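{- For every odd prime $p>2$, \[ \sum_{k=0}^{\frac{p-1}{2}}\frac{(-1)^k(172k^2+75k+9)}{2^{12k}}\binom{2k}{k}^3\binom{3k}{k}\binom{4k}{2k} \equiv 9p^2+6p^3q_p(2)-9p^4q_p(2)^2 \pmod{p^5}. \]
   Context: For an odd prime $p$, the Fermat quotient is $q_p(2)=\frac{2^{p-1}-1}{p}$. Congruences between rational numbers whose denominators are coprime to $p$ are understood in the ring of $p$-integral rationals. -}

module Defs where

open import Data.Nat.Base as ℕ using (ℕ; NonZero)
open import Data.Nat.Combinatorics using (_C_)
open import Data.Nat.Coprimality using (Coprime)
open import Data.Nat.Properties using (m^n≢0)
open import Data.Integer.Base as ℤ using (+_; -1ℤ)
open import Data.Product.Base using (∃-syntax; _×_)
open import Data.Rational.Base using (ℚ; ↧ₙ_; _/_; _-_; _*_; +-*-rawSemiring)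
open import Data.Rational.Properties using (+-0-monoid)
open import Relation.Binary.PropositionalEquality.Core using (_≡_)

open import Algebra.Definitions.RawSemiring +-*-rawSemiring using (_^_) public
open import Algebra.Properties.Monoid.Sum +-0-monoid using (sum⁺-syntax) public

fromℕ : ℕ → ℚ
fromℕ n = + n / 1

-- The denominator ↧ₙ x is the one in lowest terms.
Integral : ℕ → ℚ → Set
Integral p x = Coprime (↧ₙ x) p

-- x ≡ y (mod pⁿ) in the ring of p-integral rationals: x and y belong to the
-- ring, and x - y belongs to its ideal generated by pⁿ.
record CongruentModPower (p n : ℕ) (x y : ℚ) : Set where
  field
    integralˡ  : Integral p x
    integralʳ  : Integral p y
    difference : ∃[ z ] Integral p z × x - y ≡ fromℕ p ^ n * z

infix 4 CongruentModPower
syntax CongruentModPower p n x y = x ≡ y [mod p ^ n ]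

fermatQuotient : (p : ℕ) .{{_ : NonZero p}} → ℕ → ℚ
fermatQuotient p a = (+ (a ℕ.^ (p ℕ.∸ 1)) ℤ.- + 1) / p

summand : ℕ → ℚ
summand k =
  ( (-1ℤ ℤ.^ k)
    ℤ.* + (172 ℕ.* k ℕ.^ 2 ℕ.+ 75 ℕ.* k ℕ.+ 9)
    ℤ.* + (((2 ℕ.* k) C k) ℕ.^ 3)
    ℤ.* + ((3 ℕ.* k) C k)
    ℤ.* + ((4 ℕ.* k) C (2 ℕ.* k))
  ) / (2 ℕ.^ (12 ℕ.* k))
  where instance _ = m^n≢0 2 (12 ℕ.* k)

{-# OPTIONS --safe #-}
-- Let N = (p − 1)/2.  Dougall's ₅H₅ sum gives a WZ pair which turns the sum of the
-- theorem into a sum of terms T(i, j) over i + j = N (defined as term below).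
-- If i, j ≥ 1 then p⁴ divides T(i, j), and T(i, j)/p⁴ is congruent modulo p to
-- a constant times (4j + 1) ((i − 1)! (j − 1)!)²; these cancel in pairs
-- (i, j) ↔ (j, i).  With Π(y) = ∏_{1 ≤ l ≤ N} (1 + y/l), the two other terms are
--   T(N, 0) = 12 p² (2p + 1)/(p + 1)² · (Π(p/2) Π(−p/2))²,
--   T(0, N) = 3 p² (4p² − 1) · Π(−p/2)⁵ Π(p/2) Π(p)/Π(−p)².
-- For p > 3 the sum of 1/l² over 1 ≤ l ≤ N vanishes modulo p, hence modulo p³
--   Π(p/2) Π(−p/2) ≡ 1,  Π(p) Π(−p) ≡ 1,  Π(−p/2)² ≡ Π(−p).
-- Together with the identity Π(−p) = 2^{p−1} Π(−p/2) this gives Π(p) ≡ 4^{1−p}.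
module Submission where

open import Defs
open import Data.Nat.Base as ℕ using (ℕ; zero; suc; NonZero; _!; s≤s; z≤n)
open import Data.Nat.Combinatorics using (_C_; nCk≡n!/k![n-k]!; k![n∸k]!∣n!)
open import Data.Nat.Coprimality as Coprimality using (Coprime; coprime-divisor; 1-coprimeTo)
open import Data.Nat.Divisibility using (_∣_; _∤_; divides; ∣-trans; >⇒∤; m∣m*n)
open import Data.Nat.DivMod using (m/n*n≡m; m*n/n≡m)
open import Data.Nat.Primality using (Prime; prime⇒nonZero; prime⇒nonTrivial; prime⇒irreducible; euclidsLemma)
import Data.Nat.Properties as ℕₚ
import Data.Nat.Tactic.RingSolver as ℕ-Solver
open import Data.Fin.Base using (toℕ)
open import Data.Integer.Base as ℤ using (ℤ; +_; -1ℤ)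
import Data.Integer.Properties as ℤₚ
import Data.Integer.Tactic.RingSolver as ℤ-Solver
open import Data.Product.Base using (∃; _,_)
open import Data.Rational.Base using (ℚ; mkℚ; _+_; _-_; _*_; -_; _/_; 0ℚ; 1ℚ; toℚᵘ)
import Data.Rational.Properties as ℚₚ
import Data.Rational.Unnormalised.Base as ℚᵘ
import Data.Rational.Unnormalised.Properties as ℚᵘₚ
open import Data.Sum.Base using (_⊎_; inj₁; inj₂; [_,_]′)
open import Level using (0ℓ)
open import Relation.Binary.PropositionalEquality using (_≡_; refl; sym; trans; cong; cong₂; subst; module ≡-Reasoning)
open import Relation.Nullary.Decidable.Core using (dec⇒maybe)
open import Relation.Nullary.Negation.Core using (contradiction)
open import Tactic.RingSolver using (solve-∀)
open import Tactic.RingSolver.Core.AlmostCommutativeRing using (AlmostCommutativeRing; fromCommutativeRing)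

open ≡-Reasoning

-- The obstacle is that the given sum shows no divisibility: its summand at k = 0 is 9, so the
-- congruence cannot be read off term by term. On the antidiagonal every term carries at least p².
-- Once that power is split off, the two ends are wanted only modulo p³, and the interior, which
-- carries p⁴, only modulo p. The two sums agree for every natural N, prime or not: when N grows by
-- one, the WZ equation telescopes along the antidiagonal, and what is left at its boundary is
-- exactly the next summand. Each use of the WZ pair reduces to a polynomial identity after division
-- by a common hypergeometric factor. The powers of p become visible by writing the factorials and
-- products of odd numbers around p as products of p ± l and p ± 2l. The prime 3 stays outside the
-- general argument because the vanishing of the sum of inverse squares requires 3 to be invertible.

ℚ-ring : AlmostCommutativeRing 0ℓ 0ℓ
ℚ-ring = fromCommutativeRing ℚₚ.+-*-commutativeRing (λ x → dec⇒maybe (0ℚ ℚₚ.≟ x))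

-- The embeddings of ℕ and ℤ in ℚ, and inverses of naturals

fromℤ : ℤ → ℚ
fromℤ a = a / 1

toℚᵘ-/ : ∀ a d → toℚᵘ (a / suc d) ℚᵘ.≃ ℚᵘ.mkℚᵘ a d
toℚᵘ-/ a d = ℚₚ.toℚᵘ-fromℚᵘ (ℚᵘ.mkℚᵘ a d)

fromℤ-+ : ∀ a b → fromℤ (a ℤ.+ b) ≡ fromℤ a + fromℤ b
fromℤ-+ a b = ℚₚ.toℚᵘ-injective (ℚᵘₚ.≃-trans (toℚᵘ-/ (a ℤ.+ b) 0) (ℚᵘₚ.≃-sym
  (ℚᵘₚ.≃-trans (ℚₚ.toℚᵘ-homo-+ (fromℤ a) (fromℤ b))
  (ℚᵘₚ.≃-trans (ℚᵘₚ.+-cong (toℚᵘ-/ a 0) (toℚᵘ-/ b 0)) (ℚᵘ.*≡* (eq a b))))))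
  where
  eq : ∀ a b → (a ℤ.* + 1 ℤ.+ b ℤ.* + 1) ℤ.* + 1 ≡ (a ℤ.+ b) ℤ.* + 1
  eq = ℤ-Solver.solve-∀

fromℤ-* : ∀ a b → fromℤ (a ℤ.* b) ≡ fromℤ a * fromℤ b
fromℤ-* a b = ℚₚ.toℚᵘ-injective (ℚᵘₚ.≃-trans (toℚᵘ-/ (a ℤ.* b) 0) (ℚᵘₚ.≃-sym
  (ℚᵘₚ.≃-trans (ℚₚ.toℚᵘ-homo-* (fromℤ a) (fromℤ b))
  (ℚᵘₚ.≃-trans (ℚᵘₚ.*-cong (toℚᵘ-/ a 0) (toℚᵘ-/ b 0)) (ℚᵘ.*≡* refl)))))

fromℤ-neg : ∀ a → fromℤ (ℤ.- a) ≡ - fromℤ a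
fromℤ-neg (+ zero)   = refl
fromℤ-neg (+ suc n)  = refl
fromℤ-neg ℤ.-[1+ n ] = neg-involutive (fromℕ (suc n))
  where
  neg-involutive : ∀ x → x ≡ - (- x)
  neg-involutive = solve-∀ ℚ-ring

fromℕ-+ : ∀ m n → fromℕ (m ℕ.+ n) ≡ fromℕ m + fromℕ n
fromℕ-+ m n = fromℤ-+ (+ m) (+ n)

fromℕ-* : ∀ m n → fromℕ (m ℕ.* n) ≡ fromℕ m * fromℕ n
fromℕ-* m n = trans (cong fromℤ (ℤₚ.pos-* m n)) (fromℤ-* (+ m) (+ n))

fromℕ-suc : ∀ n → fromℕ (suc n) ≡ fromℕ n + 1ℚ
fromℕ-suc n = trans (fromℕ-+ 1 n) (ℚₚ.+-comm 1ℚ (fromℕ n))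

/-*-cancel : ∀ a d .{{_ : NonZero d}} → (a / d) * fromℕ d ≡ fromℤ a
/-*-cancel a (suc d) = ℚₚ.toℚᵘ-injective
  (ℚᵘₚ.≃-trans (ℚₚ.toℚᵘ-homo-* (a / suc d) (fromℕ (suc d)))
  (ℚᵘₚ.≃-trans (ℚᵘₚ.*-cong (toℚᵘ-/ a d) (toℚᵘ-/ (+ suc d) 0))
  (ℚᵘₚ.≃-trans (ℚᵘ.*≡* (eq a (+ suc d))) (ℚᵘₚ.≃-sym (toℚᵘ-/ a 0)))))
  where
  eq : ∀ a b → (a ℤ.* b) ℤ.* + 1 ≡ a ℤ.* (b ℤ.* + 1)
  eq = ℤ-Solver.solve-∀

-- The value at 0 is junk.
inv : ℕ → ℚ
inv zero    = 0ℚ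
inv (suc n) = + 1 / suc n

inv-cancel : ∀ n .{{_ : NonZero n}} → inv n * fromℕ n ≡ 1ℚ
inv-cancel (suc n) = /-*-cancel (+ 1) (suc n)

*-cancelʳ-fromℕ : ∀ n .{{_ : NonZero n}} {x y} → x * fromℕ n ≡ y * fromℕ n → x ≡ y
*-cancelʳ-fromℕ n {x} {y} eq = begin
  x                      ≡⟨ expand x ⟩
  x * fromℕ n * inv n    ≡⟨ cong (_* inv n) eq ⟩
  y * fromℕ n * inv n    ≡⟨ expand y ⟨
  y                      ∎
  where
  regroup : ∀ z a b → z * (b * a) ≡ z * a * b
  regroup = solve-∀ ℚ-ring
  expand : ∀ z → z ≡ z * fromℕ n * inv n
  expand z = trans (sym (trans (cong (z *_) (inv-cancel n)) (ℚₚ.*-identityʳ z)))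
                   (regroup z (fromℕ n) (inv n))

inv-factor : ∀ m n .{{_ : NonZero m}} .{{_ : NonZero n}} → inv n ≡ inv (m ℕ.* n) * fromℕ m
inv-factor m n = *-cancelʳ-fromℕ n (begin
  inv n * fromℕ n                        ≡⟨ inv-cancel n ⟩
  1ℚ                                     ≡⟨ inv-cancel (m ℕ.* n) {{ℕₚ.m*n≢0 m n}} ⟨
  inv (m ℕ.* n) * fromℕ (m ℕ.* n)        ≡⟨ cong (inv (m ℕ.* n) *_) (fromℕ-* m n) ⟩
  inv (m ℕ.* n) * (fromℕ m * fromℕ n)    ≡⟨ ℚₚ.*-assoc (inv (m ℕ.* n)) (fromℕ m) (fromℕ n) ⟨
  inv (m ℕ.* n) * fromℕ m * fromℕ n      ∎)

fromℕ-2* : ∀ n → fromℕ (2 ℕ.* n) ≡ fromℕ 2 * fromℕ n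
fromℕ-2* = fromℕ-* 2

-- Factorials, products of odd numbers, and their inverses

odd‼ : ℕ → ℕ
odd‼ zero    = 1
odd‼ (suc n) = suc (2 ℕ.* n) ℕ.* odd‼ n

odd‼≢0 : ∀ n → NonZero (odd‼ n)
odd‼≢0 zero    = _
odd‼≢0 (suc n) = ℕₚ.m*n≢0 (suc (2 ℕ.* n)) (odd‼ n) {{_}} {{odd‼≢0 n}}

fromℕ-odd : ∀ n → fromℕ (suc (2 ℕ.* n)) ≡ fromℕ 2 * fromℕ n + 1ℚ
fromℕ-odd n = trans (fromℕ-suc (2 ℕ.* n)) (cong (_+ 1ℚ) (fromℕ-2* n))

-- Opaque, here and for monomial below, so that arguments can be inferred from values.
opaque
  fac fac⁻¹ dfac dfac⁻¹ : ℕ → ℚ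
  fac n    = fromℕ (n !)
  fac⁻¹ n  = inv (n !)
  dfac n   = fromℕ (odd‼ n)
  dfac⁻¹ n = inv (odd‼ n)

  fac-cancel : ∀ n → fac⁻¹ n * fac n ≡ 1ℚ
  fac-cancel n = inv-cancel (n !) {{ℕₚ._!≢0 n}}

  dfac-cancel : ∀ n → dfac⁻¹ n * dfac n ≡ 1ℚ
  dfac-cancel n = inv-cancel (odd‼ n) {{odd‼≢0 n}}

  fac-def : ∀ n → fac n ≡ fromℕ (n !)
  fac-def n = refl

  fac⁻¹-def : ∀ n → fac⁻¹ n ≡ inv (n !)
  fac⁻¹-def n = refl

  dfac-def : ∀ n → dfac n ≡ fromℕ (odd‼ n)
  dfac-def n = refl

  dfac⁻¹-def : ∀ n → dfac⁻¹ n ≡ inv (odd‼ n)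
  dfac⁻¹-def n = refl

  -- The factor is a free variable x so that callers can supply it as a linear
  -- form in their own variables.
  fac-step : ∀ {m n x} → m ≡ suc n → fromℕ n + 1ℚ ≡ x → fac m ≡ fac n * x
  fac-step {n = n} refl refl = trans (fromℕ-* (suc n) (n !))
    (trans (ℚₚ.*-comm (fromℕ (suc n)) (fac n)) (cong (fac n *_) (fromℕ-suc n)))

  fac⁻¹-step : ∀ {m n x} → m ≡ suc n → fromℕ n + 1ℚ ≡ x → fac⁻¹ n ≡ fac⁻¹ m * x
  fac⁻¹-step {n = n} refl refl = trans (inv-factor (suc n) (n !) {{_}} {{ℕₚ._!≢0 n}})
    (cong (fac⁻¹ (suc n) *_) (fromℕ-suc n))

  dfac-step : ∀ {m n x} → m ≡ suc n → fromℕ 2 * fromℕ n + 1ℚ ≡ x → dfac m ≡ dfac n * x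
  dfac-step {n = n} refl refl = trans (fromℕ-* (suc (2 ℕ.* n)) (odd‼ n))
    (trans (ℚₚ.*-comm (fromℕ (suc (2 ℕ.* n))) (dfac n)) (cong (dfac n *_) (fromℕ-odd n)))

  dfac⁻¹-step : ∀ {m n x} → m ≡ suc n → fromℕ 2 * fromℕ n + 1ℚ ≡ x → dfac⁻¹ n ≡ dfac⁻¹ m * x
  dfac⁻¹-step {n = n} refl refl = trans (inv-factor (suc (2 ℕ.* n)) (odd‼ n) {{_}} {{odd‼≢0 n}})
    (cong (dfac⁻¹ (suc n) *_) (fromℕ-odd n))

fac-suc : ∀ n → fac (suc n) ≡ fac n * (fromℕ n + 1ℚ)
fac-suc n = fac-step refl refl

dfac-suc : ∀ n → dfac (suc n) ≡ dfac n * (fromℕ 2 * fromℕ n + 1ℚ)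
dfac-suc n = dfac-step refl refl

-- The WZ pair

infix 4 _is_times_
infixr 5 _⨾_
infixl 6 _⊛_

-- A record rather than a plain equation, so that a, b and x can be inferred.
record _is_times_ (a b x : ℚ) : Set where
  constructor scaled
  field equation : a ≡ b * x
open _is_times_

unscaled : ∀ {a} → a is a times 1ℚ
unscaled {a} = scaled (sym (ℚₚ.*-identityʳ a))

_⨾_ : ∀ {a b c x y} → a is b times x → b is c times y → a is c times (y * x)
_⨾_ {c = c} {x} {y} (scaled p) (scaled q) =
  scaled (trans p (trans (cong (_* x) q) (ℚₚ.*-assoc c y x)))

at : ∀ {A : Set} (f : A → ℚ) {m n} → m ≡ n → f m is f n times 1ℚ
at f refl = unscaled

_⊛_ : ∀ {a b x c d y} → a is b times x → c is d times y → a * c is b * d times (x * y)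
_⊛_ {b = b} {x} {d = d} {y} (scaled refl) (scaled refl) = scaled (interchange b x d y)
  where
  interchange : ∀ b x d y → (b * x) * (d * y) ≡ (b * d) * (x * y)
  interchange = solve-∀ ℚ-ring

-- All indices in the WZ pair are kept in this shape: shifting `i` or `j` then only changes the
-- constant `c`, and the rational value of the index is a linear form that the ring solver can
-- handle.
lin : (a b c i j : ℕ) → ℕ
lin a b c i j = a ℕ.* i ℕ.+ b ℕ.* j ℕ.+ c

linℚ : (a b c : ℕ) → ℚ → ℚ → ℚ
linℚ a b c I J = fromℕ a * I + fromℕ b * J + fromℕ c

module _ (a b c i j : ℕ) where
  private
    I J : ℚ
    I = fromℕ i
    J = fromℕ j

  lin-suc : lin a b (suc c) i j ≡ suc (lin a b c i j)
  lin-suc = ℕₚ.+-suc _ c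

  lin-sucˡ : lin a b c (suc i) j ≡ lin a b (a ℕ.+ c) i j
  lin-sucˡ = eq a b c i j
    where
    eq : ∀ a b c i j → a ℕ.* suc i ℕ.+ b ℕ.* j ℕ.+ c ≡ a ℕ.* i ℕ.+ b ℕ.* j ℕ.+ (a ℕ.+ c)
    eq = ℕ-Solver.solve-∀

  lin-sucʳ : lin a b c i (suc j) ≡ lin a b (b ℕ.+ c) i j
  lin-sucʳ = eq a b c i j
    where
    eq : ∀ a b c i j → a ℕ.* i ℕ.+ b ℕ.* suc j ℕ.+ c ≡ a ℕ.* i ℕ.+ b ℕ.* j ℕ.+ (b ℕ.+ c)
    eq = ℕ-Solver.solve-∀

  fromℕ-lin : fromℕ (lin a b c i j) ≡ linℚ a b c I J
  fromℕ-lin = trans (fromℕ-+ (a ℕ.* i ℕ.+ b ℕ.* j) c)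
    (cong (_+ fromℕ c) (trans (fromℕ-+ (a ℕ.* i) (b ℕ.* j)) (cong₂ _+_ (fromℕ-* a i) (fromℕ-* b j))))

  fac-lin : fac (lin a b (suc c) i j) is fac (lin a b c i j) times (linℚ a b c I J + 1ℚ)
  fac-lin = scaled (fac-step lin-suc (cong (_+ 1ℚ) fromℕ-lin))

  fac⁻¹-lin : fac⁻¹ (lin a b c i j) is fac⁻¹ (lin a b (suc c) i j) times (linℚ a b c I J + 1ℚ)
  fac⁻¹-lin = scaled (fac⁻¹-step lin-suc (cong (_+ 1ℚ) fromℕ-lin))

  dfac-lin : dfac (lin a b (suc c) i j) is dfac (lin a b c i j) times (fromℕ 2 * linℚ a b c I J + 1ℚ)
  dfac-lin = scaled (dfac-step lin-suc (cong (λ x → fromℕ 2 * x + 1ℚ) fromℕ-lin))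

  dfac⁻¹-lin : dfac⁻¹ (lin a b c i j) is dfac⁻¹ (lin a b (suc c) i j) times (fromℕ 2 * linℚ a b c I J + 1ℚ)
  dfac⁻¹-lin = scaled (dfac⁻¹-step lin-suc (cong (λ x → fromℕ 2 * x + 1ℚ) fromℕ-lin))

-¼ ¹/₁₆ : ℚ
-¼ = - (+ 1 / 4)
¹/₁₆ = + 1 / 16

opaque
  -- One shape shared by all hypergeometric terms of the proof, with the squares built in: the ratio
  -- of two such terms is then assembled from the ratios of the eleven slots.
  monomial : (c d₁ d₂ f d₃ d₄ e₁ e₂ e₃ e₄ e₅ : ℚ) → ℚ
  monomial c d₁ d₂ f d₃ d₄ e₁ e₂ e₃ e₄ e₅ =
    c * (d₁ * d₂ * f * (d₃ * d₃) * d₄) * (e₁ * e₁ * e₂ * (e₃ * e₃) * e₄ * (e₅ * e₅))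

  monomial-def : ∀ c d₁ d₂ f d₃ d₄ e₁ e₂ e₃ e₄ e₅ → monomial c d₁ d₂ f d₃ d₄ e₁ e₂ e₃ e₄ e₅
    ≡ c * (d₁ * d₂ * f * (d₃ * d₃) * d₄) * (e₁ * e₁ * e₂ * (e₃ * e₃) * e₄ * (e₅ * e₅))
  monomial-def _ _ _ _ _ _ _ _ _ _ _ = refl

  monomial-scale : ∀ {c c′ k d₁ d₁′ x₁ d₂ d₂′ x₂ f f′ y d₃ d₃′ x₃ d₄ d₄′ x₄ e₁ e₁′ z₁ e₂ e₂′ z₂ e₃ e₃′ z₃ e₄ e₄′ z₄ e₅ e₅′ z₅} →
    c′ is c times k → d₁′ is d₁ times x₁ → d₂′ is d₂ times x₂ → f′ is f times y →
    d₃′ is d₃ times x₃ → d₄′ is d₄ times x₄ → e₁′ is e₁ times z₁ → e₂′ is e₂ times z₂ →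
    e₃′ is e₃ times z₃ → e₄′ is e₄ times z₄ → e₅′ is e₅ times z₅ →
    monomial c′ d₁′ d₂′ f′ d₃′ d₄′ e₁′ e₂′ e₃′ e₄′ e₅′
      is monomial c d₁ d₂ f d₃ d₄ e₁ e₂ e₃ e₄ e₅ times
        (k * (x₁ * x₂ * y * (x₃ * x₃) * x₄) * (z₁ * z₁ * z₂ * (z₃ * z₃) * z₄ * (z₅ * z₅)))
  monomial-scale c d₁ d₂ f d₃ d₄ e₁ e₂ e₃ e₄ e₅ =
    c ⊛ (d₁ ⊛ d₂ ⊛ f ⊛ (d₃ ⊛ d₃) ⊛ d₄) ⊛ (e₁ ⊛ e₁ ⊛ e₂ ⊛ (e₃ ⊛ e₃) ⊛ e₄ ⊛ (e₅ ⊛ e₅))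

-- With N = i + j and (½)ₙ = odd‼ n / 2ⁿ this is
--   24 (−1)ʲ (4j + 1) (½)_{N+i+1} (½)_j (2N + j + 1)! (½)²_{N+1} (½)_{2N+2}
--   divided by (½)²_{i+1} j! (N + j + 1)!² (2N + 1)! N!².
term : ℕ → ℕ → ℚ
term i j = monomial (fromℕ 3 * (-¼ ^ j * ¹/₁₆ ^ (i ℕ.+ j)) * (fromℕ 4 * fromℕ j + 1ℚ))
  (dfac (lin 2 1 1 i j)) (dfac (lin 0 1 0 i j)) (fac (lin 2 3 1 i j))
  (dfac (lin 1 1 1 i j)) (dfac (lin 2 2 2 i j))
  (dfac⁻¹ (lin 1 0 1 i j)) (fac⁻¹ (lin 0 1 0 i j)) (fac⁻¹ (lin 1 2 1 i j))
  (fac⁻¹ (lin 2 2 1 i j)) (fac⁻¹ (lin 1 1 0 i j))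

-- Found by applying Gosper's algorithm in j to term (N + 1 − j) j − term (N − j) j.
certPoly : ℚ → ℚ → ℚ
certPoly N K = (fromℕ 2 * (K * K) - K) * (fromℕ 48 * (N * N) + fromℕ 118 * N + fromℕ 73)
  - fromℕ 2 * (N + 1ℚ) * (fromℕ 2 * N + fromℕ 3) * (fromℕ 60 * (N * N) + fromℕ 146 * N + fromℕ 89)

-- The WZ mate of `term`. With F(N, j) = `term (N − j) j` and G(N, j) = `cert (N − j) j`, the pair
-- satisfies F(N + 1, j) - F(N, j) = G(N, j) - G(N, j - 1).
cert : ℕ → ℕ → ℚ
cert i j = monomial (- (fromℕ 3 * ¹/₁₆ * (-¼ ^ j * ¹/₁₆ ^ (i ℕ.+ j)) * certPoly (fromℕ i + fromℕ j) (fromℕ j + 1ℚ)))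
  (dfac (lin 2 1 1 i j)) (dfac (lin 0 1 1 i j)) (fac (lin 2 3 2 i j))
  (dfac (lin 1 1 1 i j)) (dfac (lin 2 2 2 i j))
  (dfac⁻¹ (lin 1 0 1 i j)) (fac⁻¹ (lin 0 1 0 i j)) (fac⁻¹ (lin 1 2 2 i j))
  (fac⁻¹ (lin 2 2 2 i j)) (fac⁻¹ (lin 1 1 1 i j))

-- A common divisor of the four members of the WZ equation: each factorial above the fraction bar
-- has the lowest index that occurs among them, each one below it the highest. All four are
-- therefore polynomial multiples of it.
common : ℕ → ℕ → ℚ
common i j = monomial (fromℕ 3 * ¹/₁₆ * (-¼ ^ j * ¹/₁₆ ^ (i ℕ.+ j)))
  (dfac (lin 2 1 1 i j)) (dfac (lin 0 1 0 i j)) (fac (lin 2 3 1 i j))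
  (dfac (lin 1 1 1 i j)) (dfac (lin 2 2 2 i j))
  (dfac⁻¹ (lin 1 0 2 i j)) (fac⁻¹ (lin 0 1 0 i j)) (fac⁻¹ (lin 1 2 2 i j))
  (fac⁻¹ (lin 2 2 3 i j)) (fac⁻¹ (lin 1 1 1 i j))

module _ (i j : ℕ) where
  private
    I J : ℚ
    I = fromℕ i
    J = fromℕ j

  -- The factor `_` is inferred from the proof, as the product of single-step ratios in the order
  -- fixed by `monomial`.
  term-scale : term i j is common i j times _
  -- The 16 undoes the ¹/₁₆ that `common` contains to match `term (suc i) j`.
  term-scale = monomial-scale {k = fromℕ 16 * (fromℕ 4 * J + 1ℚ)}
    (scaled (eq (-¼ ^ j * ¹/₁₆ ^ (i ℕ.+ j)) (fromℕ 4 * J + 1ℚ)))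
    unscaled unscaled unscaled unscaled unscaled
    (dfac⁻¹-lin 1 0 1 i j) unscaled (fac⁻¹-lin 1 2 1 i j)
    (fac⁻¹-lin 2 2 1 i j ⨾ fac⁻¹-lin 2 2 2 i j) (fac⁻¹-lin 1 1 0 i j)
    where
    eq : ∀ s k → fromℕ 3 * s * k ≡ fromℕ 3 * (+ 1 / 16) * s * (fromℕ 16 * k)
    eq = solve-∀ ℚ-ring

  term-suc-scale : term (suc i) j is common i j times _
  term-suc-scale = monomial-scale {k = fromℕ 4 * J + 1ℚ}
    (scaled (eq (-¼ ^ j) (¹/₁₆ ^ (i ℕ.+ j)) (fromℕ 4 * J + 1ℚ)))
    (at dfac (lin-sucˡ 2 1 1 i j) ⨾ dfac-lin 2 1 2 i j ⨾ dfac-lin 2 1 1 i j)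
    unscaled
    (at fac (lin-sucˡ 2 3 1 i j) ⨾ fac-lin 2 3 2 i j ⨾ fac-lin 2 3 1 i j)
    (at dfac (lin-sucˡ 1 1 1 i j) ⨾ dfac-lin 1 1 1 i j)
    (at dfac (lin-sucˡ 2 2 2 i j) ⨾ dfac-lin 2 2 3 i j ⨾ dfac-lin 2 2 2 i j)
    (at dfac⁻¹ (lin-sucˡ 1 0 1 i j)) unscaled (at fac⁻¹ (lin-sucˡ 1 2 1 i j))
    (at fac⁻¹ (lin-sucˡ 2 2 1 i j)) (at fac⁻¹ (lin-sucˡ 1 1 0 i j))
    where
    eq : ∀ V W k → fromℕ 3 * (V * ((+ 1 / 16) * W)) * k ≡ fromℕ 3 * (+ 1 / 16) * (V * W) * k
    eq = solve-∀ ℚ-ring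

  cert-scale : cert i j is common i j times _
  cert-scale = monomial-scale {k = - certPoly (I + J) (J + 1ℚ)}
    (scaled (eq (-¼ ^ j * ¹/₁₆ ^ (i ℕ.+ j)) (certPoly (I + J) (J + 1ℚ))))
    unscaled (dfac-lin 0 1 0 i j) (fac-lin 2 3 1 i j) unscaled unscaled
    (dfac⁻¹-lin 1 0 1 i j) unscaled unscaled (fac⁻¹-lin 2 2 2 i j) unscaled
    where
    eq : ∀ s k → - (fromℕ 3 * (+ 1 / 16) * s * k) ≡ fromℕ 3 * (+ 1 / 16) * s * (- k)
    eq = solve-∀ ℚ-ring

  cert-suc-scale : cert (suc i) j is common i (suc j) times _
  -- The 4 is the minus sign of `cert` divided by the extra factor -¼ in `-¼ ^ suc j`.
  cert-suc-scale = monomial-scale {k = fromℕ 4 * certPoly (I + (J + 1ℚ)) (J + 1ℚ)}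
    (scaled (trans
      (cong (λ x → - (fromℕ 3 * ¹/₁₆ * (-¼ ^ j * ¹/₁₆ ^ (suc i ℕ.+ j)) * certPoly x (J + 1ℚ)))
        (trans (cong (_+ J) (fromℕ-suc i)) (shift I J)))
      (trans (eq (-¼ ^ j) (¹/₁₆ ^ (suc i ℕ.+ j)) (certPoly (I + (J + 1ℚ)) (J + 1ℚ)))
      (cong (λ n → fromℕ 3 * ¹/₁₆ * (-¼ ^ suc j * ¹/₁₆ ^ n) * (fromℕ 4 * certPoly (I + (J + 1ℚ)) (J + 1ℚ)))
        (sym (ℕₚ.+-suc i j))))))
    (at dfac (lin-sucˡ 2 1 1 i j) ⨾ dfac-lin 2 1 2 i j ⨾ at dfac (sym (lin-sucʳ 2 1 1 i j)))
    (at dfac (sym (lin-sucʳ 0 1 0 i j)))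
    (at fac (trans (lin-sucˡ 2 3 2 i j) (sym (lin-sucʳ 2 3 1 i j))))
    (at dfac (trans (lin-sucˡ 1 1 1 i j) (sym (lin-sucʳ 1 1 1 i j))))
    (at dfac (trans (lin-sucˡ 2 2 2 i j) (sym (lin-sucʳ 2 2 2 i j))))
    (at dfac⁻¹ (trans (lin-sucˡ 1 0 1 i j) (sym (lin-sucʳ 1 0 2 i j))))
    (fac⁻¹-lin 0 1 0 i j ⨾ at fac⁻¹ (sym (lin-sucʳ 0 1 0 i j)))
    (at fac⁻¹ (lin-sucˡ 1 2 2 i j) ⨾ fac⁻¹-lin 1 2 3 i j ⨾ at fac⁻¹ (sym (lin-sucʳ 1 2 2 i j)))
    (at fac⁻¹ (lin-sucˡ 2 2 2 i j) ⨾ fac⁻¹-lin 2 2 4 i j ⨾ at fac⁻¹ (sym (lin-sucʳ 2 2 3 i j)))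
    (at fac⁻¹ (trans (lin-sucˡ 1 1 1 i j) (sym (lin-sucʳ 1 1 1 i j))))
    where
    shift : ∀ I J → I + 1ℚ + J ≡ I + (J + 1ℚ)
    shift = solve-∀ ℚ-ring
    eq : ∀ V W k → - (fromℕ 3 * (+ 1 / 16) * (V * W) * k)
                 ≡ fromℕ 3 * (+ 1 / 16) * ((- (+ 1 / 4) * V) * W) * (fromℕ 4 * k)
    eq = solve-∀ ℚ-ring

-- The preceding value G(N, j - 1) of the mate. The value 0 at j = 0 is the one for which the WZ
-- equation holds there too.
cert⁻ : ℕ → ℕ → ℚ
cert⁻ i zero    = 0ℚ
cert⁻ i (suc j) = cert (suc i) j

-- The quotient of `cert⁻` by `common`. Its factor `J` vanishes at j = 0, so a single polynomial
-- serves both cases of `cert⁻` and the WZ equation can be proved without a case split.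
certPoly⁻ : ℚ → ℚ → ℚ
certPoly⁻ I J = fromℕ 4 * certPoly (I + J) J * (J * (fromℕ 4 * I + fromℕ 2 * J + fromℕ 3))
  * ((I + fromℕ 2 * J + fromℕ 2) * (I + fromℕ 2 * J + fromℕ 2)) * (fromℕ 2 * (I + J) + fromℕ 3)

cert⁻-scale : ∀ i j → cert⁻ i j is common i j times certPoly⁻ (fromℕ i) (fromℕ j)
cert⁻-scale i zero    = scaled (sym (trans (cong (common i 0 *_) (eq (fromℕ i))) (ℚₚ.*-zeroʳ (common i 0))))
  where
  eq : ∀ I → let
        N = I + 0ℚ
        certPoly = (fromℕ 2 * (0ℚ * 0ℚ) - 0ℚ) * (fromℕ 48 * (N * N) + fromℕ 118 * N + fromℕ 73)
          - fromℕ 2 * (N + 1ℚ) * (fromℕ 2 * N + fromℕ 3) * (fromℕ 60 * (N * N) + fromℕ 146 * N + fromℕ 89)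
      in fromℕ 4 * certPoly * (0ℚ * (fromℕ 4 * I + fromℕ 2 * 0ℚ + fromℕ 3))
        * ((I + fromℕ 2 * 0ℚ + fromℕ 2) * (I + fromℕ 2 * 0ℚ + fromℕ 2)) * (fromℕ 2 * (I + 0ℚ) + fromℕ 3) ≡ 0ℚ
  eq = solve-∀ ℚ-ring
cert⁻-scale i (suc j) = scaled (trans (equation (cert-suc-scale i j)) (cong (common i (suc j) *_)
    (trans (eq (fromℕ i) (fromℕ j) (certPoly (fromℕ i + (fromℕ j + 1ℚ)) (fromℕ j + 1ℚ)))
           (cong (certPoly⁻ (fromℕ i)) (sym (fromℕ-suc j))))))
  where
  eq : ∀ I J k → let
        lin = λ a b c → fromℕ a * I + fromℕ b * J + fromℕ c
        K = J + 1ℚ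
      in fromℕ 4 * k
        * (1ℚ * (fromℕ 2 * lin 2 1 2 + 1ℚ) * 1ℚ * 1ℚ * 1ℚ * (1ℚ * 1ℚ) * 1ℚ)
        * (1ℚ * 1ℚ * (1ℚ * (lin 0 1 0 + 1ℚ))
          * (1ℚ * (lin 1 2 3 + 1ℚ) * 1ℚ * (1ℚ * (lin 1 2 3 + 1ℚ) * 1ℚ))
          * (1ℚ * (lin 2 2 4 + 1ℚ) * 1ℚ) * (1ℚ * 1ℚ))
      ≡ fromℕ 4 * k * (K * (fromℕ 4 * I + fromℕ 2 * K + fromℕ 3))
        * ((I + fromℕ 2 * K + fromℕ 2) * (I + fromℕ 2 * K + fromℕ 2)) * (fromℕ 2 * (I + K) + fromℕ 3)
  eq = solve-∀ ℚ-ring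

-- All four members are multiples of `common i j`; what remains after taking it out is a polynomial
-- identity in `I` and `J`.
wz-equation : ∀ i j → term (suc i) j + cert⁻ i j ≡ term i j + cert i j
wz-equation i j = begin
  term (suc i) j + cert⁻ i j        ≡⟨ cong₂ _+_ (equation (term-suc-scale i j)) (equation (cert⁻-scale i j)) ⟩
  _                          ≡⟨ ℚₚ.*-distribˡ-+ (common i j) _ _ ⟨
  _                          ≡⟨ cong (common i j *_) (polynomial-identity (fromℕ i) (fromℕ j)) ⟩
  _                          ≡⟨ ℚₚ.*-distribˡ-+ (common i j) _ _ ⟩
  _                          ≡⟨ cong₂ _+_ (equation (term-scale i j)) (equation (cert-scale i j)) ⟨
  term i j + cert i j              ∎
  where
  -- The factors are written as `monomial-scale` leaves them, each 1ℚ coming from `unscaled` or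
  -- `at`, so that they match the inferred ones by computation. `lin` and `certPoly` are spelled out
  -- so that the solver sees a polynomial.
  polynomial-identity : ∀ I J → let
        lin = λ a b c → fromℕ a * I + fromℕ b * J + fromℕ c
        certPoly = λ N K → (fromℕ 2 * (K * K) - K) * (fromℕ 48 * (N * N) + fromℕ 118 * N + fromℕ 73)
              - fromℕ 2 * (N + 1ℚ) * (fromℕ 2 * N + fromℕ 3) * (fromℕ 60 * (N * N) + fromℕ 146 * N + fromℕ 89)
      in (fromℕ 4 * J + 1ℚ)
        * ((fromℕ 2 * lin 2 1 1 + 1ℚ) * (fromℕ 2 * lin 2 1 2 + 1ℚ) * 1ℚ * 1ℚ
          * ((lin 2 3 1 + 1ℚ) * (lin 2 3 2 + 1ℚ) * 1ℚ)
          * ((fromℕ 2 * lin 1 1 1 + 1ℚ) * 1ℚ * ((fromℕ 2 * lin 1 1 1 + 1ℚ) * 1ℚ))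
          * ((fromℕ 2 * lin 2 2 2 + 1ℚ) * (fromℕ 2 * lin 2 2 3 + 1ℚ) * 1ℚ))
        * (1ℚ * 1ℚ * 1ℚ * (1ℚ * 1ℚ) * 1ℚ * (1ℚ * 1ℚ))
      + fromℕ 4 * certPoly (I + J) J * (J * (fromℕ 4 * I + fromℕ 2 * J + fromℕ 3))
        * ((I + fromℕ 2 * J + fromℕ 2) * (I + fromℕ 2 * J + fromℕ 2)) * (fromℕ 2 * (I + J) + fromℕ 3)
      ≡ fromℕ 16 * (fromℕ 4 * J + 1ℚ) * (1ℚ * 1ℚ * 1ℚ * (1ℚ * 1ℚ) * 1ℚ)
        * ((fromℕ 2 * lin 1 0 1 + 1ℚ) * (fromℕ 2 * lin 1 0 1 + 1ℚ) * 1ℚ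
          * ((lin 1 2 1 + 1ℚ) * (lin 1 2 1 + 1ℚ))
          * ((lin 2 2 2 + 1ℚ) * (lin 2 2 1 + 1ℚ))
          * ((lin 1 1 0 + 1ℚ) * (lin 1 1 0 + 1ℚ)))
      + - certPoly (I + J) (J + 1ℚ)
        * (1ℚ * (fromℕ 2 * lin 0 1 0 + 1ℚ) * (lin 2 3 1 + 1ℚ) * (1ℚ * 1ℚ) * 1ℚ)
        * ((fromℕ 2 * lin 1 0 1 + 1ℚ) * (fromℕ 2 * lin 1 0 1 + 1ℚ) * 1ℚ
          * (1ℚ * 1ℚ) * (lin 2 2 2 + 1ℚ) * (1ℚ * 1ℚ))
  polynomial-identity = solve-∀ ℚ-ring

-- Summation of the WZ equation along an antidiagonal

antidiagonal : (ℕ → ℕ → ℚ) → ℕ → ℕ → ℚ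
antidiagonal f zero    j = f zero j
antidiagonal f (suc i) j = f (suc i) j + antidiagonal f i (suc j)

-- The summed WZ equation telescopes: only the first `cert⁻` and the last `cert` survive, and
-- `term 0 (suc (i + j))` is the extra entry of the longer antidiagonal. The induction needs an
-- arbitrary starting point `j`; at j = 0 the value of `cert⁻` is 0.
antidiagonal-term-suc : ∀ i j → antidiagonal term (suc i) j + cert⁻ i j
  ≡ antidiagonal term i j + (term 0 (suc (i ℕ.+ j)) + cert 0 (i ℕ.+ j))
antidiagonal-term-suc zero j = trans (swap (term 1 j) (term 0 (suc j)) (cert⁻ 0 j))
  (trans (cong (_+ term 0 (suc j)) (wz-equation 0 j)) (swap′ (term 0 j) (cert 0 j) (term 0 (suc j))))
  where
  swap : ∀ a b c → a + b + c ≡ a + c + b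
  swap = solve-∀ ℚ-ring
  swap′ : ∀ a b c → a + b + c ≡ a + (c + b)
  swap′ = solve-∀ ℚ-ring
antidiagonal-term-suc (suc i) j = begin
  term (2 ℕ.+ i) j + A₁ + cert⁻ (suc i) j                    ≡⟨ swap (term (2 ℕ.+ i) j) A₁ (cert⁻ (suc i) j) ⟩
  term (2 ℕ.+ i) j + cert⁻ (suc i) j + A₁                    ≡⟨ cong (_+ A₁) (wz-equation (suc i) j) ⟩
  term (suc i) j + cert (suc i) j + A₁                      ≡⟨ regroup (term (suc i) j) (cert (suc i) j) A₁ ⟩
  term (suc i) j + (A₁ + cert⁻ i (suc j))                    ≡⟨ cong (_+_ (term (suc i) j)) (antidiagonal-term-suc i (suc j)) ⟩
  term (suc i) j + (antidiagonal term i (suc j) + E (i ℕ.+ suc j))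
    ≡⟨ cong (λ n → term (suc i) j + (antidiagonal term i (suc j) + E n)) (ℕₚ.+-suc i j) ⟩
  term (suc i) j + (antidiagonal term i (suc j) + E (suc i ℕ.+ j))
    ≡⟨ ℚₚ.+-assoc (term (suc i) j) (antidiagonal term i (suc j)) (E (suc i ℕ.+ j)) ⟨
  term (suc i) j + antidiagonal term i (suc j) + E (suc i ℕ.+ j) ∎
  where
  A₁ = antidiagonal term (suc i) (suc j)
  E : ℕ → ℚ
  E n = term 0 (suc n) + cert 0 n
  swap : ∀ a b c → a + b + c ≡ a + c + b
  swap = solve-∀ ℚ-ring
  regroup : ∀ a b c → a + b + c ≡ a + (c + b)
  regroup = solve-∀ ℚ-ring

-- Powers

^-distrib-* : ∀ x y n → (x * y) ^ n ≡ x ^ n * y ^ n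
^-distrib-* x y zero    = refl
^-distrib-* x y (suc n) = trans (cong (x * y *_) (^-distrib-* x y n)) (eq x y (x ^ n) (y ^ n))
  where
  eq : ∀ x y a b → x * y * (a * b) ≡ x * a * (y * b)
  eq = solve-∀ ℚ-ring

^-+ : ∀ x m n → x ^ (m ℕ.+ n) ≡ x ^ m * x ^ n
^-+ x zero    n = sym (ℚₚ.*-identityˡ (x ^ n))
^-+ x (suc m) n = trans (cong (x *_) (^-+ x m n)) (sym (ℚₚ.*-assoc x (x ^ m) (x ^ n)))

1^n≡1 : ∀ n → 1ℚ ^ n ≡ 1ℚ
1^n≡1 zero    = refl
1^n≡1 (suc n) = trans (ℚₚ.*-identityˡ (1ℚ ^ n)) (1^n≡1 n)

^-inverse : ∀ x y n → x * y ≡ 1ℚ → x ^ n * y ^ n ≡ 1ℚ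
^-inverse x y n eq = trans (sym (^-distrib-* x y n)) (trans (cong (_^ n) eq) (1^n≡1 n))

fromℕ-^ : ∀ m n → fromℕ (m ℕ.^ n) ≡ fromℕ m ^ n
fromℕ-^ m zero    = refl
fromℕ-^ m (suc n) = trans (fromℕ-* m (m ℕ.^ n)) (cong (fromℕ m *_) (fromℕ-^ m n))

fromℤ-^ : ∀ a n → fromℤ (a ℤ.^ n) ≡ fromℤ a ^ n
fromℤ-^ a zero    = refl
fromℤ-^ a (suc n) = trans (fromℤ-* a (a ℤ.^ n)) (cong (fromℤ a *_) (fromℤ-^ a n))

-- Products of odd numbers and binomial coefficients in terms of factorials

fac-2* : ∀ n → fac (2 ℕ.* n) ≡ dfac n * fromℕ 2 ^ n * fac n
fac-2* zero    = trans (fac-def 0) (sym (cong₂ (λ x y → x * 1ℚ * y) (dfac-def 0) (fac-def 0)))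
fac-2* (suc n) = begin
  fac (2 ℕ.* suc n)
    ≡⟨ fac-step (index n) (cong (_+ 1ℚ) (fromℕ-odd n)) ⟩
  fac (suc (2 ℕ.* n)) * (2n+1 + 1ℚ)
    ≡⟨ cong (_* (2n+1 + 1ℚ)) (fac-step refl (cong (_+ 1ℚ) (fromℕ-2* n))) ⟩
  fac (2 ℕ.* n) * 2n+1 * (2n+1 + 1ℚ)
    ≡⟨ cong (λ x → x * 2n+1 * (2n+1 + 1ℚ)) (fac-2* n) ⟩
  dfac n * fromℕ 2 ^ n * fac n * 2n+1 * (2n+1 + 1ℚ)
    ≡⟨ eq (dfac n) (fromℕ 2 ^ n) (fac n) (fromℕ n) ⟩
  dfac n * 2n+1 * (fromℕ 2 * fromℕ 2 ^ n) * (fac n * (fromℕ n + 1ℚ))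
    ≡⟨ cong₂ (λ x y → x * (fromℕ 2 * fromℕ 2 ^ n) * y) (dfac-suc n) (fac-suc n) ⟨
  dfac (suc n) * fromℕ 2 ^ suc n * fac (suc n) ∎
  where
  2n+1 : ℚ
  2n+1 = fromℕ 2 * fromℕ n + 1ℚ
  index : ∀ n → 2 ℕ.* suc n ≡ suc (suc (2 ℕ.* n))
  index = ℕ-Solver.solve-∀
  eq : ∀ d t f N → d * t * f * (fromℕ 2 * N + 1ℚ) * (fromℕ 2 * N + 1ℚ + 1ℚ)
     ≡ d * (fromℕ 2 * N + 1ℚ) * (fromℕ 2 * t) * (f * (N + 1ℚ))
  eq = solve-∀ ℚ-ring

dfac-via-fac : ∀ n → dfac n ≡ fac (2 ℕ.* n) * (+ 1 / 2) ^ n * fac⁻¹ n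
dfac-via-fac n = sym (begin
  fac (2 ℕ.* n) * (+ 1 / 2) ^ n * fac⁻¹ n
    ≡⟨ cong (λ x → x * (+ 1 / 2) ^ n * fac⁻¹ n) (fac-2* n) ⟩
  dfac n * fromℕ 2 ^ n * fac n * (+ 1 / 2) ^ n * fac⁻¹ n
    ≡⟨ eq (dfac n) (fromℕ 2 ^ n) (fac n) ((+ 1 / 2) ^ n) (fac⁻¹ n) ⟩
  dfac n * (fromℕ 2 ^ n * (+ 1 / 2) ^ n) * (fac⁻¹ n * fac n)
    ≡⟨ cong₂ (λ x y → dfac n * x * y) (^-inverse (fromℕ 2) (+ 1 / 2) n refl) (fac-cancel n) ⟩
  dfac n * 1ℚ * 1ℚ
    ≡⟨ trans (ℚₚ.*-identityʳ (dfac n * 1ℚ)) (ℚₚ.*-identityʳ (dfac n)) ⟩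
  dfac n ∎)
  where
  eq : ∀ d t f u e → d * t * f * u * e ≡ d * (t * u) * (e * f)
  eq = solve-∀ ℚ-ring

fromℕ-C : ∀ {k} m n → m ℕ.+ n ≡ k → fromℕ (k C m) ≡ fac k * fac⁻¹ m * fac⁻¹ n
fromℕ-C m n refl = begin
  c                                        ≡⟨ one₁ c ⟩
  c * 1ℚ * 1ℚ                              ≡⟨ cong₂ (λ x y → c * x * y) (fac-cancel m) (fac-cancel n) ⟨
  c * (fac⁻¹ m * fac m) * (fac⁻¹ n * fac n) ≡⟨ eq c (fac⁻¹ m) (fac m) (fac⁻¹ n) (fac n) ⟩
  c * (fac m * fac n) * fac⁻¹ m * fac⁻¹ n  ≡⟨ cong (λ x → x * fac⁻¹ m * fac⁻¹ n) product ⟩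
  fac (m ℕ.+ n) * fac⁻¹ m * fac⁻¹ n        ∎
  where
  c : ℚ
  c = fromℕ ((m ℕ.+ n) C m)
  one₁ : ∀ x → x ≡ x * 1ℚ * 1ℚ
  one₁ = solve-∀ ℚ-ring
  eq : ∀ c a b d e → c * (a * b) * (d * e) ≡ c * (b * e) * a * d
  eq = solve-∀ ℚ-ring
  instance
    _ = ℕₚ.m*n≢0 (m !) ((m ℕ.+ n ℕ.∸ m) !) {{ℕₚ._!≢0 m}} {{ℕₚ._!≢0 (m ℕ.+ n ℕ.∸ m)}}
  factorials : ((m ℕ.+ n) C m) ℕ.* (m ! ℕ.* n !) ≡ (m ℕ.+ n) !
  factorials = trans (cong (λ k → ((m ℕ.+ n) C m) ℕ.* (m ! ℕ.* k !)) (sym (ℕₚ.m+n∸m≡n m n)))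
    (trans (cong (ℕ._* (m ! ℕ.* (m ℕ.+ n ℕ.∸ m) !)) (nCk≡n!/k![n-k]! (ℕₚ.m≤m+n m n)))
           (m/n*n≡m (k![n∸k]!∣n! (ℕₚ.m≤m+n m n))))
  product : c * (fac m * fac n) ≡ fac (m ℕ.+ n)
  product = trans (cong (c *_) (trans (cong₂ _*_ (fac-def m) (fac-def n)) (sym (fromℕ-* (m !) (n !)))))
    (trans (sym (fromℕ-* ((m ℕ.+ n) C m) (m ! ℕ.* n !))) (trans (cong fromℕ factorials) (sym (fac-def (m ℕ.+ n)))))

-- The summand as a polynomial times a hypergeometric term

summandQuadratic : ℚ → ℚ
summandQuadratic K = fromℕ 172 * (K * K) + fromℕ 75 * K + fromℕ 9

-- In the product of binomial coefficients every (2k)! cancels, which leaves (4k)! (3k)! / k!⁷; and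
-- 4096 = 2¹².
hypergeometric : ℕ → ℚ
hypergeometric k = (- (+ 1 / 4096)) ^ k * (fac (4 ℕ.* k) * fac (3 ℕ.* k) * (e * (e * e) * (e * e) * (e * e)))
  where e = fac⁻¹ k

summand-closed : ∀ k → summand k ≡ summandQuadratic (fromℕ k) * hypergeometric k
summand-closed k = *-cancelʳ-fromℕ (2 ℕ.^ (12 ℕ.* k)) (begin
  summand k * fromℕ (2 ℕ.^ (12 ℕ.* k))
    ≡⟨ /-*-cancel z₄ (2 ℕ.^ (12 ℕ.* k)) ⟩
  fromℤ z₄
    ≡⟨ fromℤ-product ⟩
  fromℤ -1ℤ ^ k * fromℕ q * fromℕ c₂³ * fromℕ c₃ * fromℕ c₄
    ≡⟨ cong₂ (λ x y → fromℤ -1ℤ ^ k * x * y * fromℕ c₃ * fromℕ c₄) q-value c₂³-value ⟩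
  fromℤ -1ℤ ^ k * Q * (fromℕ c₂ * (fromℕ c₂ * (fromℕ c₂ * 1ℚ))) * fromℕ c₃ * fromℕ c₄
    ≡⟨ cong (λ x → fromℤ -1ℤ ^ k * Q * (x * (x * (x * 1ℚ))) * fromℕ c₃ * fromℕ c₄)
         (fromℕ-C k k (index₂ k)) ⟩
  fromℤ -1ℤ ^ k * Q * (x * (x * (x * 1ℚ))) * fromℕ c₃ * fromℕ c₄
    ≡⟨ cong₂ (λ y z → fromℤ -1ℤ ^ k * Q * (x * (x * (x * 1ℚ))) * y * z)
         (fromℕ-C k (2 ℕ.* k) (index₃ k)) (fromℕ-C (2 ℕ.* k) (2 ℕ.* k) (index₄ k)) ⟩
  fromℤ -1ℤ ^ k * Q * (x * (x * (x * 1ℚ))) * (fac (3 ℕ.* k) * e * e₂) * (fac (4 ℕ.* k) * e₂ * e₂)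
    ≡⟨ regroup (fromℤ -1ℤ ^ k) Q (fac (2 ℕ.* k)) e e₂ (fac (3 ℕ.* k)) (fac (4 ℕ.* k)) ⟩
  Q * (fromℤ -1ℤ ^ k * R) * ((e₂ * fac (2 ℕ.* k)) * (e₂ * fac (2 ℕ.* k)) * (e₂ * fac (2 ℕ.* k)))
    ≡⟨ cong (λ y → Q * (fromℤ -1ℤ ^ k * R) * (y * y * y)) (fac-cancel (2 ℕ.* k)) ⟩
  Q * (fromℤ -1ℤ ^ k * R) * (1ℚ * 1ℚ * 1ℚ)
    ≡⟨ cong (λ y → Q * (y * R) * (1ℚ * 1ℚ * 1ℚ)) (^-distrib-* (- (+ 1 / 4096)) (fromℕ 4096) k) ⟩
  Q * ((- (+ 1 / 4096)) ^ k * fromℕ 4096 ^ k * R) * (1ℚ * 1ℚ * 1ℚ)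
    ≡⟨ regroup′ Q ((- (+ 1 / 4096)) ^ k) (fromℕ 4096 ^ k) R ⟩
  Q * hypergeometric k * fromℕ 4096 ^ k
    ≡⟨ cong (Q * hypergeometric k *_) (trans (cong fromℕ (sym (ℕₚ.^-*-assoc 2 12 k))) (fromℕ-^ 4096 k)) ⟨
  Q * hypergeometric k * fromℕ (2 ℕ.^ (12 ℕ.* k)) ∎)
  where
  instance _ = ℕₚ.m^n≢0 2 (12 ℕ.* k)
  q c₂ c₂³ c₃ c₄ : ℕ
  q   = 172 ℕ.* k ℕ.^ 2 ℕ.+ 75 ℕ.* k ℕ.+ 9
  c₂  = (2 ℕ.* k) C k
  c₂³ = c₂ ℕ.^ 3
  c₃  = (3 ℕ.* k) C k
  c₄  = (4 ℕ.* k) C (2 ℕ.* k)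
  z₁ z₂ z₃ z₄ : ℤ
  z₁ = -1ℤ ℤ.^ k ℤ.* + q
  z₂ = z₁ ℤ.* + c₂³
  z₃ = z₂ ℤ.* + c₃
  z₄ = z₃ ℤ.* + c₄
  e e₂ x R Q : ℚ
  e  = fac⁻¹ k
  e₂ = fac⁻¹ (2 ℕ.* k)
  x  = fac (2 ℕ.* k) * e * e
  R  = fac (4 ℕ.* k) * fac (3 ℕ.* k) * (e * (e * e) * (e * e) * (e * e))
  Q  = summandQuadratic (fromℕ k)
  index₂ : ∀ k → k ℕ.+ k ≡ 2 ℕ.* k
  index₂ = ℕ-Solver.solve-∀
  index₃ : ∀ k → k ℕ.+ 2 ℕ.* k ≡ 3 ℕ.* k
  index₃ = ℕ-Solver.solve-∀
  index₄ : ∀ k → 2 ℕ.* k ℕ.+ 2 ℕ.* k ≡ 4 ℕ.* k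
  index₄ = ℕ-Solver.solve-∀
  fromℤ-product : fromℤ z₄
    ≡ fromℤ -1ℤ ^ k * fromℕ q * fromℕ c₂³ * fromℕ c₃ * fromℕ c₄
  fromℤ-product = trans (fromℤ-* z₃ (+ c₄)) (cong (_* fromℕ c₄)
    (trans (fromℤ-* z₂ (+ c₃)) (cong (_* fromℕ c₃)
    (trans (fromℤ-* z₁ (+ c₂³)) (cong (_* fromℕ c₂³)
    (trans (fromℤ-* (-1ℤ ℤ.^ k) (+ q)) (cong (_* fromℕ q) (fromℤ-^ -1ℤ k))))))))
  q-value : fromℕ q ≡ Q
  q-value = trans (fromℕ-+ (172 ℕ.* k ℕ.^ 2 ℕ.+ 75 ℕ.* k) 9) (cong (_+ fromℕ 9)
    (trans (fromℕ-+ (172 ℕ.* k ℕ.^ 2) (75 ℕ.* k)) (cong₂ _+_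
      (trans (fromℕ-* 172 (k ℕ.^ 2)) (cong (fromℕ 172 *_)
        (trans (fromℕ-^ k 2) (cong (fromℕ k *_) (ℚₚ.*-identityʳ (fromℕ k))))))
      (fromℕ-* 75 k))))
  c₂³-value : fromℕ c₂³ ≡ fromℕ c₂ * (fromℕ c₂ * (fromℕ c₂ * 1ℚ))
  c₂³-value = fromℕ-^ c₂ 3
  regroup : ∀ s Q f e e₂ f₃ f₄ →
    s * Q * (f * e * e * (f * e * e * (f * e * e * 1ℚ))) * (f₃ * e * e₂) * (f₄ * e₂ * e₂)
    ≡ Q * (s * (f₄ * f₃ * (e * (e * e) * (e * e) * (e * e)))) * ((e₂ * f) * (e₂ * f) * (e₂ * f))
  regroup = solve-∀ ℚ-ring
  regroup′ : ∀ Q u t R → Q * (u * t * R) * (1ℚ * 1ℚ * 1ℚ) ≡ Q * (u * R) * t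
  regroup′ = solve-∀ ℚ-ring

module _ (n : ℕ) where
  private
    k : ℕ
    k = suc n
    K d D F₃ e e₂ : ℚ
    K  = fromℕ k
    d  = dfac k
    D  = dfac (2 ℕ.* k)
    F₃ = fac (3 ℕ.* k)
    e  = fac⁻¹ k
    e₂ = fac⁻¹ (2 ℕ.* k)

    B : ℚ
    B = -¼ ^ k * ¹/₁₆ ^ k * (d * d * (d * d) * D * F₃ * (e * e * e) * (e₂ * e₂ * e₂))

  -- `B` has the slots of `term 0 k`. Expressing odd products by factorials costs (1/2)ᵏ for each of
  -- the four copies of `dfac k` and (1/2)²ᵏ for `dfac (2k)`; together with -¼ and ¹/₁₆ this makes
  -- -1/(4 · 16 · 64) = -1/4096.
  B≡hypergeometric : B ≡ hypergeometric k
  B≡hypergeometric = begin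
    -¼ ^ k * ¹/₁₆ ^ k * (d * d * (d * d) * D * F₃ * (e * e * e) * (e₂ * e₂ * e₂))
      ≡⟨ cong₂ (λ x y → -¼ ^ k * ¹/₁₆ ^ k * (x * x * (x * x) * y * F₃ * (e * e * e) * (e₂ * e₂ * e₂)))
           (dfac-via-fac k) D-value ⟩
    -¼ ^ k * ¹/₁₆ ^ k * (x * x * (x * x) * (fac (4 ℕ.* k) * (h * h) * e₂) * F₃ * (e * e * e) * (e₂ * e₂ * e₂))
      ≡⟨ regroup (-¼ ^ k) (¹/₁₆ ^ k) (fac (2 ℕ.* k)) h e (fac (4 ℕ.* k)) e₂ F₃ ⟩
    -¼ ^ k * ¹/₁₆ ^ k * (h * (h * (h * (h * (h * h))))) * R * (y * y * (y * y))
      ≡⟨ cong (λ y → -¼ ^ k * ¹/₁₆ ^ k * (h * (h * (h * (h * (h * h))))) * R * (y * y * (y * y)))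
           (fac-cancel (2 ℕ.* k)) ⟩
    -¼ ^ k * ¹/₁₆ ^ k * (h * (h * (h * (h * (h * h))))) * R * (1ℚ * 1ℚ * (1ℚ * 1ℚ))
      ≡⟨ ℚₚ.*-identityʳ _ ⟩
    -¼ ^ k * ¹/₁₆ ^ k * (h * (h * (h * (h * (h * h))))) * R
      ≡⟨ cong (_* R) powers ⟩
    (- (+ 1 / 4096)) ^ k * R ∎
    where
    h x y R : ℚ
    h = (+ 1 / 2) ^ k
    x = fac (2 ℕ.* k) * h * fac⁻¹ k
    y = e₂ * fac (2 ℕ.* k)
    R = fac (4 ℕ.* k) * fac (3 ℕ.* k) * (e * (e * e) * (e * e) * (e * e))
    index : ∀ k → 2 ℕ.* (2 ℕ.* k) ≡ 4 ℕ.* k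
    index = ℕ-Solver.solve-∀
    D-value : D ≡ fac (4 ℕ.* k) * (h * h) * e₂
    D-value = trans (dfac-via-fac (2 ℕ.* k)) (cong₂ (λ m t → fac m * t * e₂) (index k) half-power)
      where
      half-power : (+ 1 / 2) ^ (2 ℕ.* k) ≡ h * h
      half-power = trans (^-+ (+ 1 / 2) k (k ℕ.+ 0)) (cong (λ m → h * (+ 1 / 2) ^ m) (ℕₚ.+-identityʳ k))
    regroup : ∀ V W f h e f₄ e₂ F₃ →
      V * W * ((f * h * e) * (f * h * e) * ((f * h * e) * (f * h * e)) * (f₄ * (h * h) * e₂) * F₃
        * (e * e * e) * (e₂ * e₂ * e₂))
      ≡ V * W * (h * (h * (h * (h * (h * h))))) * (f₄ * F₃ * (e * (e * e) * (e * e) * (e * e)))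
        * ((e₂ * f) * (e₂ * f) * ((e₂ * f) * (e₂ * f)))
    regroup = solve-∀ ℚ-ring
    powers : -¼ ^ k * ¹/₁₆ ^ k * (h * (h * (h * (h * (h * h))))) ≡ (- (+ 1 / 4096)) ^ k
    powers = begin
      -¼ ^ k * ¹/₁₆ ^ k * (h * (h * (h * (h * (h * h)))))
        ≡⟨ cong (-¼ ^ k * ¹/₁₆ ^ k *_) (sym (collect (+ 1 / 32) (collect (+ 1 / 16) (collect (+ 1 / 8) (collect (+ 1 / 4) (^-distrib-* (+ 1 / 2) (+ 1 / 2) k)))))) ⟩
      -¼ ^ k * ¹/₁₆ ^ k * (+ 1 / 64) ^ k
        ≡⟨ cong (_* (+ 1 / 64) ^ k) (^-distrib-* -¼ ¹/₁₆ k) ⟨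
      (-¼ * ¹/₁₆) ^ k * (+ 1 / 64) ^ k
        ≡⟨ ^-distrib-* (-¼ * ¹/₁₆) (+ 1 / 64) k ⟨
      (- (+ 1 / 4096)) ^ k ∎
      where
      collect : ∀ x {b} → x ^ k ≡ b → ((+ 1 / 2) * x) ^ k ≡ h * b
      collect x refl = ^-distrib-* (+ 1 / 2) x k

-- The boundary contribution of the WZ equation is the summand

module _ (n : ℕ) where
  private
    k : ℕ
    k = suc n
    N K : ℚ
    N = fromℕ n
    K = fromℕ k

    -- Plays the part of `common` for `term 0 k`, `cert 0 n` and `hypergeometric k`. The slot 1ℚ
    -- stands for `dfac⁻¹ 1`.
    base : ℚ
    base = monomial (-¼ ^ k * ¹/₁₆ ^ k) (dfac k) (dfac k) (fac (2 ℕ.+ 3 ℕ.* n)) (dfac k) (dfac (2 ℕ.* k))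
      1ℚ (fac⁻¹ k) (fac⁻¹ (suc (2 ℕ.* k))) (fac⁻¹ (suc (2 ℕ.* k))) (fac⁻¹ k)

    index₂ : ∀ n → 2 ℕ.* suc n ≡ suc (suc (2 ℕ.* n))
    index₂ = ℕ-Solver.solve-∀
    index₃ : ∀ n → 3 ℕ.* suc n ≡ suc (2 ℕ.+ 3 ℕ.* n)
    index₃ = ℕ-Solver.solve-∀
    i211 : ∀ n → 2 ℕ.* 0 ℕ.+ 1 ℕ.* n ℕ.+ 1 ≡ suc n
    i211 = ℕ-Solver.solve-∀
    i010 : ∀ n → 0 ℕ.* 0 ℕ.+ 1 ℕ.* n ℕ.+ 0 ≡ n
    i010 = ℕ-Solver.solve-∀
    i011 : ∀ n → 0 ℕ.* 0 ℕ.+ 1 ℕ.* n ℕ.+ 1 ≡ suc n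
    i011 = ℕ-Solver.solve-∀
    i231 : ∀ n → 2 ℕ.* 0 ℕ.+ 3 ℕ.* n ℕ.+ 1 ≡ suc (3 ℕ.* n)
    i231 = ℕ-Solver.solve-∀
    i232 : ∀ n → 2 ℕ.* 0 ℕ.+ 3 ℕ.* n ℕ.+ 2 ≡ 2 ℕ.+ 3 ℕ.* n
    i232 = ℕ-Solver.solve-∀
    i222 : ∀ n → 2 ℕ.* 0 ℕ.+ 2 ℕ.* n ℕ.+ 2 ≡ suc (suc (2 ℕ.* n))
    i222 = ℕ-Solver.solve-∀
    i221 : ∀ n → 2 ℕ.* 0 ℕ.+ 2 ℕ.* n ℕ.+ 1 ≡ suc (2 ℕ.* n)
    i221 = ℕ-Solver.solve-∀
    i222′ : ∀ n → 2 ℕ.* 0 ℕ.+ 2 ℕ.* n ℕ.+ 2 ≡ 2 ℕ.* suc n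
    i222′ = ℕ-Solver.solve-∀

    dfac⁻¹-1 : dfac⁻¹ 1 is 1ℚ times 1ℚ
    dfac⁻¹-1 = at (λ x → x) (dfac⁻¹-def 1)

    fac-3k : fac (3 ℕ.* k) is fac (2 ℕ.+ 3 ℕ.* n) times (fromℕ 3 * K)
    fac-3k = scaled (fac-step (index₃ n) (trans (sym (fromℕ-suc (2 ℕ.+ 3 ℕ.* n)))
      (trans (cong fromℕ (sym (index₃ n))) (fromℕ-* 3 k))))

    fac⁻¹-2k : fac⁻¹ (2 ℕ.* k) is fac⁻¹ (suc (2 ℕ.* k)) times (fromℕ 2 * K + 1ℚ)
    fac⁻¹-2k = scaled (fac⁻¹-step refl (cong (_+ 1ℚ) (fromℕ-2* k)))

    term-base : term 0 k is base times _
    term-base = monomial-scale {k = fromℕ 3 * (fromℕ 4 * K + 1ℚ)}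
      (scaled (eq (-¼ ^ k * ¹/₁₆ ^ k) (fromℕ 4 * K + 1ℚ)))
      (at dfac (i211 k) ⨾ scaled (dfac-suc k))
      (at dfac (i010 k))
      (at fac (i231 k) ⨾ scaled (fac-step refl (cong (_+ 1ℚ) (fromℕ-* 3 k))) ⨾ fac-3k)
      (at dfac (i211 k) ⨾ scaled (dfac-suc k))
      (at dfac (i222 k) ⨾ scaled (dfac-step refl (cong (λ x → fromℕ 2 * x + 1ℚ) (fromℕ-odd k)))
        ⨾ scaled (dfac-step refl (cong (λ x → fromℕ 2 * x + 1ℚ) (fromℕ-2* k))))
      dfac⁻¹-1 (at fac⁻¹ (i010 k)) (at fac⁻¹ (i221 k)) (at fac⁻¹ (i221 k)) (at fac⁻¹ (i010 k))
      where
      eq : ∀ s k → fromℕ 3 * s * k ≡ s * (fromℕ 3 * k)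
      eq = solve-∀ ℚ-ring

    cert-base : cert 0 n is base times _
    -- The 12 is the prefactor -3/16 of `cert` divided by -¼ · ¹/₁₆, since both exponents in `base`
    -- are k = n + 1.
    cert-base = monomial-scale {k = fromℕ 12 * certPoly (0ℚ + N) (N + 1ℚ)}
      (scaled (eq (-¼ ^ n) (¹/₁₆ ^ n) (certPoly (0ℚ + N) (N + 1ℚ))))
      (at dfac (i211 n)) (at dfac (i011 n)) (at fac (i232 n)) (at dfac (i211 n)) (at dfac (i222′ n))
      dfac⁻¹-1 (at fac⁻¹ (i010 n) ⨾ scaled (fac⁻¹-step refl refl))
      (at fac⁻¹ (i222′ n) ⨾ fac⁻¹-2k) (at fac⁻¹ (i222′ n) ⨾ fac⁻¹-2k) (at fac⁻¹ (i011 n))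
      where
      eq : ∀ V W k → - (fromℕ 3 * (+ 1 / 16) * (V * W) * k)
         ≡ (- (+ 1 / 4) * V) * ((+ 1 / 16) * W) * (fromℕ 12 * k)
      eq = solve-∀ ℚ-ring

    hypergeometric-base : hypergeometric k is base times _
    hypergeometric-base = scaled (trans (sym (B≡hypergeometric n)) (trans
      (trans (eq (-¼ ^ k * ¹/₁₆ ^ k) (dfac k) (dfac (2 ℕ.* k)) (fac (3 ℕ.* k)) (fac⁻¹ k) (fac⁻¹ (2 ℕ.* k)))
        (sym (monomial-def _ _ _ _ _ _ _ _ _ _ _)))
      (equation (monomial-scale unscaled unscaled unscaled fac-3k unscaled unscaled
        unscaled unscaled fac⁻¹-2k fac⁻¹-2k unscaled))))
      where
      eq : ∀ s d D F₃ e e₂ → s * (d * d * (d * d) * D * F₃ * (e * e * e) * (e₂ * e₂ * e₂))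
         ≡ s * (d * d * F₃ * (d * d) * D) * (1ℚ * 1ℚ * e * (e₂ * e₂) * e₂ * (e * e))
      eq = solve-∀ ℚ-ring

    polynomial-identity : ∀ N → let
          K = N + 1ℚ
          M = 0ℚ + N
          certPoly = (fromℕ 2 * (K * K) - K) * (fromℕ 48 * (M * M) + fromℕ 118 * M + fromℕ 73)
              - fromℕ 2 * (M + 1ℚ) * (fromℕ 2 * M + fromℕ 3) * (fromℕ 60 * (M * M) + fromℕ 146 * M + fromℕ 89)
        in fromℕ 3 * (fromℕ 4 * K + 1ℚ)
          * ((fromℕ 2 * K + 1ℚ) * 1ℚ * 1ℚ * (fromℕ 3 * K * (fromℕ 3 * K + 1ℚ) * 1ℚ)
            * ((fromℕ 2 * K + 1ℚ) * 1ℚ * ((fromℕ 2 * K + 1ℚ) * 1ℚ))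
            * ((fromℕ 2 * (fromℕ 2 * K) + 1ℚ) * (fromℕ 2 * (fromℕ 2 * K + 1ℚ) + 1ℚ) * 1ℚ))
          * (1ℚ * 1ℚ * 1ℚ * (1ℚ * 1ℚ) * 1ℚ * (1ℚ * 1ℚ))
        + fromℕ 12 * certPoly * (1ℚ * 1ℚ * 1ℚ * (1ℚ * 1ℚ) * 1ℚ)
          * (1ℚ * 1ℚ * ((N + 1ℚ) * 1ℚ)
            * ((fromℕ 2 * K + 1ℚ) * 1ℚ * ((fromℕ 2 * K + 1ℚ) * 1ℚ)) * ((fromℕ 2 * K + 1ℚ) * 1ℚ) * (1ℚ * 1ℚ))
        ≡ (fromℕ 172 * (K * K) + fromℕ 75 * K + fromℕ 9)
          * (1ℚ * (1ℚ * 1ℚ * (fromℕ 3 * K) * (1ℚ * 1ℚ) * 1ℚ)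
            * (1ℚ * 1ℚ * 1ℚ * ((fromℕ 2 * K + 1ℚ) * (fromℕ 2 * K + 1ℚ)) * (fromℕ 2 * K + 1ℚ) * (1ℚ * 1ℚ)))
    polynomial-identity = solve-∀ ℚ-ring

  -- The left side is the increment of the antidiagonal sum. Divided by `base` the claim is a
  -- polynomial identity, and this is how the quadratic 172k² + 75k + 9 arises from the WZ pair.
  term₀+cert₀≡summand : term 0 k + cert 0 n ≡ summand k
  term₀+cert₀≡summand = begin
    term 0 k + cert 0 n                               ≡⟨ cong₂ _+_ (equation term-base) (equation cert-base) ⟩
    _                                           ≡⟨ ℚₚ.*-distribˡ-+ base _ _ ⟨
    _                                           ≡⟨ cong (base *_) poly ⟩
    base * (summandQuadratic K * _)             ≡⟨ swap base (summandQuadratic K) _ ⟩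
    summandQuadratic K * (base * _)             ≡⟨ cong (summandQuadratic K *_) (equation hypergeometric-base) ⟨
    summandQuadratic K * hypergeometric k       ≡⟨ summand-closed k ⟨
    summand k ∎
    where
    swap : ∀ a b c → a * (b * c) ≡ b * (a * c)
    swap = solve-∀ ℚ-ring
    -- The identity was proved with N + 1 in place of `K`; the transport puts `fromℕ k` where the
    -- inferred factors have it and leaves the factors of `cert 0 n` that mention N.
    poly : _
    poly = subst (λ K → fromℕ 3 * (fromℕ 4 * K + 1ℚ)
          * ((fromℕ 2 * K + 1ℚ) * 1ℚ * 1ℚ * (fromℕ 3 * K * (fromℕ 3 * K + 1ℚ) * 1ℚ)
            * ((fromℕ 2 * K + 1ℚ) * 1ℚ * ((fromℕ 2 * K + 1ℚ) * 1ℚ))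
            * ((fromℕ 2 * (fromℕ 2 * K) + 1ℚ) * (fromℕ 2 * (fromℕ 2 * K + 1ℚ) + 1ℚ) * 1ℚ))
          * (1ℚ * 1ℚ * 1ℚ * (1ℚ * 1ℚ) * 1ℚ * (1ℚ * 1ℚ))
        + fromℕ 12 * certPoly (0ℚ + N) (N + 1ℚ) * (1ℚ * 1ℚ * 1ℚ * (1ℚ * 1ℚ) * 1ℚ)
          * (1ℚ * 1ℚ * ((N + 1ℚ) * 1ℚ)
            * ((fromℕ 2 * K + 1ℚ) * 1ℚ * ((fromℕ 2 * K + 1ℚ) * 1ℚ)) * ((fromℕ 2 * K + 1ℚ) * 1ℚ) * (1ℚ * 1ℚ))
        ≡ summandQuadratic K
          * (1ℚ * (1ℚ * 1ℚ * (fromℕ 3 * K) * (1ℚ * 1ℚ) * 1ℚ)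
            * (1ℚ * 1ℚ * 1ℚ * ((fromℕ 2 * K + 1ℚ) * (fromℕ 2 * K + 1ℚ)) * (fromℕ 2 * K + 1ℚ) * (1ℚ * 1ℚ))))
      (sym (fromℕ-suc n)) (polynomial-identity N)

-- The sum of the theorem as an antidiagonal sum

-- The sum unfolds from the front, whereas the induction on its upper bound adds a summand at the
-- end.
∑-suc : ∀ (f : ℕ → ℚ) n → ∑[ k ≤ suc n ] f (toℕ k) ≡ ∑[ k ≤ n ] f (toℕ k) + f (suc n)
∑-suc f zero    = eq (f 0) (f 1)
  where
  eq : ∀ a b → a + (b + 0ℚ) ≡ a + 0ℚ + b
  eq = solve-∀ ℚ-ring
∑-suc f (suc n) = trans (cong (_+_ (f 0)) (∑-suc (λ k → f (suc k)) n))
  (sym (ℚₚ.+-assoc (f 0) (∑[ k ≤ n ] f (suc (toℕ k))) (f (suc (suc n)))))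

opaque
  unfolding fac monomial
  term₀₀≡9 : term 0 0 ≡ fromℕ 9
  term₀₀≡9 = refl

-- Both sides start at 9 and have the same increments.
∑-summand : ∀ n → ∑[ k ≤ n ] summand (toℕ k) ≡ antidiagonal term n 0
∑-summand zero    = sym term₀₀≡9
∑-summand (suc n) = begin
  ∑[ k ≤ suc n ] summand (toℕ k)                  ≡⟨ ∑-suc summand n ⟩
  ∑[ k ≤ n ] summand (toℕ k) + summand (suc n)    ≡⟨ cong₂ _+_ (∑-summand n) (sym (term₀+cert₀≡summand n)) ⟩
  antidiagonal term n 0 + (term 0 (suc n) + cert 0 n)
    ≡⟨ cong (λ m → antidiagonal term n 0 + (term 0 (suc m) + cert 0 m)) (ℕₚ.+-identityʳ n) ⟨
  antidiagonal term n 0 + (term 0 (suc (n ℕ.+ 0)) + cert 0 (n ℕ.+ 0))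
    ≡⟨ antidiagonal-term-suc n 0 ⟨
  antidiagonal term (suc n) 0 + 0ℚ                   ≡⟨ ℚₚ.+-identityʳ (antidiagonal term (suc n) 0) ⟩
  antidiagonal term (suc n) 0                        ∎

-- The ring of p-integral rationals

module Localization (p : ℕ) (p-prime : Prime p) where

  -- The fraction may be unreduced: closure under sums and products then follows from Euclid's lemma
  -- for the product of the denominators.
  record Local (x : ℚ) : Set where
    constructor local
    field
      numerator   : ℤ
      denominator : ℕ
      p∤          : p ∤ denominator
      fraction    : x * fromℕ denominator ≡ fromℤ numerator

  p>1 : 1 ℕ.< p
  p>1 = ℕ.nonTrivial⇒n>1 p {{prime⇒nonTrivial p-prime}}

  Local-fromℤ : ∀ a → Local (fromℤ a)
  Local-fromℤ a = local a 1 (>⇒∤ p>1) (ℚₚ.*-identityʳ (fromℤ a))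

  Local-fromℕ : ∀ n → Local (fromℕ n)
  Local-fromℕ n = Local-fromℤ (+ n)

  Local-inv : ∀ n .{{_ : NonZero n}} → n ℕ.< p → Local (inv n)
  Local-inv n n<p = local (+ 1) n (>⇒∤ n<p) (inv-cancel n)

  Local-+ : ∀ {x y} → Local x → Local y → Local (x + y)
  Local-+ {x} {y} (local a b p∤b eq) (local a′ b′ p∤b′ eq′) =
    local (a ℤ.* + b′ ℤ.+ a′ ℤ.* + b) (b ℕ.* b′)
      (λ p∣ → [ p∤b , p∤b′ ]′ (euclidsLemma b b′ p-prime p∣))
      (begin
        (x + y) * fromℕ (b ℕ.* b′)                      ≡⟨ cong ((x + y) *_) (fromℕ-* b b′) ⟩
        (x + y) * (fromℕ b * fromℕ b′)                  ≡⟨ expand x y (fromℕ b) (fromℕ b′) ⟩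
        x * fromℕ b * fromℕ b′ + y * fromℕ b′ * fromℕ b ≡⟨ cong₂ (λ u v → u * fromℕ b′ + v * fromℕ b) eq eq′ ⟩
        fromℤ a * fromℕ b′ + fromℤ a′ * fromℕ b         ≡⟨ cong₂ _+_ (fromℤ-* a (+ b′)) (fromℤ-* a′ (+ b)) ⟨
        fromℤ (a ℤ.* + b′) + fromℤ (a′ ℤ.* + b)         ≡⟨ fromℤ-+ (a ℤ.* + b′) (a′ ℤ.* + b) ⟨
        fromℤ (a ℤ.* + b′ ℤ.+ a′ ℤ.* + b)               ∎)
    where
    expand : ∀ x y b c → (x + y) * (b * c) ≡ x * b * c + y * c * b
    expand = solve-∀ ℚ-ring

  Local-* : ∀ {x y} → Local x → Local y → Local (x * y)
  Local-* {x} {y} (local a b p∤b eq) (local a′ b′ p∤b′ eq′) =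
    local (a ℤ.* a′) (b ℕ.* b′)
      (λ p∣ → [ p∤b , p∤b′ ]′ (euclidsLemma b b′ p-prime p∣))
      (begin
        x * y * fromℕ (b ℕ.* b′)        ≡⟨ cong (x * y *_) (fromℕ-* b b′) ⟩
        x * y * (fromℕ b * fromℕ b′)    ≡⟨ expand x y (fromℕ b) (fromℕ b′) ⟩
        x * fromℕ b * (y * fromℕ b′)    ≡⟨ cong₂ _*_ eq eq′ ⟩
        fromℤ a * fromℤ a′              ≡⟨ fromℤ-* a a′ ⟨
        fromℤ (a ℤ.* a′)                ∎)
    where
    expand : ∀ x y b c → x * y * (b * c) ≡ x * b * (y * c)
    expand = solve-∀ ℚ-ring

  Local-neg : ∀ {x} → Local x → Local (- x)
  Local-neg {x} (local a b p∤b eq) = local (ℤ.- a) b p∤b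
    (trans (expand x (fromℕ b)) (trans (cong -_ eq) (sym (fromℤ-neg a))))
    where
    expand : ∀ x b → - x * b ≡ - (x * b)
    expand = solve-∀ ℚ-ring

  Local-^ : ∀ {x} n → Local x → Local (x ^ n)
  Local-^ zero    lx = Local-fromℕ 1
  Local-^ (suc n) lx = Local-* lx (Local-^ n lx)

  -- The reduced denominator divides every other denominator of `x`, so it cannot be divisible by
  -- `p`; and a common divisor with the prime `p` is 1 or `p`.
  Local⇒Integral : ∀ {x} → Local x → Integral p x
  Local⇒Integral {x@(mkℚ n d c)} (local a b p∤b eq) {e} (e∣d , e∣p)
    with prime⇒irreducible p-prime e∣p
  ... | inj₁ e≡1  = e≡1
  ... | inj₂ refl = contradiction (∣-trans e∣d d∣b) p∤b
    where
    cross : toℚᵘ x ℚᵘ.* ℚᵘ.mkℚᵘ (+ b) 0 ℚᵘ.≃ ℚᵘ.mkℚᵘ a 0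
    cross = ℚᵘₚ.≃-trans (ℚᵘₚ.*-cong (ℚᵘₚ.≃-refl {toℚᵘ x}) (ℚᵘₚ.≃-sym (toℚᵘ-/ (+ b) 0)))
      (ℚᵘₚ.≃-trans (ℚᵘₚ.≃-sym (ℚₚ.toℚᵘ-homo-* x (fromℕ b)))
      (ℚᵘₚ.≃-trans (ℚₚ.toℚᵘ-cong eq) (toℚᵘ-/ a 0)))
    numerators : n ℤ.* + b ≡ a ℤ.* + suc d
    numerators with cross
    ... | ℚᵘ.*≡* e = trans (sym (ℤₚ.*-identityʳ (n ℤ.* + b)))
      (trans e (cong (λ m → a ℤ.* m) (cong +_ (ℕₚ.*-identityʳ (suc d)))))
    naturals : ℤ.∣ n ∣ ℕ.* b ≡ ℤ.∣ a ∣ ℕ.* suc d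
    naturals = trans (sym (ℤₚ.abs-* n (+ b))) (trans (cong ℤ.∣_∣ numerators) (ℤₚ.abs-* a (+ suc d)))
    d∣b : suc d ∣ b
    d∣b = coprime-divisor (Coprimality.sym (Coprimality.recompute c)) (divides ℤ.∣ a ∣ naturals)

  X : ℚ
  X = fromℕ p

  Local-X : Local X
  Local-X = Local-fromℕ p

  infix 4 _≈_mod_

  record _≈_mod_ (x y : ℚ) (k : ℕ) : Set where
    constructor congruent
    field
      quotient : ℚ
      integral : Local quotient
      congruence : x ≡ y + X ^ k * quotient

  ≈-reflexive : ∀ {x y} k → x ≡ y → x ≈ y mod k
  ≈-reflexive {x} k refl = congruent 0ℚ (Local-fromℕ 0) (eq x (X ^ k))
    where
    eq : ∀ x u → x ≡ x + u * 0ℚ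
    eq = solve-∀ ℚ-ring

  ≈-refl : ∀ {x k} → x ≈ x mod k
  ≈-refl = ≈-reflexive _ refl

  ≈-sym : ∀ {x y k} → x ≈ y mod k → y ≈ x mod k
  ≈-sym {y = y} {k} (congruent q lq refl) = congruent (- q) (Local-neg lq) (eq y (X ^ k) q)
    where
    eq : ∀ y u q → y ≡ y + u * q + u * (- q)
    eq = solve-∀ ℚ-ring

  ≈-trans : ∀ {x y z k} → x ≈ y mod k → y ≈ z mod k → x ≈ z mod k
  ≈-trans {z = z} {k} (congruent q lq refl) (congruent r lr refl) =
    congruent (r + q) (Local-+ lr lq) (eq z (X ^ k) q r)
    where
    eq : ∀ z u q r → z + u * r + u * q ≡ z + u * (r + q)
    eq = solve-∀ ℚ-ring

  +-cong-≈ : ∀ {x x′ y y′ k} → x ≈ x′ mod k → y ≈ y′ mod k → x + y ≈ x′ + y′ mod k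
  +-cong-≈ {x′ = x′} {y′ = y′} {k} (congruent q lq refl) (congruent r lr refl) =
    congruent (q + r) (Local-+ lq lr) (eq x′ y′ (X ^ k) q r)
    where
    eq : ∀ x y u q r → x + u * q + (y + u * r) ≡ x + y + u * (q + r)
    eq = solve-∀ ℚ-ring

  -- From x y - x′ y′ = (x - x′) y′ + x (y - y′), which explains why integrality is asked of `x` and
  -- `y′`.
  *-cong-≈ : ∀ {x x′ y y′ k} → Local x → Local y′ → x ≈ x′ mod k → y ≈ y′ mod k → x * y ≈ x′ * y′ mod k
  *-cong-≈ {x} {x′} {y} {y′} {k} lx ly′ (congruent q lq e) (congruent r lr refl) =
    congruent (q * y′ + x * r) (Local-+ (Local-* lq ly′) (Local-* lx lr))
      (begin
        x * (y′ + X ^ k * r)                          ≡⟨ ℚₚ.*-distribˡ-+ x y′ (X ^ k * r) ⟩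
        x * y′ + x * (X ^ k * r)                      ≡⟨ cong (λ t → t * y′ + x * (X ^ k * r)) e ⟩
        (x′ + X ^ k * q) * y′ + x * (X ^ k * r)       ≡⟨ eq x x′ y′ (X ^ k) q r ⟩
        x′ * y′ + X ^ k * (q * y′ + x * r)            ∎)
    where
    eq : ∀ x x′ y u q r → (x′ + u * q) * y + x * (u * r) ≡ x′ * y + u * (q * y + x * r)
    eq = solve-∀ ℚ-ring

  Local-≈ : ∀ {x y k} → x ≈ y mod k → Local y → Local x
  Local-≈ {k = k} (congruent q lq refl) ly = Local-+ ly (Local-* (Local-^ k Local-X) lq)

-- The products of 1 + y/l modulo p³

-- The product of x + s l over 1 ≤ l ≤ n. With x = p and s among ±1, ±2 it covers the stretches of
-- integers and of odd integers next to p.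
rise : ℚ → ℚ → ℕ → ℚ
rise s x zero    = 1ℚ
rise s x (suc n) = rise s x n * (x + s * (fromℕ n + 1ℚ))

fac-above : ∀ m n → fac (m ℕ.+ n) ≡ fac m * rise 1ℚ (fromℕ m) n
fac-above m zero    = trans (cong fac (ℕₚ.+-identityʳ m)) (sym (ℚₚ.*-identityʳ (fac m)))
fac-above m (suc n) = begin
  fac (m ℕ.+ suc n)
    ≡⟨ fac-step (ℕₚ.+-suc m n) (trans (cong (_+ 1ℚ) (fromℕ-+ m n)) (eq (fromℕ m) (fromℕ n))) ⟩
  fac (m ℕ.+ n) * (fromℕ m + 1ℚ * (fromℕ n + 1ℚ))
    ≡⟨ cong (_* (fromℕ m + 1ℚ * (fromℕ n + 1ℚ))) (fac-above m n) ⟩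
  fac m * rise 1ℚ (fromℕ m) n * (fromℕ m + 1ℚ * (fromℕ n + 1ℚ))
    ≡⟨ ℚₚ.*-assoc (fac m) (rise 1ℚ (fromℕ m) n) _ ⟩
  fac m * rise 1ℚ (fromℕ m) (suc n) ∎
  where
  eq : ∀ m n → m + n + 1ℚ ≡ m + 1ℚ * (n + 1ℚ)
  eq = solve-∀ ℚ-ring

-- To be used with k = p - 1, so that `x` is p and the factors from m + 1 to p - 1 are read
-- downwards as p - 1, p - 2, and so on.
fac-below : ∀ {x} k m n → x ≡ fromℕ k + 1ℚ → m ℕ.+ n ≡ k → fac k ≡ fac m * rise (- 1ℚ) x n
fac-below k m zero    _    refl = trans (cong fac (ℕₚ.+-identityʳ m)) (sym (ℚₚ.*-identityʳ (fac m)))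
fac-below {x} k m (suc n) x≡ refl = begin
  fac k
    ≡⟨ fac-below k (suc m) n x≡ (sym (ℕₚ.+-suc m n)) ⟩
  fac (suc m) * rise (- 1ℚ) x n
    ≡⟨ cong (_* rise (- 1ℚ) x n) (fac-step refl factor) ⟩
  fac m * (x + - 1ℚ * (fromℕ n + 1ℚ)) * rise (- 1ℚ) x n
    ≡⟨ swap (fac m) (x + - 1ℚ * (fromℕ n + 1ℚ)) (rise (- 1ℚ) x n) ⟩
  fac m * rise (- 1ℚ) x (suc n) ∎
  where
  swap : ∀ a b c → a * b * c ≡ a * (c * b)
  swap = solve-∀ ℚ-ring
  eq : ∀ m n → m + 1ℚ ≡ m + (n + 1ℚ) + 1ℚ + - 1ℚ * (n + 1ℚ)
  eq = solve-∀ ℚ-ring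
  factor : fromℕ m + 1ℚ ≡ x + - 1ℚ * (fromℕ n + 1ℚ)
  factor = trans (eq (fromℕ m) (fromℕ n)) (cong (λ y → y + - 1ℚ * (fromℕ n + 1ℚ))
    (sym (trans x≡ (cong (_+ 1ℚ) (trans (fromℕ-+ m (suc n)) (cong (_+_ (fromℕ m)) (fromℕ-suc n)))))))

-- For p = 2k + 1 this isolates `x` = p as the middle factor and writes the odd numbers above it as
-- p + 2l; `dfac-below` does the same for those below.
dfac-above : ∀ {x} k n → x ≡ fromℕ 2 * fromℕ k + 1ℚ →
  dfac (suc k ℕ.+ n) ≡ dfac k * x * rise (fromℕ 2) x n
dfac-above k zero    refl = trans (cong (λ m → dfac (suc m)) (ℕₚ.+-identityʳ k))
  (trans (dfac-suc k) (sym (ℚₚ.*-identityʳ _)))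
dfac-above {x} k (suc n) x≡ = begin
  dfac (suc k ℕ.+ suc n)
    ≡⟨ dfac-step (ℕₚ.+-suc (suc k) n) factor ⟩
  dfac (suc k ℕ.+ n) * (x + fromℕ 2 * (fromℕ n + 1ℚ))
    ≡⟨ cong (_* (x + fromℕ 2 * (fromℕ n + 1ℚ))) (dfac-above k n x≡) ⟩
  dfac k * x * rise (fromℕ 2) x n * (x + fromℕ 2 * (fromℕ n + 1ℚ))
    ≡⟨ ℚₚ.*-assoc (dfac k * x) (rise (fromℕ 2) x n) _ ⟩
  dfac k * x * rise (fromℕ 2) x (suc n) ∎
  where
  eq : ∀ k n → fromℕ 2 * (k + 1ℚ + n) + 1ℚ ≡ fromℕ 2 * k + 1ℚ + fromℕ 2 * (n + 1ℚ)
  eq = solve-∀ ℚ-ring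
  factor : fromℕ 2 * fromℕ (suc k ℕ.+ n) + 1ℚ ≡ x + fromℕ 2 * (fromℕ n + 1ℚ)
  factor = trans (cong (λ y → fromℕ 2 * y + 1ℚ) (trans (fromℕ-+ (suc k) n) (cong (_+ fromℕ n) (fromℕ-suc k))))
    (trans (eq (fromℕ k) (fromℕ n)) (cong (λ y → y + fromℕ 2 * (fromℕ n + 1ℚ)) (sym x≡)))

dfac-below : ∀ {x} k m n → x ≡ fromℕ 2 * fromℕ k + 1ℚ → m ℕ.+ n ≡ k →
  dfac k ≡ dfac m * rise (- fromℕ 2) x n
dfac-below k m zero    _    refl = trans (cong dfac (ℕₚ.+-identityʳ m)) (sym (ℚₚ.*-identityʳ (dfac m)))
dfac-below {x} k m (suc n) x≡ refl = begin
  dfac k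
    ≡⟨ dfac-below k (suc m) n x≡ (sym (ℕₚ.+-suc m n)) ⟩
  dfac (suc m) * rise (- fromℕ 2) x n
    ≡⟨ cong (_* rise (- fromℕ 2) x n) (dfac-step refl factor) ⟩
  dfac m * (x + - fromℕ 2 * (fromℕ n + 1ℚ)) * rise (- fromℕ 2) x n
    ≡⟨ swap (dfac m) (x + - fromℕ 2 * (fromℕ n + 1ℚ)) (rise (- fromℕ 2) x n) ⟩
  dfac m * rise (- fromℕ 2) x (suc n) ∎
  where
  swap : ∀ a b c → a * b * c ≡ a * (c * b)
  swap = solve-∀ ℚ-ring
  eq : ∀ m n → fromℕ 2 * m + 1ℚ ≡ fromℕ 2 * (m + (n + 1ℚ)) + 1ℚ + - fromℕ 2 * (n + 1ℚ)
  eq = solve-∀ ℚ-ring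
  factor : fromℕ 2 * fromℕ m + 1ℚ ≡ x + - fromℕ 2 * (fromℕ n + 1ℚ)
  factor = trans (eq (fromℕ m) (fromℕ n)) (cong (λ y → y + - fromℕ 2 * (fromℕ n + 1ℚ))
    (sym (trans x≡ (cong (λ y → fromℕ 2 * y + 1ℚ)
      (trans (fromℕ-+ m (suc n)) (cong (_+_ (fromℕ m)) (fromℕ-suc n)))))))

Π : ℚ → ℕ → ℚ
Π y zero    = 1ℚ
Π y (suc n) = Π y n * (1ℚ + y * inv (suc n))

-- Take s l out of each factor: x + s l = s l (1 + t x / l), because `t` is the inverse of `s`.
rise-Π : ∀ s t x n → s * t ≡ 1ℚ → rise s x n ≡ s ^ n * fac n * Π (t * x) n
rise-Π s t x zero    st≡1 = sym (trans (ℚₚ.*-identityʳ _) (trans (ℚₚ.*-identityˡ (fac 0)) (fac-def 0)))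
rise-Π s t x (suc n) st≡1 = begin
  rise s x n * (x + s * m)
    ≡⟨ cong₂ _*_ (rise-Π s t x n st≡1) factor ⟩
  s ^ n * fac n * Π (t * x) n * (s * m * (1ℚ + t * x * i))
    ≡⟨ regroup (s ^ n) (fac n) (Π (t * x) n) s m (1ℚ + t * x * i) ⟩
  s * s ^ n * (fac n * m) * (Π (t * x) n * (1ℚ + t * x * i))
    ≡⟨ cong (λ y → s * s ^ n * y * Π (t * x) (suc n)) (fac-suc n) ⟨
  s ^ suc n * fac (suc n) * Π (t * x) (suc n) ∎
  where
  m i : ℚ
  m = fromℕ n + 1ℚ
  i = inv (suc n)
  regroup : ∀ a b c s m u → a * b * c * (s * m * u) ≡ s * a * (b * m) * (c * u)
  regroup = solve-∀ ℚ-ring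
  expand : ∀ s t x m i → s * m * (1ℚ + t * x * i) ≡ s * t * (i * m) * x + s * m
  expand = solve-∀ ℚ-ring
  i*m≡1 : i * m ≡ 1ℚ
  i*m≡1 = trans (cong (i *_) (sym (fromℕ-suc n))) (inv-cancel (suc n))
  one : ∀ x y → 1ℚ * 1ℚ * x + y ≡ x + y
  one = solve-∀ ℚ-ring
  factor : x + s * m ≡ s * m * (1ℚ + t * x * i)
  factor = sym (trans (expand s t x m i)
    (trans (cong₂ (λ a b → a * b * x + s * m) st≡1 i*m≡1) (one x (s * m))))

sumInvSq : ℕ → ℚ
sumInvSq zero    = 0ℚ
sumInvSq (suc n) = sumInvSq n + inv (suc n) * inv (suc n)

private
  conjugate-factors : ∀ a b t x i → a * (1ℚ + t * x * i) * (b * (1ℚ + - t * x * i))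
    ≡ a * b * (1ℚ - t * t * (x * x) * (i * i))
  conjugate-factors = solve-∀ ℚ-ring

  conjugate-expand : ∀ t x i S q →
    (1ℚ - t * t * (x * x) * S + x * (x * (x * 1ℚ)) * q) * (1ℚ - t * t * (x * x) * (i * i))
    ≡ 1ℚ - t * t * (x * x) * (S + i * i)
      + x * (x * (x * 1ℚ)) * (x * (t * t) * (t * t) * (i * i) * S + q * (1ℚ - t * t * (x * x) * (i * i)))
  conjugate-expand = solve-∀ ℚ-ring

  square-* : ∀ a f → a * f * (a * f) ≡ a * a * (f * f)
  square-* = solve-∀ ℚ-ring

  square-expand₁ : ∀ P t x S q i → let f = 1ℚ + t * x * i in
    (P + t * t * (x * x) * S + x * (x * (x * 1ℚ)) * q) * (f * f)
    ≡ P * (1ℚ + (t + t) * x * i) + t * t * (x * x) * (S + i * i * P)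
      + x * (x * (x * 1ℚ)) * (t * t * S * ((t + t) * i + t * t * x * (i * i)) + q * (f * f))
  square-expand₁ = solve-∀ ℚ-ring

  square-expand₂ : ∀ A t x S i r B C →
    A + t * t * (x * x) * (S + i * i * (1ℚ + x * 1ℚ * r)) + x * (x * (x * 1ℚ)) * (B + C)
    ≡ A + t * t * (x * x) * (S + i * i) + x * (x * (x * 1ℚ)) * (t * t * (i * i) * r + B + C)
  square-expand₂ = solve-∀ ℚ-ring

module Products (p : ℕ) (p-prime : Prime p) where
  open Localization p p-prime public

  Local-fac : ∀ n → Local (fac n)
  Local-fac n = subst Local (sym (fac-def n)) (Local-fromℕ (n !))

  Local-dfac : ∀ n → Local (dfac n)
  Local-dfac n = subst Local (sym (dfac-def n)) (Local-fromℕ (odd‼ n))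

  Local-fac⁻¹ : ∀ n → n ℕ.< p → Local (fac⁻¹ n)
  Local-fac⁻¹ zero    _   = subst Local (sym (fac⁻¹-def 0)) (Local-fromℕ 1)
  Local-fac⁻¹ (suc n) n<p = subst Local (sym split)
    (Local-* (Local-fac⁻¹ n (ℕₚ.<-trans (ℕₚ.n<1+n n) n<p)) (Local-inv (suc n) n<p))
    where
    regroup : ∀ a m i → a * m * i ≡ a * (i * m)
    regroup = solve-∀ ℚ-ring
    split : fac⁻¹ (suc n) ≡ fac⁻¹ n * inv (suc n)
    split = sym (trans (cong (_* inv (suc n)) (fac⁻¹-step refl (sym (fromℕ-suc n))))
      (trans (regroup (fac⁻¹ (suc n)) (fromℕ (suc n)) (inv (suc n)))
      (trans (cong (fac⁻¹ (suc n) *_) (inv-cancel (suc n))) (ℚₚ.*-identityʳ (fac⁻¹ (suc n))))))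

  Local-rise : ∀ {s x} n → Local s → Local x → Local (rise s x n)
  Local-rise zero    ls lx = Local-fromℕ 1
  Local-rise (suc n) ls lx = Local-* (Local-rise n ls lx)
    (Local-+ lx (Local-* ls (Local-+ (Local-fromℕ n) (Local-fromℕ 1))))

  Local-Π : ∀ {y} n → Local y → n ℕ.< p → Local (Π y n)
  Local-Π zero    ly _   = Local-fromℕ 1
  Local-Π (suc n) ly n<p = Local-* (Local-Π n ly (ℕₚ.<-trans (ℕₚ.n<1+n n) n<p))
    (Local-+ (Local-fromℕ 1) (Local-* ly (Local-inv (suc n) n<p)))

  Local-sumInvSq : ∀ n → n ℕ.< p → Local (sumInvSq n)
  Local-sumInvSq zero    _   = Local-fromℕ 0
  Local-sumInvSq (suc n) n<p = Local-+ (Local-sumInvSq n (ℕₚ.<-trans (ℕₚ.n<1+n n) n<p))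
    (Local-* (Local-inv (suc n) n<p) (Local-inv (suc n) n<p))

  rise-mod-p : ∀ {s} n → Local s → rise s X n ≈ s ^ n * fac n mod 1
  rise-mod-p {s} zero ls = ≈-reflexive 1 (sym (trans (ℚₚ.*-identityˡ (fac 0)) (fac-def 0)))
  rise-mod-p {s} (suc n) ls = ≈-trans
    (*-cong-≈ (Local-rise n ls Local-X) (Local-* ls (Local-+ (Local-fromℕ n) (Local-fromℕ 1)))
      (rise-mod-p n ls) (congruent 1ℚ (Local-fromℕ 1) (eq X (s * (fromℕ n + 1ℚ)))))
    (≈-reflexive 1 (trans (regroup (s ^ n) (fac n) s (fromℕ n + 1ℚ))
      (cong (s * s ^ n *_) (sym (fac-suc n)))))
    where
    eq : ∀ x y → x + y ≡ y + x * 1ℚ * 1ℚ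
    eq = solve-∀ ℚ-ring
    regroup : ∀ a b s m → a * b * (s * m) ≡ s * a * (b * m)
    regroup = solve-∀ ℚ-ring

  Π-mod-p : ∀ {t} n → Local t → n ℕ.< p → Π (t * X) n ≈ 1ℚ mod 1
  Π-mod-p zero    lt _   = ≈-refl
  Π-mod-p {t} (suc n) lt n<p = ≈-trans
    (*-cong-≈ (Local-Π n (Local-* lt Local-X) n<p′) (Local-fromℕ 1) (Π-mod-p n lt n<p′)
      (congruent (t * inv (suc n)) (Local-* lt (Local-inv (suc n) n<p)) (eq t X (inv (suc n)))))
    (≈-reflexive 1 refl)
    where
    n<p′ : n ℕ.< p
    n<p′ = ℕₚ.<-trans (ℕₚ.n<1+n n) n<p
    eq : ∀ t x i → 1ℚ + t * x * i ≡ 1ℚ + x * 1ℚ * (t * i)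
    eq = solve-∀ ℚ-ring

  -- The factors pair up to 1 - t² X² / l², and in the product of two such factors the mixed term
  -- carries X⁴.
  Π-conjugate : ∀ {t} n → Local t → n ℕ.< p →
    Π (t * X) n * Π (- t * X) n ≈ 1ℚ - t * t * (X * X) * sumInvSq n mod 3
  Π-conjugate {t} zero lt _ = ≈-reflexive 3 (eq t X)
    where
    eq : ∀ t x → 1ℚ * 1ℚ ≡ 1ℚ - t * t * (x * x) * 0ℚ
    eq = solve-∀ ℚ-ring
  Π-conjugate {t} (suc n) lt n<p = step (Π-conjugate n lt (ℕₚ.<-trans (ℕₚ.n<1+n n) n<p))
    where
    i S f : ℚ
    i = inv (suc n)
    S = sumInvSq n
    f = 1ℚ - t * t * (X * X) * (i * i)
    lt² : Local (t * t)
    lt² = Local-* lt lt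
    li² : Local (i * i)
    li² = Local-* (Local-inv (suc n) n<p) (Local-inv (suc n) n<p)
    lS : Local S
    lS = Local-sumInvSq n (ℕₚ.<-trans (ℕₚ.n<1+n n) n<p)
    lf : Local f
    lf = Local-+ (Local-fromℕ 1) (Local-neg (Local-* (Local-* lt² (Local-* Local-X Local-X)) li²))
    step : Π (t * X) n * Π (- t * X) n ≈ 1ℚ - t * t * (X * X) * S mod 3 →
      Π (t * X) (suc n) * Π (- t * X) (suc n) ≈ 1ℚ - t * t * (X * X) * (S + i * i) mod 3
    step (congruent q lq e) = congruent (X * (t * t) * (t * t) * (i * i) * S + q * f)
      (Local-+ (Local-* (Local-* (Local-* (Local-* Local-X lt²) lt²) li²) lS) (Local-* lq lf))
      (trans (conjugate-factors (Π (t * X) n) (Π (- t * X) n) t X i)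
        (trans (cong (_* f) e) (conjugate-expand t X i S q)))

  -- A squared factor exceeds 1 + 2 t X / l by t² X² / l². This excess already carries X², so modulo
  -- p³ its cofactor matters only modulo p, where `Π-mod-p` makes it 1.
  Π-half² : ∀ {t} n → Local t → n ℕ.< p →
    Π (t * X) n * Π (t * X) n ≈ Π ((t + t) * X) n + t * t * (X * X) * sumInvSq n mod 3
  Π-half² {t} zero lt _ = ≈-reflexive 3 (eq t X)
    where
    eq : ∀ t x → 1ℚ * 1ℚ ≡ 1ℚ + t * t * (x * x) * 0ℚ
    eq = solve-∀ ℚ-ring
  Π-half² {t} (suc n) lt n<p =
    step (Π-half² n lt (ℕₚ.<-trans (ℕₚ.n<1+n n) n<p)) (Π-mod-p n (Local-+ lt lt) (ℕₚ.<-trans (ℕₚ.n<1+n n) n<p))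
    where
    i S P f c : ℚ
    i = inv (suc n)
    S = sumInvSq n
    P = Π ((t + t) * X) n
    f = 1ℚ + t * X * i
    c = t * t * S * ((t + t) * i + t * t * X * (i * i))
    lt² : Local (t * t)
    lt² = Local-* lt lt
    li : Local i
    li = Local-inv (suc n) n<p
    lf : Local f
    lf = Local-+ (Local-fromℕ 1) (Local-* (Local-* lt Local-X) li)
    lS : Local S
    lS = Local-sumInvSq n (ℕₚ.<-trans (ℕₚ.n<1+n n) n<p)
    lc : Local c
    lc = Local-* (Local-* lt² lS) (Local-+ (Local-* (Local-+ lt lt) li)
          (Local-* (Local-* lt² Local-X) (Local-* li li)))
    step : Π (t * X) n * Π (t * X) n ≈ P + t * t * (X * X) * S mod 3 → P ≈ 1ℚ mod 1 →
      Π (t * X) (suc n) * Π (t * X) (suc n)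
        ≈ P * (1ℚ + (t + t) * X * i) + t * t * (X * X) * (S + i * i) mod 3
    step (congruent q lq e) (congruent r lr e′) = congruent (t * t * (i * i) * r + c + q * (f * f))
      (Local-+ (Local-+ (Local-* (Local-* lt² (Local-* li li)) lr) lc) (Local-* lq (Local-* lf lf)))
      (begin
        Π (t * X) n * f * (Π (t * X) n * f)
          ≡⟨ square-* (Π (t * X) n) f ⟩
        Π (t * X) n * Π (t * X) n * (f * f)
          ≡⟨ cong (_* (f * f)) e ⟩
        (P + t * t * (X * X) * S + X ^ 3 * q) * (f * f)
          ≡⟨ square-expand₁ P t X S q i ⟩
        P * (1ℚ + (t + t) * X * i) + t * t * (X * X) * (S + i * i * P) + X ^ 3 * (c + q * (f * f))
          ≡⟨ cong (λ y → P * (1ℚ + (t + t) * X * i) + t * t * (X * X) * (S + i * i * y)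
               + X ^ 3 * (c + q * (f * f))) e′ ⟩
        P * (1ℚ + (t + t) * X * i) + t * t * (X * X) * (S + i * i * (1ℚ + X ^ 1 * r)) + X ^ 3 * (c + q * (f * f))
          ≡⟨ square-expand₂ (P * (1ℚ + (t + t) * X * i)) t X S i r c (q * (f * f)) ⟩
        P * (1ℚ + (t + t) * X * i) + t * t * (X * X) * (S + i * i)
          + X ^ 3 * (t * t * (i * i) * r + c + q * (f * f)) ∎)

-- The sum of inverse squares modulo p

inv-2* : ∀ n .{{_ : NonZero n}} → inv (2 ℕ.* n) * inv (2 ℕ.* n) ≡ (+ 1 / 4) * (inv n * inv n)
inv-2* n = sym (trans (cong (λ x → (+ 1 / 4) * (x * x)) (inv-factor 2 n)) (eq (inv (2 ℕ.* n))))
  where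
  eq : ∀ x → (+ 1 / 4) * (x * fromℕ 2 * (x * fromℕ 2)) ≡ x * x
  eq = solve-∀ ℚ-ring

module OddPrime (N : ℕ) (p-prime : Prime (suc (2 ℕ.* N))) where
  open Products (suc (2 ℕ.* N)) p-prime public

  private
    p : ℕ
    p = suc (2 ℕ.* N)

  -- 1/a² - 1/b² = (1/a + 1/b) (1/a - 1/b), and 1/a + 1/b = (a + b)/(a b) is divisible by p.
  inv²-reflect : ∀ a b .{{_ : NonZero a}} .{{_ : NonZero b}} → a ℕ.+ b ≡ p →
    inv a * inv a ≈ inv b * inv b mod 1
  inv²-reflect a b a+b≡p = congruent ((inv a - inv b) * (inv a * inv b))
    (Local-* (Local-+ la (Local-neg lb)) (Local-* la lb))
    (begin
      inv a * inv a
        ≡⟨ eq₁ (inv a) (inv b) ⟩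
      inv b * inv b + (1ℚ * inv b + 1ℚ * inv a) * (inv a - inv b)
        ≡⟨ cong₂ (λ x y → inv b * inv b + (x * inv b + y * inv a) * (inv a - inv b))
             (inv-cancel a) (inv-cancel b) ⟨
      inv b * inv b + (inv a * fromℕ a * inv b + inv b * fromℕ b * inv a) * (inv a - inv b)
        ≡⟨ eq₂ (inv a) (inv b) (fromℕ a) (fromℕ b) ⟩
      inv b * inv b + (fromℕ a + fromℕ b) * 1ℚ * ((inv a - inv b) * (inv a * inv b))
        ≡⟨ cong (λ x → inv b * inv b + x * 1ℚ * ((inv a - inv b) * (inv a * inv b)))
             (trans (sym (fromℕ-+ a b)) (cong fromℕ a+b≡p)) ⟩
      inv b * inv b + X ^ 1 * ((inv a - inv b) * (inv a * inv b)) ∎)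
    where
    a<p : a ℕ.< p
    a<p = subst (a ℕ.<_) a+b≡p (ℕₚ.m<m+n a (ℕ.>-nonZero⁻¹ b))
    b<p : b ℕ.< p
    b<p = subst (b ℕ.<_) (trans (ℕₚ.+-comm b a) a+b≡p) (ℕₚ.m<m+n b (ℕ.>-nonZero⁻¹ a))
    la : Local (inv a)
    la = Local-inv a a<p
    lb : Local (inv b)
    lb = Local-inv b b<p
    eq₁ : ∀ x y → x * x ≡ y * y + (1ℚ * y + 1ℚ * x) * (x - y)
    eq₁ = solve-∀ ℚ-ring
    eq₂ : ∀ x y a b → y * y + (x * a * y + y * b * x) * (x - y) ≡ y * y + (a + b) * 1ℚ * ((x - y) * (x * y))
    eq₂ = solve-∀ ℚ-ring

  N<p : N ℕ.< p
  N<p = s≤s (ℕₚ.m≤m+n N (N ℕ.+ 0))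

  2<p : 0 ℕ.< N → 2 ℕ.< p
  2<p 0<N = s≤s (ℕₚ.+-mono-≤ 0<N (ℕₚ.≤-trans 0<N (ℕₚ.m≤m+n N 0)))

  private
    H : ℕ → ℚ
    H = sumInvSq

    ¼ : ℚ
    ¼ = + 1 / 4

  -- Each step trades the inverse square at N + m + 1 for the one at p - (N + m + 1) = n + 1. The
  -- case m = N, n = 0 gives H(p - 1) ≡ 2 H(N).
  reflect-upper : ∀ m n → n ℕ.+ m ≡ N → H (N ℕ.+ m) + H n ≈ H N + H N mod 1
  reflect-upper zero n refl = ≈-reflexive 1
    (cong₂ (λ a b → H a + H b) (ℕₚ.+-identityʳ N) (sym (ℕₚ.+-identityʳ n)))
  reflect-upper (suc m) n n+1+m≡N = ≈-trans
    (≈-reflexive 1 (trans (cong (λ k → H k + H n) (ℕₚ.+-suc N m))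
      (swap (H (N ℕ.+ m)) (r * r) (H n))))
    (≈-trans (+-cong-≈ (≈-refl {H (N ℕ.+ m)}) (+-cong-≈ (≈-refl {H n}) (inv²-reflect (suc (N ℕ.+ m)) (suc n) total)))
      (reflect-upper m (suc n) (trans (sym (ℕₚ.+-suc n m)) n+1+m≡N)))
    where
    r : ℚ
    r = inv (suc (N ℕ.+ m))
    swap : ∀ a b c → a + b + c ≡ a + (c + b)
    swap = solve-∀ ℚ-ring
    index : ∀ n m → suc (n ℕ.+ suc m ℕ.+ m) ℕ.+ suc n ≡ suc (2 ℕ.* (n ℕ.+ suc m))
    index = ℕ-Solver.solve-∀
    total : suc (N ℕ.+ m) ℕ.+ suc n ≡ p
    total = subst (λ k → suc (k ℕ.+ m) ℕ.+ suc n ≡ suc (2 ℕ.* k)) n+1+m≡N (index n m)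

  -- Even indices 2l contribute 1/(4 l²) outright; an odd index 2m + 1 is first reflected to the
  -- even number p - (2m + 1) = 2(n + 1). The case m = N, n = 0 gives H(p - 1) ≡ H(N)/2.
  even-odd-split : ∀ m n → m ℕ.+ n ≡ N →
    H (2 ℕ.* m) + ¼ * H n ≈ ¼ * H N + ¼ * H m mod 1
  even-odd-split zero n refl = ≈-reflexive 1 (eq (¼ * H N))
    where
    eq : ∀ a → 0ℚ + a ≡ a + ¼ * 0ℚ
    eq = solve-∀ ℚ-ring
  even-odd-split (suc m) n 1+m+n≡N = ≈-trans
    (≈-reflexive 1 (trans (cong (λ k → H k + ¼ * H n) (double m))
      (trans (cong (λ y → H (2 ℕ.* m) + o * o + y + ¼ * H n) e²≡)
        (regroup (H (2 ℕ.* m)) (o * o) (¼ * (i * i)) (¼ * H n)))))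
    (≈-trans (+-cong-≈ (≈-refl {H (2 ℕ.* m) + ¼ * H n + ¼ * (i * i)}) odd≈)
    (≈-trans (≈-reflexive 1 (regroup′ (H (2 ℕ.* m)) (H n) (¼ * (i * i)) (inv (suc n) * inv (suc n))))
    (≈-trans (+-cong-≈ (even-odd-split m (suc n) (trans (ℕₚ.+-suc m n) 1+m+n≡N)) (≈-refl {¼ * (i * i)}))
      (≈-reflexive 1 (collect (¼ * H N) (H m) (i * i))))))
    where
    o i : ℚ
    o = inv (suc (2 ℕ.* m))
    i = inv (suc m)
    double : ∀ m → 2 ℕ.* suc m ≡ suc (suc (2 ℕ.* m))
    double = ℕ-Solver.solve-∀
    e²≡ : inv (suc (suc (2 ℕ.* m))) * inv (suc (suc (2 ℕ.* m))) ≡ ¼ * (i * i)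
    e²≡ = trans (cong (λ k → inv k * inv k) (sym (double m))) (inv-2* (suc m))
    index : ∀ m n → suc (2 ℕ.* m) ℕ.+ 2 ℕ.* suc n ≡ suc (2 ℕ.* (suc m ℕ.+ n))
    index = ℕ-Solver.solve-∀
    odd≈ : o * o ≈ ¼ * (inv (suc n) * inv (suc n)) mod 1
    odd≈ = ≈-trans (inv²-reflect (suc (2 ℕ.* m)) (2 ℕ.* suc n)
        (trans (index m n) (cong (λ k → suc (2 ℕ.* k)) 1+m+n≡N)))
      (≈-reflexive 1 (inv-2* (suc n)))
    regroup : ∀ a b c d → a + b + c + d ≡ a + d + c + b
    regroup = solve-∀ ℚ-ring
    regroup′ : ∀ a b c d → a + (+ 1 / 4) * b + c + (+ 1 / 4) * d ≡ a + (+ 1 / 4) * (b + d) + c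
    regroup′ = solve-∀ ℚ-ring
    collect : ∀ a b c → a + (+ 1 / 4) * b + (+ 1 / 4) * c ≡ a + (+ 1 / 4) * (b + c)
    collect = solve-∀ ℚ-ring

  -- Summing 1/l² over 0 < l < p by l ↔ p − l gives 2 H, while splitting into even
  -- and odd l gives H/2; hence 3 H ≡ 0.
  sumInvSq-mod-p : 1 ℕ.< N → H N ≈ 0ℚ mod 1
  sumInvSq-mod-p 1<N = ≈-trans (≈-reflexive 1 (scale (H N)))
    (≈-trans (*-cong-≈ l⅔ (Local-fromℕ 0) (≈-refl {+ 2 / 3}) difference) (≈-reflexive 1 refl))
    where
    3<p : 3 ℕ.< p
    3<p = s≤s (ℕₚ.≤-trans (ℕₚ.n≤1+n 3) (ℕₚ.+-mono-≤ 1<N (ℕₚ.≤-trans 1<N (ℕₚ.m≤m+n N 0))))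
    l⅔ : Local (+ 2 / 3)
    l⅔ = Local-* (Local-fromℕ 2) (Local-inv 3 3<p)
    scale : ∀ h → h ≡ (+ 2 / 3) * (h + h + - ((+ 1 / 4) * h + (+ 1 / 4) * h))
    scale = solve-∀ ℚ-ring
    quarter : H N + H N ≈ ¼ * H N + ¼ * H N mod 1
    quarter = ≈-trans (≈-sym (reflect-upper N 0 refl))
      (≈-trans (≈-reflexive 1 (trans (cong (λ k → H k + 0ℚ) (cong (N ℕ.+_) (sym (ℕₚ.+-identityʳ N)))) (drop (H (2 ℕ.* N)))))
        (even-odd-split N 0 (ℕₚ.+-identityʳ N)))
      where
      drop : ∀ a → a + 0ℚ ≡ a + (+ 1 / 4) * 0ℚ
      drop = solve-∀ ℚ-ring
    difference : H N + H N + - (¼ * H N + ¼ * H N) ≈ 0ℚ mod 1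
    difference = ≈-trans (+-cong-≈ quarter (≈-refl { - (¼ * H N + ¼ * H N)}))
      (≈-reflexive 1 (ℚₚ.+-inverseʳ (¼ * H N + ¼ * H N)))

-- The terms of the antidiagonal sum

-- Among the odd numbers up to 4N + 3 = 2p + 1, the prime p sits in the middle; the last one is kept
-- apart.
dfac-p : ∀ N → let X = fromℕ (suc (2 ℕ.* N)) in
  dfac (suc (suc (2 ℕ.* N))) ≡ dfac N * X * rise (fromℕ 2) X N * (fromℕ 2 * X + 1ℚ)
dfac-p N = trans (dfac-suc (suc (2 ℕ.* N))) (cong (_* (fromℕ 2 * fromℕ (suc (2 ℕ.* N)) + 1ℚ))
  (trans (cong (λ m → dfac (suc (N ℕ.+ m))) (ℕₚ.+-identityʳ N)) (dfac-above N N (fromℕ-odd N))))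

-- Here the powers of p can be counted. Two factors X are explicit, the one in (2N + j + 1)! has
-- cancelled against (2N + 1)!, and two more sit in the square of `dfac (suc N)`. These last are
-- cancelled by `dfac⁻¹ (suc i)` exactly if i = N, while `fac⁻¹ (suc N + j)` has p in its
-- denominator exactly if j = N. This singles out the two end terms.
term-expand : ∀ {N} i j → i ℕ.+ j ≡ N → let X = fromℕ (suc (2 ℕ.* N)) in
  term i j ≡ fromℕ 3 * (-¼ ^ j * ¹/₁₆ ^ N) * (fromℕ 4 * fromℕ j + 1ℚ)
    * (dfac N * X * rise (fromℕ 2) X i * dfac j * rise 1ℚ X j)
    * (dfac (suc N) * dfac⁻¹ (suc i) * (dfac (suc N) * dfac⁻¹ (suc i)))
    * (dfac N * X * rise (fromℕ 2) X N * (fromℕ 2 * X + 1ℚ))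
    * (fac⁻¹ j * (fac⁻¹ (suc N ℕ.+ j) * fac⁻¹ (suc N ℕ.+ j)) * (fac⁻¹ N * fac⁻¹ N))
term-expand {N} i j refl = begin
  term i j
    ≡⟨ monomial-def _ _ _ _ _ _ _ _ _ _ _ ⟩
  c * (dfac (lin 2 1 1 i j) * dfac (lin 0 1 0 i j) * fac (lin 2 3 1 i j)
      * (dfac (lin 1 1 1 i j) * dfac (lin 1 1 1 i j)) * dfac (lin 2 2 2 i j))
    * (dfac⁻¹ (lin 1 0 1 i j) * dfac⁻¹ (lin 1 0 1 i j) * fac⁻¹ (lin 0 1 0 i j)
      * (fac⁻¹ (lin 1 2 1 i j) * fac⁻¹ (lin 1 2 1 i j)) * fac⁻¹ (lin 2 2 1 i j)
      * (fac⁻¹ (lin 1 1 0 i j) * fac⁻¹ (lin 1 1 0 i j)))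
    ≡⟨ cong₂ (λ x y → c * x * y)
         (cong₂ _*_ (cong₂ _*_ (cong₂ _*_ (cong₂ _*_
             (trans (cong dfac (i211 i j)) (dfac-above N i (fromℕ-odd N)))
             (cong dfac (i010 i j)))
             (trans (cong fac (i231 i j)) (fac-above p j)))
             (cong (λ m → dfac m * dfac m) (i111 i j)))
             (trans (cong dfac (i222 i j)) (dfac-p N)))
         (cong₂ _*_ (cong₂ _*_ (cong₂ _*_ (cong₂ _*_
             (cong (λ m → dfac⁻¹ m * dfac⁻¹ m) (i101 i j))
             (cong fac⁻¹ (i010 i j)))
             (cong (λ m → fac⁻¹ m * fac⁻¹ m) (i121 i j)))
             (cong fac⁻¹ (i221 i j)))
             (cong (λ m → fac⁻¹ m * fac⁻¹ m) (i110 i j))) ⟩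
  c * (a * dfac j * (fac p * r) * (dfac (suc N) * dfac (suc N)) * D)
    * (dfac⁻¹ (suc i) * dfac⁻¹ (suc i) * fac⁻¹ j * (φ * φ) * fac⁻¹ p * (fac⁻¹ N * fac⁻¹ N))
    ≡⟨ regroup c a (dfac j) (fac p) r (dfac (suc N)) D (dfac⁻¹ (suc i)) (fac⁻¹ j) φ (fac⁻¹ p) (fac⁻¹ N) ⟩
  c * (a * dfac j * r) * (dfac (suc N) * dfac⁻¹ (suc i) * (dfac (suc N) * dfac⁻¹ (suc i))) * D
    * (fac⁻¹ j * (φ * φ) * (fac⁻¹ N * fac⁻¹ N)) * (fac⁻¹ p * fac p)
    ≡⟨ trans (cong (z *_) (fac-cancel p)) (ℚₚ.*-identityʳ z) ⟩
  z ∎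
  where
  p : ℕ
  p = suc (2 ℕ.* N)
  X c a r D φ z : ℚ
  X = fromℕ p
  c = fromℕ 3 * (-¼ ^ j * ¹/₁₆ ^ N) * (fromℕ 4 * fromℕ j + 1ℚ)
  a = dfac N * X * rise (fromℕ 2) X i
  r = rise 1ℚ X j
  D = dfac N * X * rise (fromℕ 2) X N * (fromℕ 2 * X + 1ℚ)
  φ = fac⁻¹ (suc N ℕ.+ j)
  z = c * (a * dfac j * r) * (dfac (suc N) * dfac⁻¹ (suc i) * (dfac (suc N) * dfac⁻¹ (suc i))) * D
    * (fac⁻¹ j * (φ * φ) * (fac⁻¹ N * fac⁻¹ N))
  i211 : ∀ i j → 2 ℕ.* i ℕ.+ 1 ℕ.* j ℕ.+ 1 ≡ suc (i ℕ.+ j) ℕ.+ i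
  i211 = ℕ-Solver.solve-∀
  i010 : ∀ i j → 0 ℕ.* i ℕ.+ 1 ℕ.* j ℕ.+ 0 ≡ j
  i010 = ℕ-Solver.solve-∀
  i231 : ∀ i j → 2 ℕ.* i ℕ.+ 3 ℕ.* j ℕ.+ 1 ≡ suc (2 ℕ.* (i ℕ.+ j)) ℕ.+ j
  i231 = ℕ-Solver.solve-∀
  i111 : ∀ i j → 1 ℕ.* i ℕ.+ 1 ℕ.* j ℕ.+ 1 ≡ suc (i ℕ.+ j)
  i111 = ℕ-Solver.solve-∀
  i222 : ∀ i j → 2 ℕ.* i ℕ.+ 2 ℕ.* j ℕ.+ 2 ≡ suc (suc (2 ℕ.* (i ℕ.+ j)))
  i222 = ℕ-Solver.solve-∀
  i101 : ∀ i j → 1 ℕ.* i ℕ.+ 0 ℕ.* j ℕ.+ 1 ≡ suc i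
  i101 = ℕ-Solver.solve-∀
  i121 : ∀ i j → 1 ℕ.* i ℕ.+ 2 ℕ.* j ℕ.+ 1 ≡ suc (i ℕ.+ j) ℕ.+ j
  i121 = ℕ-Solver.solve-∀
  i221 : ∀ i j → 2 ℕ.* i ℕ.+ 2 ℕ.* j ℕ.+ 1 ≡ suc (2 ℕ.* (i ℕ.+ j))
  i221 = ℕ-Solver.solve-∀
  i110 : ∀ i j → 1 ℕ.* i ℕ.+ 1 ℕ.* j ℕ.+ 0 ≡ i ℕ.+ j
  i110 = ℕ-Solver.solve-∀
  regroup : ∀ c a d f r s D e₁ e₂ φ ε e →
    c * (a * d * (f * r) * (s * s) * D) * (e₁ * e₁ * e₂ * (φ * φ) * ε * (e * e))
    ≡ c * (a * d * r) * (s * e₁ * (s * e₁)) * D * (e₂ * (φ * φ) * (e * e)) * (ε * f)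
  regroup = solve-∀ ℚ-ring

-- The two end terms in closed form

module Boundary (N : ℕ) where
  private
    p : ℕ
    p = suc (2 ℕ.* N)

    X e f V W : ℚ
    X = fromℕ p
    e = fac⁻¹ N
    f = fac N
    V = -¼ ^ N
    W = ¹/₁₆ ^ N

  -- `A` and `B` belong to -p and -p/2, their variants with ⁺ to p and p/2. `Y` is the inverse of
  -- the central binomial coefficient of 2N over N, and `u` equals 2/(p + 1).
  ½ u A B B⁺ A⁺ Y : ℚ
  ½ = + 1 / 2
  u = inv (suc N)
  A = Π (- 1ℚ * X) N
  B = Π (- ½ * X) N
  B⁺ = Π (½ * X) N
  A⁺ = Π (1ℚ * X) N
  Y = f * f * fac⁻¹ (2 ℕ.* N)

  private
    dfac-N : dfac N ≡ (- fromℕ 2) ^ N * f * B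
    dfac-N = trans (dfac-below N 0 N (fromℕ-odd N) refl)
      (trans (cong (_* rise (- fromℕ 2) X N) (dfac-def 0))
      (trans (ℚₚ.*-identityˡ (rise (- fromℕ 2) X N)) (rise-Π (- fromℕ 2) (- ½) X N refl)))

    rise-2 : rise (fromℕ 2) X N ≡ fromℕ 2 ^ N * f * B⁺
    rise-2 = rise-Π (fromℕ 2) ½ X N refl

    powers : ∀ a b c d → a * b * (c * d) ≡ 1ℚ → a ^ N * b ^ N * (c ^ N * d ^ N) ≡ 1ℚ
    powers a b c d eq = trans (cong₂ _*_ (sym (^-distrib-* a b N)) (sym (^-distrib-* c d N)))
      (^-inverse (a * b) (c * d) N eq)

  -- Since i = N, the quotient of the two `dfac (suc N)` is 1 and only p² remains. `u` comes from (N
  -- + 1)! = (N + 1) N!, and all powers of 2 cancel.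
  term-N-0 : term N 0 ≡ fromℕ 3 * (X * X) * (fromℕ 2 * X + 1ℚ) * (B⁺ * B * (B⁺ * B)) * (u * u)
  term-N-0 = begin
    term N 0
      ≡⟨ term-expand N 0 (ℕₚ.+-identityʳ N) ⟩
    fromℕ 3 * (1ℚ * W) * 1ℚ * (dfac N * X * r * dfac 0 * 1ℚ)
      * (dfac (suc N) * dfac⁻¹ (suc N) * (dfac (suc N) * dfac⁻¹ (suc N)))
      * (dfac N * X * r * k) * (fac⁻¹ 0 * (fac⁻¹ (suc N ℕ.+ 0) * fac⁻¹ (suc N ℕ.+ 0)) * (e * e))
      ≡⟨ cong₂ (λ x y → fromℕ 3 * (1ℚ * W) * 1ℚ * (dfac N * X * r * x * 1ℚ) * (y * y)
           * (dfac N * X * r * k) * (fac⁻¹ 0 * (fac⁻¹ (suc N ℕ.+ 0) * fac⁻¹ (suc N ℕ.+ 0)) * (e * e)))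
           (dfac-def 0) (trans (ℚₚ.*-comm (dfac (suc N)) (dfac⁻¹ (suc N))) (dfac-cancel (suc N))) ⟩
    fromℕ 3 * (1ℚ * W) * 1ℚ * (dfac N * X * r * 1ℚ * 1ℚ) * (1ℚ * 1ℚ)
      * (dfac N * X * r * k) * (fac⁻¹ 0 * (fac⁻¹ (suc N ℕ.+ 0) * fac⁻¹ (suc N ℕ.+ 0)) * (e * e))
      ≡⟨ cong₂ (λ x y → fromℕ 3 * (1ℚ * W) * 1ℚ * (dfac N * X * r * 1ℚ * 1ℚ) * (1ℚ * 1ℚ)
           * (dfac N * X * r * k) * (x * (y * y) * (e * e))) (fac⁻¹-def 0) φ ⟩
    fromℕ 3 * (1ℚ * W) * 1ℚ * (dfac N * X * r * 1ℚ * 1ℚ) * (1ℚ * 1ℚ)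
      * (dfac N * X * r * k) * (1ℚ * (u * e * (u * e)) * (e * e))
      ≡⟨ cong₂ (λ x y → fromℕ 3 * (1ℚ * W) * 1ℚ * (x * X * y * 1ℚ * 1ℚ) * (1ℚ * 1ℚ)
           * (x * X * y * k) * (1ℚ * (u * e * (u * e)) * (e * e))) dfac-N rise-2 ⟩
    fromℕ 3 * (1ℚ * W) * 1ℚ * (a * f * B * X * (b * f * B⁺) * 1ℚ * 1ℚ) * (1ℚ * 1ℚ)
      * (a * f * B * X * (b * f * B⁺) * k) * (1ℚ * (u * e * (u * e)) * (e * e))
      ≡⟨ regroup W a b f e B B⁺ X k u ⟩
    z * (W * b * b * (a * a)) * (e * f * (e * f) * (e * f * (e * f)))
      ≡⟨ cong₂ (λ x y → z * x * (y * y * (y * y))) pow (fac-cancel N) ⟩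
    z * 1ℚ * (1ℚ * 1ℚ * (1ℚ * 1ℚ))
      ≡⟨ trans (ℚₚ.*-identityʳ (z * 1ℚ)) (ℚₚ.*-identityʳ z) ⟩
    z ∎
    where
    r k a b z : ℚ
    r = rise (fromℕ 2) X N
    k = fromℕ 2 * X + 1ℚ
    a = (- fromℕ 2) ^ N
    b = fromℕ 2 ^ N
    z = fromℕ 3 * (X * X) * k * (B⁺ * B * (B⁺ * B)) * (u * u)
    φ : fac⁻¹ (suc N ℕ.+ 0) ≡ u * e
    φ = trans (cong fac⁻¹ (ℕₚ.+-identityʳ (suc N))) (sym (trans
      (cong (u *_) (fac⁻¹-step refl (sym (fromℕ-suc N))))
      (trans (swap u (fac⁻¹ (suc N)) (fromℕ (suc N)))
      (trans (cong (fac⁻¹ (suc N) *_) (inv-cancel (suc N))) (ℚₚ.*-identityʳ (fac⁻¹ (suc N)))))))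
      where
      swap : ∀ u x y → u * (x * y) ≡ x * (u * y)
      swap = solve-∀ ℚ-ring
    pow : W * b * b * (a * a) ≡ 1ℚ
    pow = trans (cong (_* (a * a)) (cong (_* b) (sym (^-distrib-* ¹/₁₆ (fromℕ 2) N))))
      (powers (¹/₁₆ * fromℕ 2) (fromℕ 2) (- fromℕ 2) (- fromℕ 2) refl)
    regroup : ∀ W a b f e B B⁺ X k u →
      fromℕ 3 * (1ℚ * W) * 1ℚ * (a * f * B * X * (b * f * B⁺) * 1ℚ * 1ℚ) * (1ℚ * 1ℚ)
        * (a * f * B * X * (b * f * B⁺) * k) * (1ℚ * (u * e * (u * e)) * (e * e))
      ≡ fromℕ 3 * (X * X) * k * (B⁺ * B * (B⁺ * B)) * (u * u)
        * (W * b * b * (a * a)) * (e * f * (e * f) * (e * f * (e * f)))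
    regroup = solve-∀ ℚ-ring

  -- Of four factors p, two are absorbed by the squared inverse of p!, turning it into that of
  -- (2N)!. The weight 4N + 1 is 2p - 1.
  term-0-N : term 0 N ≡ fromℕ 3 * (fromℕ 2 * X - 1ℚ) * (fromℕ 2 * X + 1ℚ) * (X * X)
    * (B * B * (B * B) * (B⁺ * B) * A⁺) * (Y * Y)
  term-0-N = begin
    term 0 N
      ≡⟨ term-expand 0 N refl ⟩
    fromℕ 3 * (V * W) * (fromℕ 4 * fromℕ N + 1ℚ) * (dfac N * X * 1ℚ * dfac N * rise 1ℚ X N)
      * (dfac (suc N) * dfac⁻¹ 1 * (dfac (suc N) * dfac⁻¹ 1))
      * (dfac N * X * r * k) * (e * (fac⁻¹ (suc N ℕ.+ N) * fac⁻¹ (suc N ℕ.+ N)) * (e * e))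
      ≡⟨ cong₂ (λ x y → fromℕ 3 * (V * W) * x * (dfac N * X * 1ℚ * dfac N * rise 1ℚ X N)
           * (y * y) * (dfac N * X * r * k)
           * (e * (fac⁻¹ (suc N ℕ.+ N) * fac⁻¹ (suc N ℕ.+ N)) * (e * e))) 4N+1 ρ ⟩
    fromℕ 3 * (V * W) * l * (dfac N * X * 1ℚ * dfac N * rise 1ℚ X N)
      * (dfac N * X * (dfac N * X))
      * (dfac N * X * r * k) * (e * (fac⁻¹ (suc N ℕ.+ N) * fac⁻¹ (suc N ℕ.+ N)) * (e * e))
      ≡⟨ cong₂ (λ x y → fromℕ 3 * (V * W) * l * (dfac N * X * 1ℚ * dfac N * x)
           * (dfac N * X * (dfac N * X)) * (dfac N * X * r * k) * (e * (y * y) * (e * e)))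
           rise-1 (cong (λ m → fac⁻¹ (suc (N ℕ.+ m))) (sym (ℕₚ.+-identityʳ N))) ⟩
    fromℕ 3 * (V * W) * l * (dfac N * X * 1ℚ * dfac N * (f * A⁺))
      * (dfac N * X * (dfac N * X)) * (dfac N * X * r * k) * (e * (fac⁻¹ p * fac⁻¹ p) * (e * e))
      ≡⟨ cong₂ (λ x y → fromℕ 3 * (V * W) * l * (x * X * 1ℚ * x * (f * A⁺))
           * (x * X * (x * X)) * (x * X * y * k) * (e * (fac⁻¹ p * fac⁻¹ p) * (e * e))) dfac-N rise-2 ⟩
    fromℕ 3 * (V * W) * l * (a * f * B * X * 1ℚ * (a * f * B) * (f * A⁺))
      * (a * f * B * X * (a * f * B * X)) * (a * f * B * X * (b * f * B⁺) * k)
      * (e * (fac⁻¹ p * fac⁻¹ p) * (e * e))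
      ≡⟨ regroup (V * W) l k X (a * f * B) f (f * A⁺) (b * f * B⁺) e (fac⁻¹ p) ⟩
    fromℕ 3 * l * k * (X * X) * (V * W)
      * (a * f * B * (a * f * B) * (a * f * B * (a * f * B)) * (a * f * B * (b * f * B⁺)) * (f * A⁺))
      * (e * e * e) * (fac⁻¹ p * X * (fac⁻¹ p * X))
      ≡⟨ cong (λ y → fromℕ 3 * l * k * (X * X) * (V * W)
      * (a * f * B * (a * f * B) * (a * f * B * (a * f * B)) * (a * f * B * (b * f * B⁺)) * (f * A⁺))
      * (e * e * e) * (y * y)) (sym φ) ⟩
    fromℕ 3 * l * k * (X * X) * (V * W)
      * (a * f * B * (a * f * B) * (a * f * B * (a * f * B)) * (a * f * B * (b * f * B⁺)) * (f * A⁺))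
      * (e * e * e) * (y * y)
      ≡⟨ regroup′ (fromℕ 3 * l * k * (X * X)) (V * W) a b f e B B⁺ A⁺ y ⟩
    z * (V * W * (a * a * (a * a) * (a * b))) * (e * f * (e * f) * (e * f))
      ≡⟨ cong₂ (λ x y → z * x * (y * y * y)) pow (fac-cancel N) ⟩
    z * 1ℚ * (1ℚ * 1ℚ * 1ℚ)
      ≡⟨ trans (ℚₚ.*-identityʳ (z * 1ℚ)) (ℚₚ.*-identityʳ z) ⟩
    z ∎
    where
    r k l a b y z : ℚ
    r = rise (fromℕ 2) X N
    k = fromℕ 2 * X + 1ℚ
    l = fromℕ 2 * X - 1ℚ
    a = (- fromℕ 2) ^ N
    b = fromℕ 2 ^ N
    y = fac⁻¹ (2 ℕ.* N)
    z = fromℕ 3 * l * k * (X * X) * (B * B * (B * B) * (B⁺ * B) * A⁺) * (f * f * y * (f * f * y))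
    4N+1 : fromℕ 4 * fromℕ N + 1ℚ ≡ l
    4N+1 = trans (eq (fromℕ N)) (cong (λ x → fromℕ 2 * x - 1ℚ) (sym (fromℕ-odd N)))
      where
      eq : ∀ n → fromℕ 4 * n + 1ℚ ≡ fromℕ 2 * (fromℕ 2 * n + 1ℚ) - 1ℚ
      eq = solve-∀ ℚ-ring
    ρ : dfac (suc N) * dfac⁻¹ 1 ≡ dfac N * X
    ρ = trans (cong₂ _*_ (dfac-step refl (sym (fromℕ-odd N))) (dfac⁻¹-def 1)) (ℚₚ.*-identityʳ (dfac N * X))
    rise-1 : rise 1ℚ X N ≡ f * A⁺
    rise-1 = trans (rise-Π 1ℚ 1ℚ X N refl) (cong (_* A⁺) (trans (cong (_* f) (1^n≡1 N)) (ℚₚ.*-identityˡ f)))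
    φ : y ≡ fac⁻¹ p * X
    φ = fac⁻¹-step refl (sym (fromℕ-suc (2 ℕ.* N)))
    pow : V * W * (a * a * (a * a) * (a * b)) ≡ 1ℚ
    pow = trans (cong (λ x → V * W * (x * (a * b)))
        (trans (cong₂ _*_ (sym (^-distrib-* (- fromℕ 2) (- fromℕ 2) N)) (sym (^-distrib-* (- fromℕ 2) (- fromℕ 2) N)))
          (sym (^-distrib-* (fromℕ 4) (fromℕ 4) N))))
      (trans (cong (λ x → V * W * (fromℕ 16 ^ N * x)) (sym (^-distrib-* (- fromℕ 2) (fromℕ 2) N)))
        (powers -¼ ¹/₁₆ (fromℕ 16) (- fromℕ 4) refl))
    regroup : ∀ s l k X d f fP r e φ →
      fromℕ 3 * s * l * (d * X * 1ℚ * d * fP) * (d * X * (d * X)) * (d * X * r * k) * (e * (φ * φ) * (e * e))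
      ≡ fromℕ 3 * l * k * (X * X) * s * (d * d * (d * d) * (d * r) * fP) * (e * e * e) * (φ * X * (φ * X))
    regroup = solve-∀ ℚ-ring
    regroup′ : ∀ s t a b f e B B⁺ A⁺ y →
      s * t * (a * f * B * (a * f * B) * (a * f * B * (a * f * B)) * (a * f * B * (b * f * B⁺)) * (f * A⁺))
        * (e * e * e) * (y * y)
      ≡ s * (B * B * (B * B) * (B⁺ * B) * A⁺) * (f * f * y * (f * f * y))
        * (t * (a * a * (a * a) * (a * b))) * (e * f * (e * f) * (e * f))
    regroup′ = solve-∀ ℚ-ring

  private
    fac-2N : fac (2 ℕ.* N) ≡ (- 1ℚ) ^ N * (f * f) * A
    fac-2N = trans (fac-below (2 ℕ.* N) N N (fromℕ-suc (2 ℕ.* N)) (cong (N ℕ.+_) (sym (ℕₚ.+-identityʳ N))))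
      (trans (cong (f *_) (rise-Π (- 1ℚ) (- 1ℚ) X N refl)) (eq f ((- 1ℚ) ^ N) A))
      where
      eq : ∀ f s A → f * (s * f * A) ≡ s * (f * f) * A
      eq = solve-∀ ℚ-ring

  -- Two evaluations of (2N)!: its upper half as the product of p - l gives (-1)ᴺ N!² A, while its
  -- odd and even factors give (-2)ᴺ N! B · 2ᴺ N!.
  A≡4^N*B : A ≡ fromℕ 4 ^ N * B
  A≡4^N*B = begin
    A
      ≡⟨ one A ⟩
    1ℚ * (1ℚ * 1ℚ) * A
      ≡⟨ cong₂ (λ x y → x * (y * y) * A) (^-inverse (- 1ℚ) (- 1ℚ) N refl) (fac-cancel N) ⟨
    s * s * (e * f * (e * f)) * A
      ≡⟨ regroup s e f A ⟩
    s * (e * e) * (s * (f * f) * A)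
      ≡⟨ cong (s * (e * e) *_) (trans (sym fac-2N) (fac-2* N)) ⟩
    s * (e * e) * (dfac N * fromℕ 2 ^ N * f)
      ≡⟨ cong (λ x → s * (e * e) * (x * fromℕ 2 ^ N * f)) dfac-N ⟩
    s * (e * e) * ((- fromℕ 2) ^ N * f * B * fromℕ 2 ^ N * f)
      ≡⟨ regroup′ s e ((- fromℕ 2) ^ N) f B (fromℕ 2 ^ N) ⟩
    s * ((- fromℕ 2) ^ N * fromℕ 2 ^ N) * (e * f * (e * f)) * B
      ≡⟨ cong₂ (λ x y → x * (y * y) * B) pow (fac-cancel N) ⟩
    fromℕ 4 ^ N * (1ℚ * 1ℚ) * B
      ≡⟨ cong (_* B) (ℚₚ.*-identityʳ (fromℕ 4 ^ N)) ⟩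
    fromℕ 4 ^ N * B ∎
    where
    s : ℚ
    s = (- 1ℚ) ^ N
    one : ∀ x → x ≡ 1ℚ * (1ℚ * 1ℚ) * x
    one = solve-∀ ℚ-ring
    regroup : ∀ s e f A → s * s * (e * f * (e * f)) * A ≡ s * (e * e) * (s * (f * f) * A)
    regroup = solve-∀ ℚ-ring
    regroup′ : ∀ s e a f B b → s * (e * e) * (a * f * B * b * f) ≡ s * (a * b) * (e * f * (e * f)) * B
    regroup′ = solve-∀ ℚ-ring
    pow : s * ((- fromℕ 2) ^ N * fromℕ 2 ^ N) ≡ fromℕ 4 ^ N
    pow = trans (cong (s *_) (sym (^-distrib-* (- fromℕ 2) (fromℕ 2) N)))
      (sym (^-distrib-* (- 1ℚ) (- fromℕ 4) N))

  -- By `fac-2N` the central binomial coefficient is (-1)ᴺ A; squaring removes the sign.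
  Y²A²≡1 : Y * Y * (A * A) ≡ 1ℚ
  Y²A²≡1 = begin
    Y * Y * (A * A)
      ≡⟨ one (Y * Y * (A * A)) ⟩
    1ℚ * (Y * Y * (A * A))
      ≡⟨ cong (_* (Y * Y * (A * A))) (^-inverse (- 1ℚ) (- 1ℚ) N refl) ⟨
    s * s * (Y * Y * (A * A))
      ≡⟨ regroup s f y A ⟩
    y * (s * (f * f) * A) * (y * (s * (f * f) * A))
      ≡⟨ cong (λ x → y * x * (y * x)) (sym fac-2N) ⟩
    y * fac (2 ℕ.* N) * (y * fac (2 ℕ.* N))
      ≡⟨ cong (λ x → x * x) (fac-cancel (2 ℕ.* N)) ⟩
    1ℚ ∎
    where
    s y : ℚ
    s = (- 1ℚ) ^ N
    y = fac⁻¹ (2 ℕ.* N)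
    one : ∀ x → x ≡ 1ℚ * x
    one = solve-∀ ℚ-ring
    regroup : ∀ s f y A → s * s * (f * f * y * (f * f * y) * (A * A))
      ≡ y * (s * (f * f) * A) * (y * (s * (f * f) * A))
    regroup = solve-∀ ℚ-ring

-- Rules for antidiagonal sums

antidiagonal-cong : ∀ {f g} i j → (∀ a b → a ℕ.+ b ≡ i ℕ.+ j → f a b ≡ g a b) →
  antidiagonal f i j ≡ antidiagonal g i j
antidiagonal-cong zero    j eq = eq 0 j refl
antidiagonal-cong (suc i) j eq = cong₂ _+_ (eq (suc i) j refl)
  (antidiagonal-cong i (suc j) (λ a b e → eq a b (trans e (ℕₚ.+-suc i j))))

antidiagonal-scale : ∀ c f i j → antidiagonal (λ a b → c * f a b) i j ≡ c * antidiagonal f i j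
antidiagonal-scale c f zero    j = refl
antidiagonal-scale c f (suc i) j = trans (cong (_+_ (c * f (suc i) j)) (antidiagonal-scale c f i (suc j)))
  (sym (ℚₚ.*-distribˡ-+ c (f (suc i) j) (antidiagonal f i (suc j))))

antidiagonal-+ : ∀ f g i j →
  antidiagonal (λ a b → f a b + g a b) i j ≡ antidiagonal f i j + antidiagonal g i j
antidiagonal-+ f g zero    j = refl
antidiagonal-+ f g (suc i) j = trans (cong (_+_ (f (suc i) j + g (suc i) j)) (antidiagonal-+ f g i (suc j)))
  (eq (f (suc i) j) (g (suc i) j) (antidiagonal f i (suc j)) (antidiagonal g i (suc j)))
  where
  eq : ∀ a b c d → a + b + (c + d) ≡ a + c + (b + d)
  eq = solve-∀ ℚ-ring

antidiagonal-shift : ∀ f i j → antidiagonal f i (suc j) ≡ antidiagonal (λ a b → f a (suc b)) i j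
antidiagonal-shift f zero    j = refl
antidiagonal-shift f (suc i) j = cong (_+_ (f (suc i) (suc j))) (antidiagonal-shift f i (suc j))

antidiagonal-last : ∀ f i j →
  antidiagonal f (suc i) j ≡ antidiagonal (λ a b → f (suc a) b) i j + f 0 (suc i ℕ.+ j)
antidiagonal-last f zero    j = refl
antidiagonal-last f (suc i) j = begin
  f (2 ℕ.+ i) j + antidiagonal f (suc i) (suc j)
    ≡⟨ cong (_+_ (f (2 ℕ.+ i) j)) (antidiagonal-last f i (suc j)) ⟩
  f (2 ℕ.+ i) j + (antidiagonal (λ a b → f (suc a) b) i (suc j) + f 0 (suc i ℕ.+ suc j))
    ≡⟨ cong (λ m → f (2 ℕ.+ i) j + (antidiagonal (λ a b → f (suc a) b) i (suc j) + f 0 m)) (ℕₚ.+-suc (suc i) j) ⟩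
  f (2 ℕ.+ i) j + (antidiagonal (λ a b → f (suc a) b) i (suc j) + f 0 (2 ℕ.+ i ℕ.+ j))
    ≡⟨ ℚₚ.+-assoc (f (2 ℕ.+ i) j) (antidiagonal (λ a b → f (suc a) b) i (suc j)) (f 0 (2 ℕ.+ i ℕ.+ j)) ⟨
  f (2 ℕ.+ i) j + antidiagonal (λ a b → f (suc a) b) i (suc j) + f 0 (2 ℕ.+ i ℕ.+ j) ∎

antidiagonal-flip : ∀ f n → antidiagonal f n 0 ≡ antidiagonal (λ a b → f b a) n 0
antidiagonal-flip f zero    = refl
antidiagonal-flip f (suc n) = begin
  f (suc n) 0 + antidiagonal f n 1
    ≡⟨ cong (_+_ (f (suc n) 0)) (trans (antidiagonal-shift f n 0) (antidiagonal-flip (λ a b → f a (suc b)) n)) ⟩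
  f (suc n) 0 + antidiagonal (λ a b → f b (suc a)) n 0
    ≡⟨ ℚₚ.+-comm (f (suc n) 0) (antidiagonal (λ a b → f b (suc a)) n 0) ⟩
  antidiagonal (λ a b → f b (suc a)) n 0 + f (suc n) 0
    ≡⟨ cong (λ m → antidiagonal (λ a b → f b (suc a)) n 0 + f (suc m) 0) (ℕₚ.+-identityʳ n) ⟨
  antidiagonal (λ a b → f b (suc a)) n 0 + f (suc n ℕ.+ 0) 0
    ≡⟨ antidiagonal-last (λ a b → f b a) n 0 ⟨
  antidiagonal (λ a b → f b a) (suc n) 0 ∎

-- The interior terms vanish modulo p⁵

module Interior (M : ℕ) (p-prime : Prime (suc (2 ℕ.* (2 ℕ.+ M)))) where
  open OddPrime (2 ℕ.+ M) p-prime public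

  N : ℕ
  N = 2 ℕ.+ M

  private
    e φ : ℚ
    e = fac⁻¹ N
    φ = fac⁻¹ (2 ℕ.* N)

  antidiagonal-≈ : ∀ {f g k} i j → (∀ a b → a ℕ.+ b ≡ i ℕ.+ j → f a b ≈ g a b mod k) →
    antidiagonal f i j ≈ antidiagonal g i j mod k
  antidiagonal-≈ zero    j eq = eq 0 j refl
  antidiagonal-≈ (suc i) j eq = +-cong-≈ (eq (suc i) j refl)
    (antidiagonal-≈ i (suc j) (λ a b e → eq a b (trans e (ℕₚ.+-suc i j))))

  Local-½ : Local (+ 1 / 2)
  Local-½ = Local-inv 2 (2<p (s≤s z≤n))

  Local-¼ : Local (+ 1 / 4)
  Local-¼ = Local-* Local-½ Local-½

  2N<p : 2 ℕ.* N ℕ.< suc (2 ℕ.* N)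
  2N<p = ℕₚ.n<1+n (2 ℕ.* N)

  Local--2 : Local (- fromℕ 2)
  Local--2 = Local-neg (Local-fromℕ 2)

  -- Collects the factors that are the same for all interior terms; the square of `φ` appears once
  -- (N + j + 1)! is expressed through (2N)!.
  κ : ℚ
  κ = fromℕ 3 * ¹/₁₆ ^ N * (dfac N * rise (fromℕ 2) X N * (fromℕ 2 * X + 1ℚ)) * (φ * φ) * (e * e)

  Local-κ : Local κ
  Local-κ = Local-* (Local-* (Local-* (Local-* (Local-fromℕ 3) (Local-^ N (Local-* Local-¼ Local-¼)))
      (Local-* (Local-* (Local-dfac N) (Local-rise N (Local-fromℕ 2) Local-X))
        (Local-+ (Local-* (Local-fromℕ 2) Local-X) (Local-fromℕ 1))))
      (Local-* (Local-fac⁻¹ (2 ℕ.* N) 2N<p) (Local-fac⁻¹ (2 ℕ.* N) 2N<p)))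
      (Local-* (Local-fac⁻¹ N N<p) (Local-fac⁻¹ N N<p))

  -- T(i + 1, j + 1)/p⁴: the shift makes (i, j) run over a full antidiagonal with i + j = M = N - 2.
  τ : ℕ → ℕ → ℚ
  τ i j = κ * (-¼ ^ suc j * (fromℕ 4 * fromℕ (suc j) + 1ℚ))
    * (dfac N * (rise (fromℕ 2) X (suc i) * dfac (suc j)))
    * (rise 1ℚ X (suc j) * fac⁻¹ (suc j))
    * (rise (- fromℕ 2) X j * rise (- fromℕ 2) X j)
    * (rise (- 1ℚ) X i * rise (- 1ℚ) X i)

  term-interior : ∀ i j → i ℕ.+ j ≡ M → term (suc i) (suc j) ≡ X ^ 4 * τ i j
  term-interior i j i+j≡M = begin
    term (suc i) (suc j)
      ≡⟨ term-expand (suc i) (suc j) total ⟩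
    fromℕ 3 * (V * W) * L * (dN * X * R * dj * r) * (ρ * ρ) * (dN * X * S * k) * (fj * (ψ * ψ) * (e * e))
      ≡⟨ cong₂ (λ x y → fromℕ 3 * (V * W) * L * (dN * X * R * dj * r) * (x * x)
           * (dN * X * S * k) * (fj * (y * y) * (e * e))) ρ≡ ψ≡ ⟩
    fromℕ 3 * (V * W) * L * (dN * X * R * dj * r) * (X * r₂ * (X * r₂))
      * (dN * X * S * k) * (fj * (φ * r₁ * (φ * r₁)) * (e * e))
      ≡⟨ regroup (fromℕ 3) V W L dN X R dj r r₂ S k fj (φ * r₁ * (φ * r₁)) (e * e) ⟩
    X ^ 4 * (fromℕ 3 * W * (dN * S * k) * (φ * r₁ * (φ * r₁)) * (e * e) * (V * L)
      * (dN * (R * dj)) * (r * fj) * (r₂ * r₂))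
      ≡⟨ cong (X ^ 4 *_) (regroup′ (fromℕ 3 * W * (dN * S * k)) φ r₁ (e * e) (V * L)
           (dN * (R * dj)) (r * fj) (r₂ * r₂)) ⟩
    X ^ 4 * τ i j ∎
    where
    V W L dN R dj r ρ S k fj ψ r₁ r₂ : ℚ
    V = -¼ ^ suc j
    W = ¹/₁₆ ^ N
    L = fromℕ 4 * fromℕ (suc j) + 1ℚ
    dN = dfac N
    R = rise (fromℕ 2) X (suc i)
    dj = dfac (suc j)
    r = rise 1ℚ X (suc j)
    ρ = dfac (suc N) * dfac⁻¹ (suc (suc i))
    S = rise (fromℕ 2) X N
    k = fromℕ 2 * X + 1ℚ
    fj = fac⁻¹ (suc j)
    ψ = fac⁻¹ (suc N ℕ.+ suc j)
    r₁ = rise (- 1ℚ) X i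
    r₂ = rise (- fromℕ 2) X j
    total : suc i ℕ.+ suc j ≡ N
    total = trans (cong suc (ℕₚ.+-suc i j)) (cong (2 ℕ.+_) i+j≡M)
    -- The odd numbers from 2i + 5 to p are p itself and p - 2l for l ≤ j. As ρ enters squared, this
    -- supplies p² of the p⁴.
    ρ≡ : ρ ≡ X * r₂
    ρ≡ = begin
      dfac (suc N) * d⁻¹          ≡⟨ cong (_* d⁻¹) (dfac-step refl (sym (fromℕ-odd N))) ⟩
      dN * X * d⁻¹                ≡⟨ cong (λ x → x * X * d⁻¹) (dfac-below N (2 ℕ.+ i) j (fromℕ-odd N) (cong (2 ℕ.+_) i+j≡M)) ⟩
      dfac (2 ℕ.+ i) * r₂ * X * d⁻¹ ≡⟨ eq (dfac (2 ℕ.+ i)) r₂ X d⁻¹ ⟩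
      X * r₂ * (d⁻¹ * dfac (2 ℕ.+ i)) ≡⟨ cong (X * r₂ *_) (dfac-cancel (2 ℕ.+ i)) ⟩
      X * r₂ * 1ℚ                 ≡⟨ ℚₚ.*-identityʳ (X * r₂) ⟩
      X * r₂                      ∎
      where
      d⁻¹ : ℚ
      d⁻¹ = dfac⁻¹ (2 ℕ.+ i)
      eq : ∀ d r x e → d * r * x * e ≡ x * r * (e * d)
      eq = solve-∀ ℚ-ring
    index : ∀ i j → suc (2 ℕ.+ (i ℕ.+ j)) ℕ.+ suc j ℕ.+ i ≡ 2 ℕ.* (2 ℕ.+ (i ℕ.+ j))
    index = ℕ-Solver.solve-∀
    -- From (2N)! = (N + j + 2)! (p - 1) ⋯ (p - i): the dependence on the indices moves into a
    -- product that is ± i! modulo p.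
    ψ≡ : ψ ≡ φ * r₁
    ψ≡ = begin
      ψ                               ≡⟨ ℚₚ.*-identityʳ ψ ⟨
      ψ * 1ℚ                          ≡⟨ cong (ψ *_) (fac-cancel (2 ℕ.* N)) ⟨
      ψ * (φ * fac (2 ℕ.* N))         ≡⟨ cong (λ x → ψ * (φ * x)) (fac-below (2 ℕ.* N) (suc N ℕ.+ suc j) i
                                           (fromℕ-suc (2 ℕ.* N))
                                           (subst (λ m → suc (2 ℕ.+ m) ℕ.+ suc j ℕ.+ i ≡ 2 ℕ.* (2 ℕ.+ m)) i+j≡M (index i j))) ⟩
      ψ * (φ * (fac (suc N ℕ.+ suc j) * r₁)) ≡⟨ eq ψ φ (fac (suc N ℕ.+ suc j)) r₁ ⟩
      φ * r₁ * (ψ * fac (suc N ℕ.+ suc j))   ≡⟨ cong (φ * r₁ *_) (fac-cancel (suc N ℕ.+ suc j)) ⟩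
      φ * r₁ * 1ℚ                     ≡⟨ ℚₚ.*-identityʳ (φ * r₁) ⟩
      φ * r₁                          ∎
      where
      eq : ∀ a b c d → a * (b * (c * d)) ≡ b * d * (a * c)
      eq = solve-∀ ℚ-ring
    regroup : ∀ t V W L d X R dj r r₂ S k fj q e →
      t * (V * W) * L * (d * X * R * dj * r) * (X * r₂ * (X * r₂)) * (d * X * S * k) * (fj * q * e)
      ≡ X * (X * (X * (X * 1ℚ))) * (t * W * (d * S * k) * q * e * (V * L) * (d * (R * dj)) * (r * fj) * (r₂ * r₂))
    regroup = solve-∀ ℚ-ring
    regroup′ : ∀ c φ r₁ e a b d f →
      c * (φ * r₁ * (φ * r₁)) * e * a * b * d * f ≡ c * (φ * φ) * e * a * b * d * f * (r₁ * r₁)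
    regroup′ = solve-∀ ℚ-ring

  -- Reflects odd factors above p to those below it, where they can complete `dfac (suc j)` to
  -- `dfac N`.
  rise-2-mod-p : ∀ n → rise (fromℕ 2) X n ≈ (- 1ℚ) ^ n * rise (- fromℕ 2) X n mod 1
  rise-2-mod-p n = ≈-trans (rise-mod-p n (Local-fromℕ 2)) (≈-sym (≈-trans
    (*-cong-≈ (Local-^ n (Local-neg (Local-fromℕ 1))) (Local-* (Local-^ n Local--2) (Local-fac n))
      (≈-refl {(- 1ℚ) ^ n}) (rise-mod-p n Local--2))
    (≈-reflexive 1 (trans (sym (ℚₚ.*-assoc ((- 1ℚ) ^ n) ((- fromℕ 2) ^ n) (fac n)))
      (cong (_* fac n) (sym (^-distrib-* (- 1ℚ) (- fromℕ 2) n)))))))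

  K : ℚ
  K = κ * (dfac N * dfac N) * ((+ 1 / 4) * (- 1ℚ) ^ M)

  Local-K : Local K
  Local-K = Local-* (Local-* Local-κ (Local-* (Local-dfac N) (Local-dfac N)))
    (Local-* Local-¼ (Local-^ M (Local-neg (Local-fromℕ 1))))

  σ : ℕ → ℕ → ℚ
  σ i j = (fromℕ 4 * fromℕ (suc j) + 1ℚ) * (fac i * fac i * (fac j * fac j))

  -- Modulo p the product of `rise 2 X (suc i)` and `dfac (suc j)` is ± `dfac N`, the quotient for
  -- (j + 1)! is 1, and the two squared products become j!² 4ʲ and i!². The 4ʲ cancels against the
  -- power of -¼, and the remaining sign (-1)ⁱ⁺ʲ = (-1)ᴹ is constant, so it can go into `K`.
  τ-mod-p : ∀ i j → i ℕ.+ j ≡ M → τ i j ≈ K * σ i j mod 1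
  τ-mod-p i j i+j≡M = ≈-trans
    (*-cong-≈ (Local-* (Local-* (Local-* lc lr₁) lr₂) lr₃) (Local-* lg₄ lg₄)
      (*-cong-≈ (Local-* (Local-* lc lr₁) lr₂) (Local-* lg₃ lg₃)
        (*-cong-≈ (Local-* lc lr₁) (Local-fromℕ 1)
          (*-cong-≈ lc lg₁ (≈-refl {c}) first) second)
        (*-cong-≈ (Local-rise j Local--2 Local-X) lg₃ (rise-mod-p j Local--2) (rise-mod-p j Local--2)))
      (*-cong-≈ (Local-rise i l-1 Local-X) lg₄ (rise-mod-p i l-1) (rise-mod-p i l-1)))
    (≈-reflexive 1 final)
    where
    c L s dN : ℚ
    L = fromℕ 4 * fromℕ (suc j) + 1ℚ
    c = κ * (-¼ ^ suc j * L)
    s = (- 1ℚ) ^ suc i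
    dN = dfac N
    l-1 : Local (- 1ℚ)
    l-1 = Local-neg (Local-fromℕ 1)
    lc : Local c
    lc = Local-* Local-κ (Local-* (Local-^ (suc j) (Local-neg Local-¼))
      (Local-+ (Local-* (Local-fromℕ 4) (Local-fromℕ (suc j))) (Local-fromℕ 1)))
    1+j<p : suc j ℕ.< suc (2 ℕ.* N)
    1+j<p = s≤s (ℕₚ.≤-trans (ℕₚ.≤-trans (ℕₚ.m≤n+m (suc j) (suc i))
        (ℕₚ.≤-reflexive (trans (cong suc (ℕₚ.+-suc i j)) (cong (2 ℕ.+_) i+j≡M))))
      (ℕₚ.m≤m+n N (N ℕ.+ 0)))
    lr₁ : Local (dN * (rise (fromℕ 2) X (suc i) * dfac (suc j)))
    lr₁ = Local-* (Local-dfac N) (Local-* (Local-rise (suc i) (Local-fromℕ 2) Local-X) (Local-dfac (suc j)))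
    lr₂ : Local (rise 1ℚ X (suc j) * fac⁻¹ (suc j))
    lr₂ = Local-* (Local-rise (suc j) (Local-fromℕ 1) Local-X) (Local-fac⁻¹ (suc j) 1+j<p)
    lr₃ : Local (rise (- fromℕ 2) X j * rise (- fromℕ 2) X j)
    lr₃ = Local-* (Local-rise j Local--2 Local-X) (Local-rise j Local--2 Local-X)
    lg₁ : Local (dN * (s * dN))
    lg₁ = Local-* (Local-dfac N) (Local-* (Local-^ (suc i) l-1) (Local-dfac N))
    lg₃ : Local ((- fromℕ 2) ^ j * fac j)
    lg₃ = Local-* (Local-^ j Local--2) (Local-fac j)
    lg₄ : Local ((- 1ℚ) ^ i * fac i)
    lg₄ = Local-* (Local-^ i l-1) (Local-fac i)
    first : dN * (rise (fromℕ 2) X (suc i) * dfac (suc j)) ≈ dN * (s * dN) mod 1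
    first = *-cong-≈ (Local-dfac N) (Local-* (Local-^ (suc i) l-1) (Local-dfac N)) (≈-refl {dN})
      (≈-trans (*-cong-≈ (Local-rise (suc i) (Local-fromℕ 2) Local-X) (Local-dfac (suc j))
          (rise-2-mod-p (suc i)) (≈-refl {dfac (suc j)}))
        (≈-reflexive 1 (trans (swap s (rise (- fromℕ 2) X (suc i)) (dfac (suc j)))
          (cong (s *_) (sym (dfac-below N (suc j) (suc i) (fromℕ-odd N)
            (trans (ℕₚ.+-comm (suc j) (suc i)) (trans (cong suc (ℕₚ.+-suc i j)) (cong (2 ℕ.+_) i+j≡M)))))))))
      where
      swap : ∀ a b c → a * b * c ≡ a * (c * b)
      swap = solve-∀ ℚ-ring
    second : rise 1ℚ X (suc j) * fac⁻¹ (suc j) ≈ 1ℚ mod 1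
    second = ≈-trans (*-cong-≈ (Local-rise (suc j) (Local-fromℕ 1) Local-X) (Local-fac⁻¹ (suc j) 1+j<p)
        (rise-mod-p (suc j) (Local-fromℕ 1)) (≈-refl {fac⁻¹ (suc j)}))
      (≈-reflexive 1 (trans (cong (λ x → x * fac (suc j) * fac⁻¹ (suc j)) (1^n≡1 (suc j)))
        (trans (swap (fac (suc j)) (fac⁻¹ (suc j))) (fac-cancel (suc j)))))
      where
      swap : ∀ a b → 1ℚ * a * b ≡ b * a
      swap = solve-∀ ℚ-ring
    final : c * (dN * (s * dN)) * 1ℚ * ((- fromℕ 2) ^ j * fac j * ((- fromℕ 2) ^ j * fac j))
        * ((- 1ℚ) ^ i * fac i * ((- 1ℚ) ^ i * fac i))
      ≡ K * σ i j
    final = begin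
      κ * (-¼ * -¼ ^ j * L) * (dN * (- 1ℚ * t * dN)) * 1ℚ * (b * fac j * (b * fac j)) * (t * fac i * (t * fac i))
        ≡⟨ regroup κ (-¼ ^ j) L dN t b (fac i) (fac j) ⟩
      κ * (dN * dN) * ((+ 1 / 4) * (t * (-¼ ^ j * (b * b)))) * (t * t) * σ i j
        ≡⟨ cong₂ (λ x y → κ * (dN * dN) * ((+ 1 / 4) * (t * x)) * y * σ i j) pow (^-inverse (- 1ℚ) (- 1ℚ) i refl) ⟩
      κ * (dN * dN) * ((+ 1 / 4) * (t * (- 1ℚ) ^ j)) * 1ℚ * σ i j
        ≡⟨ cong (_* σ i j) (ℚₚ.*-identityʳ (κ * (dN * dN) * ((+ 1 / 4) * (t * (- 1ℚ) ^ j)))) ⟩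
      κ * (dN * dN) * ((+ 1 / 4) * (t * (- 1ℚ) ^ j)) * σ i j
        ≡⟨ cong (λ x → κ * (dN * dN) * ((+ 1 / 4) * x) * σ i j) (trans (sym (^-+ (- 1ℚ) i j)) (cong ((- 1ℚ) ^_) i+j≡M)) ⟩
      K * σ i j ∎
      where
      t b : ℚ
      t = (- 1ℚ) ^ i
      b = (- fromℕ 2) ^ j
      pow : -¼ ^ j * (b * b) ≡ (- 1ℚ) ^ j
      pow = trans (cong (-¼ ^ j *_) (sym (^-distrib-* (- fromℕ 2) (- fromℕ 2) j)))
        (sym (^-distrib-* -¼ (fromℕ 4) j))
      regroup : ∀ κ v L d t b x y →
        κ * (- (+ 1 / 4) * v * L) * (d * (- 1ℚ * t * d)) * 1ℚ * (b * y * (b * y)) * (t * x * (t * x))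
        ≡ κ * (d * d) * ((+ 1 / 4) * (t * (v * (b * b)))) * (t * t) * (L * (x * x * (y * y)))
      regroup = solve-∀ ℚ-ring

  -- The weights 4j + 5 and 4i + 5 of the pairs (i, j) and (j, i) add up to 2p.
  σ-antisymmetric : ∀ i j → i ℕ.+ j ≡ M → σ i j + σ j i ≈ 0ℚ mod 1
  σ-antisymmetric i j i+j≡M = congruent (fromℕ 2 * (fac i * fac i * (fac j * fac j)))
    (Local-* (Local-fromℕ 2) (Local-* (Local-* (Local-fac i) (Local-fac i)) (Local-* (Local-fac j) (Local-fac j))))
    (trans (cong₂ (λ x y → (fromℕ 4 * x + 1ℚ) * (fac i * fac i * (fac j * fac j))
        + (fromℕ 4 * y + 1ℚ) * (fac j * fac j * (fac i * fac i))) (fromℕ-suc j) (fromℕ-suc i))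
      (trans (eq (fromℕ i) (fromℕ j) (fac i) (fac j))
        (cong (λ x → 0ℚ + x * 1ℚ * (fromℕ 2 * (fac i * fac i * (fac j * fac j)))) (sym X-value))))
    where
    X-value : X ≡ fromℕ 2 * (fromℕ 2 + (fromℕ i + fromℕ j)) + 1ℚ
    X-value = trans (fromℕ-odd N) (cong (λ x → fromℕ 2 * x + 1ℚ)
      (trans (fromℕ-+ 2 M) (cong (_+_ (fromℕ 2)) (trans (cong fromℕ (sym i+j≡M)) (fromℕ-+ i j)))))
    eq : ∀ i j x y → (fromℕ 4 * (j + 1ℚ) + 1ℚ) * (x * x * (y * y)) + (fromℕ 4 * (i + 1ℚ) + 1ℚ) * (y * y * (x * x))
      ≡ 0ℚ + (fromℕ 2 * (fromℕ 2 + (i + j)) + 1ℚ) * 1ℚ * (fromℕ 2 * (x * x * (y * y)))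
    eq = solve-∀ ℚ-ring

  -- The sum plus its reversal vanishes termwise by `σ-antisymmetric`, and 2 is invertible because p
  -- is odd.
  Σσ-mod-p : antidiagonal σ M 0 ≈ 0ℚ mod 1
  Σσ-mod-p = ≈-trans (≈-reflexive 1 (halve (antidiagonal σ M 0)))
    (≈-trans (*-cong-≈ Local-½ (Local-fromℕ 0) (≈-refl {+ 1 / 2}) doubled) (≈-reflexive 1 refl))
    where
    halve : ∀ x → x ≡ (+ 1 / 2) * (x + x)
    halve = solve-∀ ℚ-ring
    zeros : ∀ i j → antidiagonal (λ _ _ → 0ℚ) i j ≡ 0ℚ
    zeros zero    j = refl
    zeros (suc i) j = trans (ℚₚ.+-identityˡ (antidiagonal (λ _ _ → 0ℚ) i (suc j))) (zeros i (suc j))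
    doubled : antidiagonal σ M 0 + antidiagonal σ M 0 ≈ 0ℚ mod 1
    doubled = ≈-trans (≈-reflexive 1 (trans (cong (_+_ (antidiagonal σ M 0)) (antidiagonal-flip σ M))
        (sym (antidiagonal-+ σ (λ a b → σ b a) M 0))))
      (≈-trans (antidiagonal-≈ M 0 (λ a b e → σ-antisymmetric a b (trans e (ℕₚ.+-identityʳ M))))
        (≈-reflexive 1 (zeros M 0)))

  interior-mod-p⁵ : antidiagonal (λ i j → term (suc i) (suc j)) M 0 ≈ 0ℚ mod 5
  interior-mod-p⁵ = lift (≈-trans (antidiagonal-≈ M 0 (λ a b e → τ-mod-p a b (trans e (ℕₚ.+-identityʳ M))))
      (≈-trans (≈-reflexive 1 (antidiagonal-scale K σ M 0))
      (≈-trans (*-cong-≈ Local-K (Local-fromℕ 0) (≈-refl {K}) Σσ-mod-p) (≈-reflexive 1 (ℚₚ.*-zeroʳ K)))))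
    where
    eq : ∀ x q → x * (x * (x * (x * 1ℚ))) * (0ℚ + x * 1ℚ * q) ≡ 0ℚ + x * (x * (x * (x * (x * 1ℚ)))) * q
    eq = solve-∀ ℚ-ring
    lift : antidiagonal τ M 0 ≈ 0ℚ mod 1 → antidiagonal (λ i j → term (suc i) (suc j)) M 0 ≈ 0ℚ mod 5
    lift (congruent q lq e) = congruent q lq (begin
      antidiagonal (λ i j → term (suc i) (suc j)) M 0
        ≡⟨ antidiagonal-cong M 0 (λ a b e → term-interior a b (trans e (ℕₚ.+-identityʳ M))) ⟩
      antidiagonal (λ i j → X ^ 4 * τ i j) M 0
        ≡⟨ antidiagonal-scale (X ^ 4) τ M 0 ⟩
      X ^ 4 * antidiagonal τ M 0
        ≡⟨ cong (X ^ 4 *_) e ⟩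
      X ^ 4 * (0ℚ + X ^ 1 * q)
        ≡⟨ eq X q ⟩
      0ℚ + X ^ 5 * q ∎)

-- Evaluation of the end terms modulo p⁵

module Evaluation (M : ℕ) (p-prime : Prime (suc (2 ℕ.* (2 ℕ.+ M)))) where
  open Interior M p-prime
  open Boundary N

  private
    -- `t` is 2 to the power p - 1, that is 1 + z, and `m` is the expansion of (1 + z)⁻² up to z².
    -- As p divides z, `m` inverts t² modulo p³.
    q t z m : ℚ
    q = fermatQuotient (suc (2 ℕ.* N)) 2
    t = fromℕ 4 ^ N
    z = X * q
    m = 1ℚ - fromℕ 2 * z + fromℕ 3 * (z * z)

  t≡1+z : t ≡ 1ℚ + z
  t≡1+z = sym (begin
    1ℚ + X * q                              ≡⟨ cong (_+_ 1ℚ) (ℚₚ.*-comm X q) ⟩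
    1ℚ + q * X                              ≡⟨ cong (_+_ 1ℚ) (/-*-cancel (+ (2 ℕ.^ (2 ℕ.* N)) ℤ.- + 1) (suc (2 ℕ.* N))) ⟩
    1ℚ + fromℤ (+ (2 ℕ.^ (2 ℕ.* N)) ℤ.- + 1) ≡⟨ cong (_+_ 1ℚ) (fromℤ-+ (+ (2 ℕ.^ (2 ℕ.* N))) (ℤ.- + 1)) ⟩
    1ℚ + (fromℕ (2 ℕ.^ (2 ℕ.* N)) + - 1ℚ)   ≡⟨ cancel (fromℕ (2 ℕ.^ (2 ℕ.* N))) ⟩
    fromℕ (2 ℕ.^ (2 ℕ.* N))                 ≡⟨ cong fromℕ (ℕₚ.^-*-assoc 2 2 N) ⟨
    fromℕ (4 ℕ.^ N)                         ≡⟨ fromℕ-^ 4 N ⟩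
    t                                       ∎)
    where
    cancel : ∀ x → 1ℚ + (x + - 1ℚ) ≡ x
    cancel = solve-∀ ℚ-ring

  Local-t : Local t
  Local-t = Local-^ N (Local-fromℕ 4)

  Local--½ : Local (- ½)
  Local--½ = Local-neg Local-½

  Local--1 : Local (- 1ℚ)
  Local--1 = Local-neg (Local-fromℕ 1)

  Local-A : Local A
  Local-A = Local-Π N (Local-* Local--1 Local-X) N<p

  Local-B : Local B
  Local-B = Local-Π N (Local-* Local--½ Local-X) N<p

  Local-A⁺ : Local A⁺
  Local-A⁺ = Local-Π N (Local-* (Local-fromℕ 1) Local-X) N<p

  Local-B⁺ : Local B⁺
  Local-B⁺ = Local-Π N (Local-* Local-½ Local-X) N<p

  -- From A = t B with A ≡ B ≡ 1 (mod p): this is Fermat's little theorem.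
  Local-q : Local q
  Local-q = divide (Π-mod-p N Local--1 N<p) (Π-mod-p N Local--½ N<p)
    where
    divide : A ≈ 1ℚ mod 1 → B ≈ 1ℚ mod 1 → Local q
    divide (congruent a la eA) (congruent b lb eB) = subst Local (sym q≡) (Local-+ la (Local-neg (Local-* Local-t lb)))
      where
      step₁ : ∀ t x q a b → t ≡ 1ℚ + x * q → 1ℚ + x * 1ℚ * a ≡ t * (1ℚ + x * 1ℚ * b) → q * x ≡ (a + - (t * b)) * x
      step₁ t x q a b t≡ e = begin
        q * x                                        ≡⟨ e₁ x q ⟩
        (1ℚ + x * q) - 1ℚ                            ≡⟨ cong (_- 1ℚ) t≡ ⟨
        t - 1ℚ                                       ≡⟨ e₂ t x b ⟩
        t * (1ℚ + x * 1ℚ * b) - 1ℚ - t * b * x       ≡⟨ cong (λ y → y - 1ℚ - t * b * x) e ⟨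
        1ℚ + x * 1ℚ * a - 1ℚ - t * b * x             ≡⟨ e₃ x a b t ⟩
        (a + - (t * b)) * x                          ∎
        where
        e₁ : ∀ x q → q * x ≡ (1ℚ + x * q) - 1ℚ
        e₁ = solve-∀ ℚ-ring
        e₂ : ∀ t x b → t - 1ℚ ≡ t * (1ℚ + x * 1ℚ * b) - 1ℚ - t * b * x
        e₂ = solve-∀ ℚ-ring
        e₃ : ∀ x a b t → 1ℚ + x * 1ℚ * a - 1ℚ - t * b * x ≡ (a + - (t * b)) * x
        e₃ = solve-∀ ℚ-ring
      q≡ : q ≡ a + - (t * b)
      q≡ = *-cancelʳ-fromℕ (suc (2 ℕ.* N))
        (step₁ t X q a b t≡1+z (trans (sym eA) (trans A≡4^N*B (cong (t *_) eB))))

  Local-z : Local z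
  Local-z = Local-* Local-X Local-q

  Local-m : Local m
  Local-m = Local-+ (Local-+ (Local-fromℕ 1) (Local-neg (Local-* (Local-fromℕ 2) Local-z)))
    (Local-* (Local-fromℕ 3) (Local-* Local-z Local-z))

  X²-sumInvSq : ∀ c → Local c → c * (X * X) * sumInvSq N ≈ 0ℚ mod 3
  X²-sumInvSq c lc = lift (sumInvSq-mod-p (s≤s (s≤s z≤n)))
    where
    eq : ∀ c x q → c * (x * x) * (0ℚ + x * 1ℚ * q) ≡ 0ℚ + x * (x * (x * 1ℚ)) * (c * q)
    eq = solve-∀ ℚ-ring
    lift : sumInvSq N ≈ 0ℚ mod 1 → c * (X * X) * sumInvSq N ≈ 0ℚ mod 3
    lift (congruent r lr e) = congruent (c * r) (Local-* lc lr)
      (trans (cong (c * (X * X) *_) e) (eq c X r))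

  conjugate≈1 : ∀ s → Local s → Π (s * X) N * Π (- s * X) N ≈ 1ℚ mod 3
  conjugate≈1 s ls = ≈-trans (Π-conjugate N ls N<p)
    (≈-trans (+-cong-≈ (≈-refl {1ℚ}) (negate (X²-sumInvSq (s * s) (Local-* ls ls)))) (≈-reflexive 3 refl))
    where
    eq : ∀ u r → - (0ℚ + u * r) ≡ 0ℚ + u * (- r)
    eq = solve-∀ ℚ-ring
    negate : ∀ {x} → x ≈ 0ℚ mod 3 → - x ≈ 0ℚ mod 3
    negate (congruent r lr e) = congruent (- r) (Local-neg lr) (trans (cong -_ e) (eq (X ^ 3) r))

  B⁺B≈1 : B⁺ * B ≈ 1ℚ mod 3
  B⁺B≈1 = conjugate≈1 ½ Local-½

  A⁺A≈1 : A⁺ * A ≈ 1ℚ mod 3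
  A⁺A≈1 = conjugate≈1 1ℚ (Local-fromℕ 1)

  B²≈A : B * B ≈ A mod 3
  B²≈A = ≈-trans (Π-half² N Local--½ N<p)
    (≈-trans (+-cong-≈ (≈-refl {A}) (X²-sumInvSq (- ½ * - ½) (Local-* Local--½ Local--½)))
      (≈-reflexive 3 (ℚₚ.+-identityʳ A)))

  -- Cancel `B` from t B = A ≡ B². Its inverse modulo p³ is `A⁺ * t`, since A⁺ t B = A⁺ A ≡ 1.
  t≈B : t ≈ B mod 3
  t≈B = ≈-trans (≈-reflexive 3 (sym (ℚₚ.*-identityʳ t)))
    (≈-trans (*-cong-≈ Local-t (Local-* Local-A⁺ Local-A) (≈-refl {t}) (≈-sym A⁺A≈1))
    (≈-trans (≈-reflexive 3 (trans (cong (λ y → t * (A⁺ * y)) A≡4^N*B) (regroup t A⁺ B)))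
    (≈-trans (*-cong-≈ (Local-* Local-A⁺ Local-t) (Local-* Local-B Local-B) (≈-refl {A⁺ * t})
        (≈-trans (≈-reflexive 3 (sym A≡4^N*B)) (≈-sym B²≈A)))
    (≈-trans (≈-reflexive 3 (trans (regroup′ A⁺ t B) (cong (λ y → B * (A⁺ * y)) (sym A≡4^N*B))))
    (≈-trans (*-cong-≈ Local-B (Local-fromℕ 1) (≈-refl {B}) A⁺A≈1) (≈-reflexive 3 (ℚₚ.*-identityʳ B)))))))
    where
    regroup : ∀ t A⁺ B → t * (A⁺ * (t * B)) ≡ A⁺ * t * (t * B)
    regroup = solve-∀ ℚ-ring
    regroup′ : ∀ A⁺ t B → A⁺ * t * (B * B) ≡ B * (A⁺ * (t * B))
    regroup′ = solve-∀ ℚ-ring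

  -- A⁺ is the inverse of A = t B ≡ t², and so is m. The witness comes from m (1 + z)² = 1 + 4z³ +
  -- 3z⁴ with z = X q.
  A⁺≈m : A⁺ ≈ m mod 3
  A⁺≈m = ≈-sym (≈-trans (≈-reflexive 3 (sym (ℚₚ.*-identityʳ m)))
    (≈-trans (*-cong-≈ Local-m (Local-* Local-A⁺ Local-A) (≈-refl {m}) (≈-sym A⁺A≈1))
    (≈-trans (*-cong-≈ Local-m (Local-* Local-A⁺ (Local-* Local-t Local-t)) (≈-refl {m})
        (*-cong-≈ Local-A⁺ (Local-* Local-t Local-t) (≈-refl {A⁺})
          (≈-trans (≈-reflexive 3 A≡4^N*B) (*-cong-≈ Local-t Local-t (≈-refl {t}) (≈-sym t≈B)))))
    (congruent (A⁺ * (fromℕ 4 * (q * q * q) + fromℕ 3 * (X * (q * q * (q * q)))))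
      (Local-* Local-A⁺ (Local-+ (Local-* (Local-fromℕ 4) (Local-* lq² Local-q))
        (Local-* (Local-fromℕ 3) (Local-* Local-X (Local-* lq² lq²)))))
      (trans (cong (λ y → m * (A⁺ * (y * y))) t≡1+z) (expand A⁺ X q))))))
    where
    lq² : Local (q * q)
    lq² = Local-* Local-q Local-q
    expand : ∀ A⁺ x q → let z = x * q in
      (1ℚ - fromℕ 2 * z + fromℕ 3 * (z * z)) * (A⁺ * ((1ℚ + z) * (1ℚ + z)))
      ≡ A⁺ + x * (x * (x * 1ℚ)) * (A⁺ * (fromℕ 4 * (q * q * q) + fromℕ 3 * (x * (q * q * (q * q)))))
    expand = solve-∀ ℚ-ring

  Local-Y : Local Y
  Local-Y = Local-* (Local-* (Local-fac N) (Local-fac N)) (Local-fac⁻¹ (2 ℕ.* N) 2N<p)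

  -- Modulo p³ the product becomes A² · 1 · m · Y², and `Y²A²≡1` removes A.
  last-factor : B * B * (B * B) * (B⁺ * B) * A⁺ * (Y * Y) ≈ m mod 3
  last-factor = ≈-trans
    (*-cong-≈ (Local-* (Local-* (Local-* lB² lB²) (Local-* Local-B⁺ Local-B)) Local-A⁺) lY²
      (*-cong-≈ (Local-* (Local-* lB² lB²) (Local-* Local-B⁺ Local-B)) Local-m
        (*-cong-≈ (Local-* lB² lB²) (Local-fromℕ 1) (*-cong-≈ lB² Local-A B²≈A B²≈A) B⁺B≈1) A⁺≈m)
      (≈-refl {Y * Y}))
    (≈-reflexive 3 (trans (regroup A m Y) (trans (cong (m *_) Y²A²≡1) (ℚₚ.*-identityʳ m))))
    where
    lB² : Local (B * B)
    lB² = Local-* Local-B Local-B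
    lY² : Local (Y * Y)
    lY² = Local-* Local-Y Local-Y
    regroup : ∀ A m Y → A * A * 1ℚ * m * (Y * Y) ≡ m * (Y * Y * (A * A))
    regroup = solve-∀ ℚ-ring

  u-value : u * (X + 1ℚ) ≡ fromℕ 2
  u-value = begin
    u * (X + 1ℚ)                            ≡⟨ cong (u *_) (trans (cong (_+ 1ℚ) (fromℕ-odd N)) (eq (fromℕ N))) ⟩
    u * ((fromℕ N + 1ℚ) * fromℕ 2)          ≡⟨ cong (λ y → u * (y * fromℕ 2)) (fromℕ-suc N) ⟨
    u * (fromℕ (suc N) * fromℕ 2)           ≡⟨ ℚₚ.*-assoc u (fromℕ (suc N)) (fromℕ 2) ⟨
    u * fromℕ (suc N) * fromℕ 2             ≡⟨ cong (_* fromℕ 2) (inv-cancel (suc N)) ⟩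
    1ℚ * fromℕ 2                            ≡⟨⟩
    fromℕ 2                                 ∎
    where
    eq : ∀ n → fromℕ 2 * n + 1ℚ + 1ℚ ≡ (n + 1ℚ) * fromℕ 2
    eq = solve-∀ ℚ-ring

  Local-u : Local u
  Local-u = Local-inv (suc N) (s≤s (ℕₚ.≤-trans (ℕₚ.≤-reflexive (ℕₚ.+-comm 1 N)) (ℕₚ.+-monoʳ-≤ N (s≤s z≤n))))

  -- Uses 2X + 1 = (X + 1)² (1 - X²) + X³ (2 + X) together with u (X + 1) = 2. The prefactor X²
  -- turns every multiple of X³, including the error of `B⁺B≈1`, into a multiple of X⁵.
  first-term : term N 0 ≈ fromℕ 12 * (X * X) - fromℕ 12 * (X * X * (X * X)) mod 5
  first-term = lift B⁺B≈1
    where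
    lift : B⁺ * B ≈ 1ℚ mod 3 → term N 0 ≈ fromℕ 12 * (X * X) - fromℕ 12 * (X * X * (X * X)) mod 5
    lift (congruent r lr e) = congruent
      (fromℕ 3 * (u * u) * (fromℕ 2 + X + (fromℕ 2 * X + 1ℚ) * (r * (fromℕ 2 + X ^ 3 * r))))
      (Local-* (Local-* (Local-fromℕ 3) (Local-* Local-u Local-u))
        (Local-+ (Local-+ (Local-fromℕ 2) Local-X)
          (Local-* (Local-+ (Local-* (Local-fromℕ 2) Local-X) (Local-fromℕ 1))
            (Local-* lr (Local-+ (Local-fromℕ 2) (Local-* (Local-^ 3 Local-X) lr))))))
      (begin
        term N 0
          ≡⟨ term-N-0 ⟩
        fromℕ 3 * (X * X) * (fromℕ 2 * X + 1ℚ) * (B⁺ * B * (B⁺ * B)) * (u * u)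
          ≡⟨ cong (λ y → fromℕ 3 * (X * X) * (fromℕ 2 * X + 1ℚ) * (y * y) * (u * u)) e ⟩
        fromℕ 3 * (X * X) * (fromℕ 2 * X + 1ℚ) * ((1ℚ + X ^ 3 * r) * (1ℚ + X ^ 3 * r)) * (u * u)
          ≡⟨ expand X u r ⟩
        fromℕ 3 * (u * (X + 1ℚ) * (u * (X + 1ℚ))) * (X * X - X * X * (X * X)) + rest
          ≡⟨ cong (λ y → fromℕ 3 * (y * y) * (X * X - X * X * (X * X)) + rest) u-value ⟩
        fromℕ 12 * (X * X - X * X * (X * X)) + rest
          ≡⟨ cong (_+ rest) (distribute (X * X) (X * X * (X * X))) ⟩
        fromℕ 12 * (X * X) - fromℕ 12 * (X * X * (X * X)) + rest ∎)
      where
      rest : ℚ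
      rest = X ^ 5 * (fromℕ 3 * (u * u) * (fromℕ 2 + X + (fromℕ 2 * X + 1ℚ) * (r * (fromℕ 2 + X ^ 3 * r))))
      distribute : ∀ a b → fromℕ 12 * (a - b) ≡ fromℕ 12 * a - fromℕ 12 * b
      distribute = solve-∀ ℚ-ring
      expand : ∀ x u r → let x³ = x * (x * (x * 1ℚ)) in
        fromℕ 3 * (x * x) * (fromℕ 2 * x + 1ℚ) * ((1ℚ + x³ * r) * (1ℚ + x³ * r)) * (u * u)
        ≡ fromℕ 3 * (u * (x + 1ℚ) * (u * (x + 1ℚ))) * (x * x - x * x * (x * x))
          + x * (x * x³) * (fromℕ 3 * (u * u) * (fromℕ 2 + x + (fromℕ 2 * x + 1ℚ) * (r * (fromℕ 2 + x³ * r))))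
      expand = solve-∀ ℚ-ring

  last-term : term 0 N ≈ fromℕ 3 * (fromℕ 2 * X - 1ℚ) * (fromℕ 2 * X + 1ℚ) * (X * X) * m mod 5
  last-term = lift last-factor
    where
    c : ℚ
    c = fromℕ 3 * (fromℕ 2 * X - 1ℚ) * (fromℕ 2 * X + 1ℚ)
    lc : Local c
    lc = Local-* (Local-* (Local-fromℕ 3) (Local-+ (Local-* (Local-fromℕ 2) Local-X) Local--1))
      (Local-+ (Local-* (Local-fromℕ 2) Local-X) (Local-fromℕ 1))
    eq : ∀ c x m r → c * (x * x) * (m + x * (x * (x * 1ℚ)) * r)
       ≡ c * (x * x) * m + x * (x * (x * (x * (x * 1ℚ)))) * (c * r)
    eq = solve-∀ ℚ-ring
    lift : B * B * (B * B) * (B⁺ * B) * A⁺ * (Y * Y) ≈ m mod 3 → term 0 N ≈ c * (X * X) * m mod 5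
    lift (congruent r lr e) = congruent (c * r) (Local-* lc lr)
      (trans term-0-N (trans (ℚₚ.*-assoc (c * (X * X)) (B * B * (B * B) * (B⁺ * B) * A⁺) (Y * Y))
        (trans (cong (c * (X * X) *_) e) (eq c X m r))))

  rhs : ℚ
  rhs = fromℕ 9 * X ^ 2 + fromℕ 6 * X ^ 3 * q - fromℕ 9 * X ^ 4 * q ^ 2

  Local-rhs : Local rhs
  Local-rhs = Local-+ (Local-+ (Local-* (Local-fromℕ 9) (Local-^ 2 Local-X))
      (Local-* (Local-* (Local-fromℕ 6) (Local-^ 3 Local-X)) Local-q))
    (Local-neg (Local-* (Local-* (Local-fromℕ 9) (Local-^ 4 Local-X)) (Local-^ 2 Local-q)))

  antidiagonal-ends : antidiagonal term N 0
    ≡ term N 0 + (antidiagonal (λ i j → term (suc i) (suc j)) M 0 + term 0 N)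
  antidiagonal-ends = cong (_+_ (term N 0)) (trans (antidiagonal-shift term (suc M) 0)
    (trans (antidiagonal-last (λ a b → term a (suc b)) M 0)
      (cong (λ k → antidiagonal (λ i j → term (suc i) (suc j)) M 0 + term 0 (2 ℕ.+ k)) (ℕₚ.+-identityʳ M))))

  ∑-summand-≈ : ∑[ k ≤ N ] summand (toℕ k) ≈ rhs mod 5
  ∑-summand-≈ = ≈-trans (≈-reflexive 5 (trans (∑-summand N) antidiagonal-ends))
    (≈-trans (+-cong-≈ first-term (+-cong-≈ interior-mod-p⁵ last-term))
      -- The terms ± 12 X⁴ of the two ends cancel. The witness collects -24 X⁴ z + 36 X⁴ z² divided
      -- by X⁵, where z = X q.
      (congruent (fromℕ 12 * (fromℕ 3 * (X * (q * q)) - fromℕ 2 * q))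
        (Local-* (Local-fromℕ 12) (Local-+ (Local-* (Local-fromℕ 3) (Local-* Local-X (Local-* Local-q Local-q)))
          (Local-neg (Local-* (Local-fromℕ 2) Local-q))))
        (expand X q)))
    where
    expand : ∀ x q → let z = x * q in
      fromℕ 12 * (x * x) - fromℕ 12 * (x * x * (x * x))
        + (0ℚ + fromℕ 3 * (fromℕ 2 * x - 1ℚ) * (fromℕ 2 * x + 1ℚ) * (x * x)
            * (1ℚ - fromℕ 2 * z + fromℕ 3 * (z * z)))
      ≡ fromℕ 9 * (x * (x * 1ℚ)) + fromℕ 6 * (x * (x * (x * 1ℚ))) * q
          - fromℕ 9 * (x * (x * (x * (x * 1ℚ)))) * (q * (q * 1ℚ))
        + x * (x * (x * (x * (x * 1ℚ)))) * (fromℕ 12 * (fromℕ 3 * (x * (q * q)) - fromℕ 2 * q))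
    expand = solve-∀ ℚ-ring

  conclusion : ∑[ k ≤ N ] summand (toℕ k) ≡ rhs [mod suc (2 ℕ.* N) ^ 5 ]
  conclusion = record
    { integralˡ  = Local⇒Integral (Local-≈ ∑-summand-≈ Local-rhs)
    ; integralʳ  = Local⇒Integral Local-rhs
    ; difference = quotient , Local⇒Integral integral
        , trans (cong (_- rhs) congruence) (cancel rhs (X ^ 5 * quotient))
    }
    where
    open _≈_mod_ ∑-summand-≈
    cancel : ∀ y u → y + u - y ≡ u
    cancel = solve-∀ ℚ-ring

-- The theorem for all odd primes

parity : ∀ n → ∃ λ k → n ≡ 2 ℕ.* k ⊎ n ≡ suc (2 ℕ.* k)
parity zero    = 0 , inj₁ refl
parity (suc n) with parity n
... | k , inj₁ refl = k , inj₂ refl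
... | k , inj₂ refl = suc k , inj₁ (double k)
  where
  double : ∀ k → suc (suc (2 ℕ.* k)) ≡ 2 ℕ.* suc k
  double = ℕ-Solver.solve-∀

half : ∀ k → (2 ℕ.* k) ℕ./ 2 ≡ k
half k = trans (cong (ℕ._/ 2) (ℕₚ.*-comm 2 k)) (m*n/n≡m k 2)

theorem1p1 : (p : ℕ) (pp : Prime p) → 2 ℕ.< p →
    let P = fromℕ p
        q = fermatQuotient p {{prime⇒nonZero pp}} 2
    in (∑[ k ≤ (p ℕ.∸ 1) ℕ./ 2 ] summand (toℕ k))
         ≡ fromℕ 9 * P ^ 2 + fromℕ 6 * P ^ 3 * q - fromℕ 9 * P ^ 4 * q ^ 2 [mod p ^ 5 ]
theorem1p1 p pp 2<p with parity p
theorem1p1 p pp 2<p | k , inj₁ refl with prime⇒irreducible pp (m∣m*n k)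
... | inj₂ 2≡p = contradiction 2≡p (ℕₚ.<⇒≢ 2<p)
-- Here p would be 1.
theorem1p1 p pp (s≤s ()) | 0 , inj₂ refl
-- The prime 3, checked by computation: the sum is 9 - 9 = 0, the Fermat quotient is 1, the right
-- side is 81 + 162 - 729 = -486, and the difference is 2 · 3⁵.
theorem1p1 p pp 2<p | 1 , inj₂ refl = record
  { integralˡ  = Coprime-1
  ; integralʳ  = Coprime-1
  ; difference = fromℕ 2 , Coprime-1 , refl
  }
  where
  Coprime-1 : Coprime 1 3
  Coprime-1 = 1-coprimeTo 3
theorem1p1 p pp 2<p | suc (suc M) , inj₂ refl =
  subst (λ n → ∑[ k ≤ n ] summand (toℕ k) ≡ Evaluation.rhs M pp [mod p ^ 5 ])
    (sym (half (2 ℕ.+ M))) (Evaluation.conclusion M pp)
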